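{- Let $\Gamma$ be a Shilla distance-regular graph with $b(\Gamma)=3$. Then $\Gamma$ has one of the following intersection arrays: $\{12,10,5;1,1,8\}$, $\{12,10,2;1,2,8\}$, $\{12,10,3;1,3,8\}$, $\{15,12,6;1,2,10\}$, $\{24,18,9;1,1,16\}$, $\{27,20,10;1,2,18\}$, $\{30,22,9;1,3,20\}$, $\{42,30,12;1,6,28\}$, $\{60,42,18;1,6,40\}$, $\{69,48,24;1,4,46\}$, $\{93,64,24;1,6,62\}$, $\{105,72,24;1,12,70\}$.
   Context: A connected graph $\Gamma$ of diameter $D$ is distance-regular if there are integers $b_i,c_i$ ($0\le i\le D$) such that for any two vertices $x,y$ at distance $i$, exactly $c_i$ neighbours of $y$ are at distance $i-1$ from $x$ and exactly $b_i$ neighbours of $y$ are at distance $i+1$ from $x$. Then $\Gamma$ is regular of valency $k=b_0$, and $a_i:=k-b_i-c_i$. The intersection array is $\{b_0,b_1,\dots,b_{D-1};c_1,\dots,c_D\}$. The eigenvalues of $\Gamma$ are those of its adjacency matrix; $\Gamma$ has exactly $D+1$ distinct eigenvalues $k=\theta_0>\theta_1>\dots>\theta_D$. A Shilla distance-regular graph is a distance-regular graph of diameter $3$ whose second largest eigenvalue satisfies $\theta_1=a_3$. For such graphs $k=(a_3-a_1)a_3$, and one defines $b(\Gamma):=a_3-a_1=k/a_3$. -}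

module Defs where

open import Data.Bool.Base using (if_then_else_)
open import Data.Fin.Base using (Fin; zero; suc; toℕ; inject₁)
open import Data.Fin.Patterns using (1F; 3F)
open import Data.Fin.Properties using (any?)
import Data.Fin.Properties as Fin
open import Data.Integer.Base as ℤ using (ℤ; +_)
open import Data.List.Base using (length; filter; allFin)
open import Data.Nat.Base as ℕ using (ℕ; zero; suc)
import Data.Nat.Properties as ℕ
open import Data.Product.Base using (∃; ∃-syntax; Σ-syntax; _×_; _,_)
open import Data.Rational.Base as ℚ using (ℚ; 0ℚ; 1ℚ; ½; ∣_∣; 1/_; Positive; positive)
import Data.Rational.Properties as ℚ
open import Data.Rational.Solver using (module +-*-Solver)
open import Data.Sum.Base using (_⊎_)
open import Data.Vec.Base using (Vec; tabulate)
open import Data.Vec.Functional using (Vector; foldr)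
open import Level using (0ℓ)
open import Relation.Binary.Core using (Rel)
open import Relation.Binary.Definitions using (Decidable; Symmetric; Irreflexive)
open import Relation.Binary.PropositionalEquality using (_≡_; refl; sym; trans; cong; subst)
open import Relation.Nullary.Decidable using (Dec; does; ¬?; _×-dec_)
open import Relation.Nullary.Negation using (¬_)
open import Relation.Unary using (Pred) renaming (Decidable to Decidable₁)

------------------------------------------------------------------------
-- Real numbers, as Cauchy sequences of rationals

CloseFrom : (ℕ → ℚ) → ℚ → ℕ → Set
CloseFrom s ε N = ∀ m n → N ℕ.≤ m → N ℕ.≤ n → ∣ s m ℚ.- s n ∣ ℚ.< ε

IsCauchy : (ℕ → ℚ) → Set
IsCauchy s = ∀ ε → 0ℚ ℚ.< ε → ∃[ N ] CloseFrom s ε N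

record ℝ : Set where
  constructor mkℝ
  field
    seq    : ℕ → ℚ
    cauchy : IsCauchy seq

open ℝ public

private
  module _ where
    open +-*-Solver

    half+half : ∀ ε → ε ℚ.* ½ ℚ.+ ε ℚ.* ½ ≡ ε
    half+half ε = trans (sym (ℚ.*-distribˡ-+ ε ½ ½)) (ℚ.*-identityʳ ε)

    split-+ : ∀ p q r s →
      (p ℚ.+ q) ℚ.- (r ℚ.+ s) ≡ (p ℚ.- r) ℚ.+ (q ℚ.- s)
    split-+ = solve 4 (λ p q r s →
      (p :+ q) :- (r :+ s) := (p :- r) :+ (q :- s)) refl

    split-* : ∀ p q r s →
      p ℚ.* q ℚ.- r ℚ.* s ≡ p ℚ.* (q ℚ.- s) ℚ.+ s ℚ.* (p ℚ.- r)
    split-* = solve 4 (λ p q r s →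
      p :* q :- r :* s := p :* (q :- s) :+ s :* (p :- r)) refl

    split-bound : ∀ p q → p ≡ (p ℚ.- q) ℚ.+ q
    split-bound = solve 2 (λ p q → p := (p :- q) :+ q) refl

  open ℚ.≤-Reasoning

  ∣sum∣<ε : ∀ p q r s ε → ∣ p ℚ.- r ∣ ℚ.< ε ℚ.* ½ → ∣ q ℚ.- s ∣ ℚ.< ε ℚ.* ½ →
    ∣ (p ℚ.+ q) ℚ.- (r ℚ.+ s) ∣ ℚ.< ε
  ∣sum∣<ε p q r s ε p-r q-s = begin-strict
    ∣ (p ℚ.+ q) ℚ.- (r ℚ.+ s) ∣      ≡⟨ cong ∣_∣ (split-+ p q r s) ⟩
    ∣ (p ℚ.- r) ℚ.+ (q ℚ.- s) ∣      ≤⟨ ℚ.∣p+q∣≤∣p∣+∣q∣ (p ℚ.- r) (q ℚ.- s) ⟩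
    ∣ p ℚ.- r ∣ ℚ.+ ∣ q ℚ.- s ∣      <⟨ ℚ.+-mono-< p-r q-s ⟩
    ε ℚ.* ½ ℚ.+ ε ℚ.* ½              ≡⟨ half+half ε ⟩
    ε                                ∎

  ∣prod∣<Bδ : ∀ p q {B δ} → 0ℚ ℚ.< B → ∣ p ∣ ℚ.≤ B → ∣ q ∣ ℚ.< δ →
    ∣ p ℚ.* q ∣ ℚ.< B ℚ.* δ
  ∣prod∣<Bδ p q {B} {δ} B>0 p≤B q<δ = begin-strict
    ∣ p ℚ.* q ∣        ≡⟨ ℚ.∣p*q∣≡∣p∣*∣q∣ p q ⟩
    ∣ p ∣ ℚ.* ∣ q ∣    ≤⟨ ℚ.*-monoʳ-≤-nonNeg ∣ q ∣ {{ℚ.nonNegative (ℚ.0≤∣p∣ q)}} p≤B ⟩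
    B ℚ.* ∣ q ∣        <⟨ ℚ.*-monoʳ-<-pos B {{positive B>0}} q<δ ⟩
    B ℚ.* δ            ∎

  ∣pq-rs∣<ε : ∀ p q r s {B C δ} → 0ℚ ℚ.< B → 0ℚ ℚ.< C → ∣ p ∣ ℚ.≤ B → ∣ s ∣ ℚ.≤ C →
    ∣ p ℚ.- r ∣ ℚ.< δ → ∣ q ℚ.- s ∣ ℚ.< δ →
    ∣ p ℚ.* q ℚ.- r ℚ.* s ∣ ℚ.< (B ℚ.+ C) ℚ.* δ
  ∣pq-rs∣<ε p q r s {B} {C} {δ} B>0 C>0 p≤B s≤C p-r q-s = begin-strict
    ∣ p ℚ.* q ℚ.- r ℚ.* s ∣                         ≡⟨ cong ∣_∣ (split-* p q r s) ⟩
    ∣ p ℚ.* (q ℚ.- s) ℚ.+ s ℚ.* (p ℚ.- r) ∣         ≤⟨ ℚ.∣p+q∣≤∣p∣+∣q∣ (p ℚ.* (q ℚ.- s)) (s ℚ.* (p ℚ.- r)) ⟩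
    ∣ p ℚ.* (q ℚ.- s) ∣ ℚ.+ ∣ s ℚ.* (p ℚ.- r) ∣     <⟨ ℚ.+-mono-<
      (∣prod∣<Bδ p (q ℚ.- s) B>0 p≤B q-s) (∣prod∣<Bδ s (p ℚ.- r) C>0 s≤C p-r) ⟩
    B ℚ.* δ ℚ.+ C ℚ.* δ                             ≡⟨ ℚ.*-distribʳ-+ δ B C ⟨
    (B ℚ.+ C) ℚ.* δ                                 ∎

  divide : ∀ {B ε} → 0ℚ ℚ.< B → 0ℚ ℚ.< ε → ∃[ δ ] 0ℚ ℚ.< δ × B ℚ.* δ ≡ ε
  divide {B} {ε} B>0 ε>0 = 1/B ℚ.* ε , δ>0 , B*δ≡ε
    where
    instance
      B-pos : Positive B
      B-pos = positive B>0
    1/B : ℚ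
    1/B = (1/ B) {{ℚ.pos⇒nonZero B}}
    δ>0 : 0ℚ ℚ.< 1/B ℚ.* ε
    δ>0 = ℚ.positive⁻¹ _ {{ℚ.pos*pos⇒pos 1/B {{ℚ.1/pos⇒pos B}} ε {{positive ε>0}}}}
    B*δ≡ε : B ℚ.* (1/B ℚ.* ε) ≡ ε
    B*δ≡ε = trans (sym (ℚ.*-assoc B 1/B ε))
      (trans (cong (ℚ._* ε) (ℚ.*-inverseʳ B {{ℚ.pos⇒nonZero B}})) (ℚ.*-identityˡ ε))

  BoundedBy : (ℕ → ℚ) → ℚ → ℕ → Set
  BoundedBy s B K = ∀ n → K ℕ.≤ n → ∣ s n ∣ ℚ.≤ B

  bounded : ∀ s → IsCauchy s → ∃[ B ] 0ℚ ℚ.< B × ∃[ N ] BoundedBy s B N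
  bounded s cs = from (cs 1ℚ (ℚ.positive⁻¹ 1ℚ))
    where
    from : ∃ (CloseFrom s 1ℚ) → ∃[ B ] 0ℚ ℚ.< B × ∃[ N ] BoundedBy s B N
    from (N , close) =
      1ℚ ℚ.+ ∣ s N ∣ , ℚ.+-mono-<-≤ (ℚ.positive⁻¹ 1ℚ) (ℚ.0≤∣p∣ (s N)) , N , λ n N≤n → begin
      ∣ s n ∣                        ≡⟨ cong ∣_∣ (split-bound (s n) (s N)) ⟩
      ∣ (s n ℚ.- s N) ℚ.+ s N ∣      ≤⟨ ℚ.∣p+q∣≤∣p∣+∣q∣ (s n ℚ.- s N) (s N) ⟩
      ∣ s n ℚ.- s N ∣ ℚ.+ ∣ s N ∣    ≤⟨ ℚ.+-monoˡ-≤ ∣ s N ∣ (ℚ.<⇒≤ (close n N N≤n ℕ.≤-refl)) ⟩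
      1ℚ ℚ.+ ∣ s N ∣                 ∎

  -- The witnesses are passed to local functions rather than to 'with':
  -- with-abstraction would normalise rational arithmetic, which is very slow.
  abstract
    +-cauchy : ∀ s t → IsCauchy s → IsCauchy t → IsCauchy (λ n → s n ℚ.+ t n)
    +-cauchy s t cs ct ε ε>0 = combine (cs (ε ℚ.* ½) δ>0) (ct (ε ℚ.* ½) δ>0)
      where
      δ>0 : 0ℚ ℚ.< ε ℚ.* ½
      δ>0 = ℚ.positive⁻¹ _ {{ℚ.pos*pos⇒pos ε {{positive ε>0}} ½}}
      combine : ∃ (CloseFrom s (ε ℚ.* ½)) → ∃ (CloseFrom t (ε ℚ.* ½)) →
                ∃ (CloseFrom (λ n → s n ℚ.+ t n) ε)
      combine (M , s-close) (N , t-close) = M ℕ.⊔ N , λ m n hm hn →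
        ∣sum∣<ε (s m) (t m) (s n) (t n) ε
          (s-close m n (ℕ.m⊔n≤o⇒m≤o M N hm) (ℕ.m⊔n≤o⇒m≤o M N hn))
          (t-close m n (ℕ.m⊔n≤o⇒n≤o M N hm) (ℕ.m⊔n≤o⇒n≤o M N hn))

    *-cauchy : ∀ s t → IsCauchy s → IsCauchy t → IsCauchy (λ n → s n ℚ.* t n)
    *-cauchy s t cs ct ε ε>0 = bounds (bounded s cs) (bounded t ct)
      where
      Goal : Set
      Goal = ∃ (CloseFrom (λ n → s n ℚ.* t n) ε)

      bounds : (∃[ B ] 0ℚ ℚ.< B × ∃[ K ] BoundedBy s B K) →
               (∃[ C ] 0ℚ ℚ.< C × ∃[ L ] BoundedBy t C L) → Goal
      bounds (B , B>0 , K , s≤B) (C , C>0 , L , t≤C) =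
        threshold (divide (ℚ.+-mono-< B>0 C>0) ε>0)
        where
        threshold : (∃[ δ ] 0ℚ ℚ.< δ × (B ℚ.+ C) ℚ.* δ ≡ ε) → Goal
        threshold (δ , δ>0 , [B+C]*δ≡ε) = combine (cs δ δ>0) (ct δ δ>0)
          where
          combine : ∃ (CloseFrom s δ) → ∃ (CloseFrom t δ) → Goal
          combine (M , s-close) (N , t-close) =
            (K ℕ.⊔ L) ℕ.⊔ (M ℕ.⊔ N) , λ m n hm hn →
            subst (∣ s m ℚ.* t m ℚ.- s n ℚ.* t n ∣ ℚ.<_) [B+C]*δ≡ε
              (∣pq-rs∣<ε (s m) (t m) (s n) (t n) B>0 C>0
                (s≤B m (ℕ.m⊔n≤o⇒m≤o K L (KL m hm)))
                (t≤C n (ℕ.m⊔n≤o⇒n≤o K L (KL n hn)))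
                (s-close m n (ℕ.m⊔n≤o⇒m≤o M N (MN m hm)) (ℕ.m⊔n≤o⇒m≤o M N (MN n hn)))
                (t-close m n (ℕ.m⊔n≤o⇒n≤o M N (MN m hm)) (ℕ.m⊔n≤o⇒n≤o M N (MN n hn))))
            where
            KL : ∀ k → (K ℕ.⊔ L) ℕ.⊔ (M ℕ.⊔ N) ℕ.≤ k → K ℕ.⊔ L ℕ.≤ k
            KL k = ℕ.m⊔n≤o⇒m≤o (K ℕ.⊔ L) (M ℕ.⊔ N)
            MN : ∀ k → (K ℕ.⊔ L) ℕ.⊔ (M ℕ.⊔ N) ℕ.≤ k → M ℕ.⊔ N ℕ.≤ k
            MN k = ℕ.m⊔n≤o⇒n≤o (K ℕ.⊔ L) (M ℕ.⊔ N)

infix  4 _≈_ _<_ _≤_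
infixl 6 _+_
infixl 7 _*_

_≈_ : Rel ℝ 0ℓ
x ≈ y = ∀ ε → 0ℚ ℚ.< ε → ∃[ N ] ∀ n → N ℕ.≤ n → ∣ seq x n ℚ.- seq y n ∣ ℚ.< ε

_<_ : Rel ℝ 0ℓ
x < y = ∃[ ε ] 0ℚ ℚ.< ε × ∃[ N ] (∀ n → N ℕ.≤ n → seq x n ℚ.+ ε ℚ.≤ seq y n)

_≤_ : Rel ℝ 0ℓ
x ≤ y = ¬ (y < x)

fromℚ : ℚ → ℝ
fromℚ q = mkℝ (λ _ → q) λ ε ε>0 →
  0 , λ _ _ _ _ → subst (λ d → ∣ d ∣ ℚ.< ε) (sym (ℚ.+-inverseʳ q)) ε>0

fromℤ : ℤ → ℝ
fromℤ z = fromℚ (z ℚ./ 1)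

0ℝ 1ℝ : ℝ
0ℝ = fromℚ 0ℚ
1ℝ = fromℚ 1ℚ

_+_ : ℝ → ℝ → ℝ
x + y = mkℝ (λ n → seq x n ℚ.+ seq y n) (+-cauchy (seq x) (seq y) (cauchy x) (cauchy y))

_*_ : ℝ → ℝ → ℝ
x * y = mkℝ (λ n → seq x n ℚ.* seq y n) (*-cauchy (seq x) (seq y) (cauchy x) (cauchy y))

∑ : ∀ {n} → Vector ℝ n → ℝ
∑ = foldr _+_ 0ℝ

------------------------------------------------------------------------
-- Eigenvalues

Matrix : ℕ → Set
Matrix n = Fin n → Fin n → ℝ

IsEigenvalue : ∀ {n} → Matrix n → ℝ → Set
IsEigenvalue {n} A θ =
  Σ[ v ∈ Vector ℝ n ] ¬ (∀ i → v i ≈ 0ℝ) × (∀ i → ∑ (λ j → A i j * v j) ≈ θ * v i)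

-- Eigenvalues are ranked without multiplicity: θ₁ is second in the list
-- θ₀ > θ₁ > ⋯ of the distinct ones.
IsSecondLargestEigenvalue : ∀ {n} → Matrix n → ℝ → Set
IsSecondLargestEigenvalue A θ₁ =
  IsEigenvalue A θ₁ ×
  ∃[ θ₀ ] IsEigenvalue A θ₀ × θ₁ < θ₀ ×
          (∀ μ → IsEigenvalue A μ → μ ≈ θ₀ ⊎ μ ≤ θ₁)

------------------------------------------------------------------------
-- Finite simple graphs

record Graph (n : ℕ) : Set₁ where
  field
    Adj    : Rel (Fin n) 0ℓ
    adj?   : Decidable Adj
    symm   : Symmetric Adj
    irrefl : Irreflexive _≡_ Adj

count : ∀ {n} {P : Pred (Fin n) 0ℓ} → Decidable₁ P → ℕ
count {n} P? = length (filter P? (allFin n))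

module _ {n} (Γ : Graph n) where
  open Graph Γ

  adjacencyMatrix : Matrix n
  adjacencyMatrix x y = if does (adj? x y) then 1ℝ else 0ℝ

  Walk : ℕ → Rel (Fin n) 0ℓ
  Walk zero    x y = x ≡ y
  Walk (suc ℓ) x y = ∃[ z ] Adj x z × Walk ℓ z y

  walk? : ∀ ℓ → Decidable (Walk ℓ)
  walk? zero    x y = x Fin.≟ y
  walk? (suc ℓ) x y = any? λ z → adj? x z ×-dec walk? ℓ z y

  Connected : Set
  Connected = ∀ x y → ∃[ ℓ ] Walk ℓ x y

  AtDistance : ℕ → Rel (Fin n) 0ℓ
  AtDistance i x y = Walk i x y × (∀ {j} → j ℕ.< i → ¬ Walk j x y)

  atDistance? : ∀ i → Decidable (AtDistance i)
  atDistance? i x y =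
    walk? i x y ×-dec ℕ.allUpTo? (λ j → ¬? (walk? j x y)) i

  HasDiameter : ℕ → Set
  HasDiameter D =
    (∀ {i x y} → AtDistance i x y → i ℕ.≤ D) ×
    ∃[ x ] ∃[ y ] AtDistance D x y

  neighboursAtDistance : ℕ → Fin n → Fin n → ℕ
  neighboursAtDistance i x y = count λ z → adj? y z ×-dec atDistance? i x z

  -- For vertices x, y at distance i, the number of neighbours of y at
  -- distance i - 1 from x; no vertex is at distance -1.
  neighboursCloser : ℕ → Fin n → Fin n → ℕ
  neighboursCloser zero    x y = 0
  neighboursCloser (suc i) x y = neighboursAtDistance i x y

  neighboursFurther : ℕ → Fin n → Fin n → ℕ
  neighboursFurther i x y = neighboursAtDistance (suc i) x y

------------------------------------------------------------------------
-- Distance-regular graphs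

-- The parameters count vertices, so they may be taken in ℕ: each
-- distance 0, …, D occurs in a connected graph of diameter D.
record DistanceRegular {n} (Γ : Graph n) (D : ℕ) : Set where
  field
    connected : Connected Γ
    diameter  : HasDiameter Γ D
    b c       : Fin (suc D) → ℕ
    closer    : ∀ i {x y} → AtDistance Γ (toℕ i) x y →
                neighboursCloser Γ (toℕ i) x y ≡ c i
    further   : ∀ i {x y} → AtDistance Γ (toℕ i) x y →
                neighboursFurther Γ (toℕ i) x y ≡ b i

  valency : ℕ
  valency = b zero

  a : Fin (suc D) → ℤ
  a i = + valency ℤ.- + b i ℤ.- + c i

  intersectionArray : Vec ℕ D × Vec ℕ D
  intersectionArray = tabulate (λ i → b (inject₁ i)) , tabulate (λ i → c (suc i))

record Shilla {n} (Γ : Graph n) : Set where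
  field
    distanceRegular : DistanceRegular Γ 3

  open DistanceRegular distanceRegular public

  field
    θ₁≡a₃ : IsSecondLargestEigenvalue (adjacencyMatrix Γ) (fromℤ (a 3F))

  bΓ : ℤ
  bΓ = a 3F ℤ.- a 1F

module Submission where

-- As b(Γ) = 3, the intersection array is {3 α, 2 α + 2, β; 1, γ, 2 α} with α = a₃, β = b₂ and γ = c₂, and the
-- eigenvalues other than k and a₃ are the roots - t of a quadratic polynomial over ℤ. A cosine sequence of norm N
-- gives a matrix W with W² = N W, and clearing its rows one pivot at a time shows, over any integral domain, that
-- its trace is an integral multiple of N.
--
-- For irrational t this makes N rational; the resulting equation in α, β and γ ∣ 2 β has no solution.
--
-- For integral t the Krein condition q₁₁³ ≥ 0 leaves 4 ≤ t ≤ 8. Then γ divides 24 (t - 3)² t (t - 1), because it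
-- divides 6 α (α + 1), and choosing non-adjacent neighbours of a vertex greedily bounds α, hence β / γ, in terms of γ.
-- Among the finitely many arrays that remain, divisibility conditions and the Krein conditions leave the listed ones
-- and {21, 16, 8; 1, 4, 14}.
--
-- The latter attains q₁₁³ = 0, so triple intersection numbers satisfy linear equations. For a vertex x and u, v in
-- Γ(x) these give the number of blocks through u and v, a block being the set of neighbours of x at distance 3 from
-- some z at distance 3 from x. Call u and v related if ten blocks contain both. Each u is related to four
-- vertices, forming two triangles with u. Counting pairs of a triangle and a block containing it gives at least
-- 48 · 18 from the blocks, but at most 21 · 40 from the vertices (each triangle being counted six times).

open import Defs hiding (_≈_; _<_; _≤_; _+_; _*_; ∑)
import Defs as D
open import Algebra.Bundles using (CommutativeRing)
import Algebra.Properties.Semiring.Sum as Sum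
import Algebra.Solver.Ring as RingSolver
import Algebra.Solver.Ring.AlmostCommutativeRing as ACR
open import Algebra.Structures using (IsCommutativeRing)
open import Data.Bool.Base using (Bool; true; false; not; _∧_; _∨_; if_then_else_)
open import Data.Bool.Properties using (T-≡)
open import Data.Empty using (⊥; ⊥-elim)
open import Data.Fin.Base using (Fin; zero; suc; toℕ; fromℕ<)
open import Data.Fin.Patterns
import Data.Fin.Properties as Fin
open import Data.Integer.Base as ℤ using (ℤ; +_; 0ℤ) renaming (∣_∣ to abs)
import Data.Integer.Properties as ℤ
import Data.Integer.Solver as ℤ
import Data.Integer.Tactic.RingSolver as ℤRing
open import Data.List.Base using (List; []; _∷_; map; length; filter; tabulate)
open import Data.List.Membership.Propositional using (_∈_)
open import Data.List.Membership.Propositional.Properties using (∈-map⁺)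
open import Data.List.Relation.Unary.All as All using (All; []; _∷_)
import Data.List.Relation.Unary.All.Properties as All
open import Data.List.Relation.Unary.AllPairs using ([]; _∷_)
open import Data.List.Relation.Unary.Any using (here; there)
open import Data.List.Relation.Unary.Unique.Propositional using (Unique)
import Data.List.Relation.Unary.Unique.Propositional.Properties as Unique
open import Data.Maybe.Base using (Maybe; just; nothing)
open import Data.Nat.Base as ℕ using (ℕ; zero; suc; s≤s; z≤n; _≡ᵇ_; _∸_; _/_; _%_)
open import Data.Nat.Coprimality using (Coprime; coprime-divisor; coprime-/gcd)
open import Data.Nat.Divisibility as ℕ using (_∣_; divides; n∣m⇒m%n≡0)
open import Data.Nat.DivMod using (m/n*n≡m; m*n/n≡m; m*n%n≡0)
open import Data.Nat.GCD using (gcd; gcd[m,n]∣m; gcd[m,n]∣n; gcd[m,n]≢0)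
open import Data.Nat.Induction using (<-rec)
import Data.Nat.Properties as ℕ
import Data.Nat.Tactic.RingSolver as ℕRing
open import Data.Product.Base using (∃-syntax; _×_; _,_; proj₁; proj₂)
open import Data.Product.Properties using (≡-dec)
open import Data.Rational.Base as ℚ using (ℚ; 0ℚ; 1ℚ; ½; ∣_∣; Positive; positive; toℚᵘ)
import Data.Rational.Properties as ℚ
open import Data.Rational.Unnormalised.Base as ℚᵘ using (ℚᵘ; mkℚᵘ; *≡*)
import Data.Rational.Unnormalised.Properties as ℚᵘ
open import Data.Sum.Base using (_⊎_; inj₁; inj₂)
open import Data.Unit.Base using (tt)
open import Data.Vec.Base using (Vec; []; _∷_)
open import Data.Vec.Functional using (Vector)
open import Function.Base using (_∘_; id)
open import Function.Bundles using (Equivalence)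
open import Level using (0ℓ)
open import Relation.Binary.Definitions using (DecidableEquality; tri<; tri≈; tri>)
open import Relation.Binary.PropositionalEquality hiding ([_])
open import Relation.Nullary.Decidable using (Dec; does; yes; no; ¬?; dec-true; dec-false; decidable-stable; toWitness; _×-dec_; _⊎-dec_; _→-dec_)
open import Relation.Nullary.Negation using (¬_; contradiction)
open import Relation.Unary using (Pred; Decidable)

-- Pivoting has to decide whether an entry is zero, which Cauchy sequences do not allow. So the
-- eigenvalue - t is never treated as a real number: the multiplicity arguments are matrix
-- identities over a domain with decidable equality, ℤ for an integral t and ℤ[τ] for an irrational
-- root τ. Real numbers enter through the eigenvector of a₃ alone. At each stage of its Cauchy
-- sequences it is a rational vector that satisfies the recurrences of the distance matrices up to a
-- null sequence, and this forces b₂ (a₃² - a₁ a₃ - k) = 0. A cosine sequence is scaled to a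
-- function ω of the distance with values in the domain. The columns of W = ω(dist) are
-- eigenvectors, hence their sums over spheres are multiples of their values, and W² is a multiple
-- of W. For t = τ the trace identity reads ℓ = m (x + y τ) with an integer ℓ ≠ 0, which makes y =
-- 0. For {21, 16, 8; 1, 4, 14} one has t = 7, and (t - 3) c₂ = (9 - t) b₂ is the equality in the
-- Krein condition. The blocks at x are 48 sets of 7 among 21 points, with 16 blocks through each
-- point.

-- Integral domains and the trace of a matrix with W² = N W

record Domain : Set₁ where
  infix  8 -_
  infixl 7 _*_
  infixl 6 _+_
  field
    Carrier : Set
    _+_ _*_ : Carrier → Carrier → Carrier
    -_      : Carrier → Carrier
    0# 1#   : Carrier
    isCommutativeRing : IsCommutativeRing _≡_ _+_ _*_ -_ 0# 1#
    ι       : ℤ → Carrier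
    ι-+     : ∀ x y → ι (x ℤ.+ y) ≡ ι x + ι y
    ι-*     : ∀ x y → ι (x ℤ.* y) ≡ ι x * ι y
    ι-neg   : ∀ x → ι (ℤ.- x) ≡ - ι x
    ι-0     : ι (+ 0) ≡ 0#
    ι-1     : ι (+ 1) ≡ 1#
    integral : ∀ x y → x * y ≡ 0# → x ≡ 0# ⊎ y ≡ 0#
    _≟_     : DecidableEquality Carrier

  commutativeRing : CommutativeRing _ _
  commutativeRing = record { isCommutativeRing = isCommutativeRing }

module DomainProperties (R : Domain) where
  open Domain R public
  open CommutativeRing commutativeRing public
    using (+-identityˡ; +-identityʳ; -‿inverseʳ; +-assoc; +-comm;
           *-assoc; *-comm; *-identityˡ; *-identityʳ; zeroˡ; zeroʳ; semiring; _-_)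
  private module Sum′ = Sum semiring

  -- Abstract, so that unification never unfolds a sum.
  abstract
    ∑ : ∀ {n} → (Fin n → Carrier) → Carrier
    ∑ = Sum′.sum

    ∑-empty : (f : Fin 0 → Carrier) → ∑ f ≡ 0#
    ∑-empty f = refl

    ∑-suc : ∀ {n} (f : Fin (suc n) → Carrier) → ∑ f ≡ f zero + ∑ (λ i → f (suc i))
    ∑-suc f = refl

    ∑-cong : ∀ {n} {f g : Fin n → Carrier} → (∀ i → f i ≡ g i) → ∑ f ≡ ∑ g
    ∑-cong = Sum′.sum-cong-≗

    ∑-+ : ∀ {n} (f g : Fin n → Carrier) → ∑ (λ i → f i + g i) ≡ ∑ f + ∑ g
    ∑-+ = Sum′.∑-distrib-+

    ∑-*ˡ : ∀ {n} x (f : Fin n → Carrier) → ∑ (λ i → x * f i) ≡ x * ∑ f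
    ∑-*ˡ x f = sym (Sum′.*-distribˡ-sum x f)

    ∑-*ʳ : ∀ {n} x (f : Fin n → Carrier) → ∑ (λ i → f i * x) ≡ ∑ f * x
    ∑-*ʳ x f = sym (Sum′.*-distribʳ-sum x f)

    ∑-swap : ∀ {m n} (f : Fin m → Fin n → Carrier) → ∑ (λ i → ∑ (λ j → f i j)) ≡ ∑ (λ j → ∑ (λ i → f i j))
    ∑-swap = Sum′.∑-comm

    ∑-0 : ∀ {n} {f : Fin n → Carrier} → (∀ i → f i ≡ 0#) → ∑ f ≡ 0#
    ∑-0 {n} f≡0 = trans (∑-cong f≡0) (Sum′.sum-replicate-zero n)

  private
    acr : ACR.AlmostCommutativeRing _ _
    acr = ACR.fromCommutativeRing commutativeRing

    ι-morphism : CommutativeRing.rawRing ℤ.+-*-commutativeRing ACR.-Raw-AlmostCommutative⟶ acr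
    ι-morphism = record
      { ⟦_⟧ = ι ; +-homo = ι-+ ; *-homo = ι-* ; -‿homo = ι-neg ; 0-homo = ι-0 ; 1-homo = ι-1 }

    ι-≟ : ∀ x y → Maybe (ι x ≡ ι y)
    ι-≟ x y with x ℤ.≟ y
    ... | yes x≡y = just (cong ι x≡y)
    ... | no  _   = nothing

  module Solver = RingSolver (CommutativeRing.rawRing ℤ.+-*-commutativeRing) acr ι-morphism ι-≟

  open Solver

  x-y≡0⇒x≡y : ∀ x y → x - y ≡ 0# → x ≡ y
  x-y≡0⇒x≡y x y x-y≡0 = begin
    x             ≡⟨ solve 2 (λ x y → x := (x :- y) :+ y) refl x y ⟩
    (x - y) + y   ≡⟨ cong (_+ y) x-y≡0 ⟩
    0# + y        ≡⟨ +-identityˡ y ⟩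
    y             ∎
    where open ≡-Reasoning

  -- To use equations in a ring identity, the solver is given the identity
  -- with multiples of their differences added.
  using-eq : ∀ p q {x y} → x ≡ y → p + q * (x - y) ≡ p
  using-eq p q {x} refl = begin
    p + q * (x - x)  ≡⟨ cong (λ d → p + q * d) (-‿inverseʳ x) ⟩
    p + q * 0#       ≡⟨ cong (λ d → p + d) (zeroʳ q) ⟩
    p + 0#           ≡⟨ +-identityʳ p ⟩
    p                ∎
    where open ≡-Reasoning

  *-cancelˡ : ∀ x {y z} → x ≢ 0# → x * y ≡ x * z → y ≡ z
  *-cancelˡ x {y} {z} x≢0 xy≡xz with integral x (y - z) x[y-z]≡0
    where
    open ≡-Reasoning
    x[y-z]≡0 : x * (y - z) ≡ 0#
    x[y-z]≡0 = begin
      x * (y - z)     ≡⟨ solve 3 (λ x y z → x :* (y :- z) := x :* y :- x :* z) refl x y z ⟩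
      x * y - x * z   ≡⟨ cong (_- x * z) xy≡xz ⟩
      x * z - x * z   ≡⟨ -‿inverseʳ (x * z) ⟩
      0#              ∎
  ... | inj₁ x≡0   = contradiction x≡0 x≢0
  ... | inj₂ y-z≡0 = x-y≡0⇒x≡y y z y-z≡0

  infixl 6 _⊞_
  infixl 7 _⊠_
  infix  8 ⊟_

  -- Polynomial expressions in integers, to push ι through them.
  data Expr : Set where
    int     : ℤ → Expr
    _⊞_ _⊠_ : Expr → Expr → Expr
    ⊟_      : Expr → Expr

  evalℤ : Expr → ℤ
  evalℤ (int z) = z
  evalℤ (p ⊞ q) = evalℤ p ℤ.+ evalℤ q
  evalℤ (p ⊠ q) = evalℤ p ℤ.* evalℤ q
  evalℤ (⊟ p)   = ℤ.- evalℤ p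

  eval : Expr → Carrier
  eval (int z) = ι z
  eval (p ⊞ q) = eval p + eval q
  eval (p ⊠ q) = eval p * eval q
  eval (⊟ p)   = - eval p

  ι-eval : ∀ p → ι (evalℤ p) ≡ eval p
  ι-eval (int z) = refl
  ι-eval (p ⊞ q) = trans (ι-+ (evalℤ p) (evalℤ q)) (cong₂ _+_ (ι-eval p) (ι-eval q))
  ι-eval (p ⊠ q) = trans (ι-* (evalℤ p) (evalℤ q)) (cong₂ _*_ (ι-eval p) (ι-eval q))
  ι-eval (⊟ p)   = trans (ι-neg (evalℤ p)) (cong -_ (ι-eval p))

  -- Subtracting from a matrix the rank one matrix spanned by the column and
  -- the row of a pivot keeps the relation W² = N W (with N rescaled by the
  -- pivot), lowers the trace by N and clears the row of the pivot.
  module _ {n : ℕ} where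
    private
      Mat : Set
      Mat = Fin n → Fin n → Carrier

      QuasiIdempotent : Mat → Carrier → Set
      QuasiIdempotent W N = ∀ i k → ∑ (λ j → W i j * W j k) ≡ N * W i k

      module Clear (W : Mat) (N : Carrier) (W²≡NW : QuasiIdempotent W N) (i₀ j₀ : Fin n) where
        p : Carrier
        p = W i₀ j₀

        W′ : Mat
        W′ i k = p * W i k - W i j₀ * W i₀ k

        W′²≡pNW′ : QuasiIdempotent W′ (p * N)
        W′²≡pNW′ i k = begin
          ∑ (λ j → W′ i j * W′ j k)
            ≡⟨ ∑-cong (λ j → solve 7 (λ p x u y z w v →
                 (p :* x :- u :* y) :* (p :* z :- w :* v) :=
                 (p :* p) :* (x :* z) :+ (:- (p :* v)) :* (x :* w) :+
                 ((:- (p :* u)) :* (y :* z) :+ (u :* v) :* (y :* w)))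
               refl p (W i j) u (W i₀ j) (W j k) (W j j₀) v) ⟩
          ∑ (λ j → (p * p) * (W i j * W j k) + (- (p * v)) * (W i j * W j j₀) +
                     ((- (p * u)) * (W i₀ j * W j k) + (u * v) * (W i₀ j * W j j₀)))
            ≡⟨ trans (∑-+ _ _) (cong₂ _+_
                 (trans (∑-+ _ _) (cong₂ _+_ (scaled (p * p) i k) (scaled (- (p * v)) i j₀)))
                 (trans (∑-+ _ _) (cong₂ _+_ (scaled (- (p * u)) i₀ k) (scaled (u * v) i₀ j₀)))) ⟩
          ((p * p) * (N * W i k) + (- (p * v)) * (N * u)) + ((- (p * u)) * (N * v) + (u * v) * (N * p))
            ≡⟨ solve 5 (λ p N x u v →
                 ((p :* p) :* (N :* x) :+ (:- (p :* v)) :* (N :* u)) :+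
                 ((:- (p :* u)) :* (N :* v) :+ (u :* v) :* (N :* p)) :=
                 (p :* N) :* (p :* x :- u :* v)) refl p N (W i k) u v ⟩
          (p * N) * W′ i k ∎
          where
          open ≡-Reasoning
          u v : Carrier
          u = W i j₀
          v = W i₀ k
          scaled : ∀ c i k → ∑ (λ j → c * (W i j * W j k)) ≡ c * (N * W i k)
          scaled c i k = trans (∑-*ˡ c _) (cong (c *_) (W²≡NW i k))

        trace-W′ : ∑ (λ i → W′ i i) ≡ p * (∑ (λ i → W i i) - N)
        trace-W′ = begin
          ∑ (λ i → W′ i i)
            ≡⟨ ∑-cong (λ i → solve 4 (λ p x u v → p :* x :- u :* v := p :* x :+ (:- con (+ 1)) :* (v :* u))
                 refl p (W i i) (W i j₀) (W i₀ i)) ⟩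
          ∑ (λ i → p * W i i + (- ι (+ 1)) * (W i₀ i * W i j₀))
            ≡⟨ trans (∑-+ _ _) (cong₂ _+_ (∑-*ˡ p _) (∑-*ˡ (- ι (+ 1)) _)) ⟩
          p * tr + (- ι (+ 1)) * ∑ (λ i → W i₀ i * W i j₀)
            ≡⟨ cong (λ s → p * tr + (- ι (+ 1)) * s) (W²≡NW i₀ j₀) ⟩
          p * tr + (- ι (+ 1)) * (N * p)
            ≡⟨ solve 3 (λ p t N → p :* t :+ (:- con (+ 1)) :* (N :* p) := p :* (t :- N)) refl p tr N ⟩
          p * (tr - N) ∎
          where
          open ≡-Reasoning
          tr : Carrier
          tr = ∑ (λ i → W i i)

        cleared : ∀ k → W′ i₀ k ≡ 0#
        cleared k = -‿inverseʳ (p * W i₀ k)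

        stays-zero : ∀ i → (∀ k → W i k ≡ 0#) → ∀ k → W′ i k ≡ 0#
        stays-zero i Wi≡0 k = begin
          p * W i k - W i j₀ * W i₀ k  ≡⟨ cong₂ (λ x y → p * x - y * W i₀ k) (Wi≡0 k) (Wi≡0 j₀) ⟩
          p * 0# - 0# * W i₀ k         ≡⟨ cong₂ (λ x y → x - y) (zeroʳ p) (zeroˡ (W i₀ k)) ⟩
          0# - 0#                      ≡⟨ -‿inverseʳ 0# ⟩
          0#                           ∎
          where open ≡-Reasoning

      -- Induction over the rows: the first r rows are zero and g remain. A zero row is skipped. A
      -- pivot p contributes one N to the trace; the cleared matrix has norm p N, and p is cancelled
      -- afterwards. So m counts the pivots.
      traceFrom : ∀ g r → r ℕ.+ g ≡ n → (W : Mat) (N : Carrier) → QuasiIdempotent W N →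
        (∀ i → toℕ i ℕ.< r → ∀ k → W i k ≡ 0#) →
        ∃[ m ] ∑ (λ i → W i i) ≡ ι (+ m) * N
      traceFrom zero r r+0≡n W N W²≡NW zeros =
        0 , trans (∑-0 (λ i → zeros i (subst (toℕ i ℕ.<_) n≡r (Fin.toℕ<n i)) i))
                  (sym (trans (cong (_* N) ι-0) (zeroˡ N)))
        where
        n≡r : n ≡ r
        n≡r = trans (sym r+0≡n) (ℕ.+-identityʳ r)
      traceFrom (suc g) r r+g+1≡n W N W²≡NW zeros = pivot (Fin.any? (λ j → ¬? (W i₀ j ≟ 0#)))
        where
        r<n : r ℕ.< n
        r<n = subst (r ℕ.<_) r+g+1≡n (ℕ.m<m+n r ℕ.z<s)
        i₀ : Fin n
        i₀ = fromℕ< r<n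
        below : ∀ i → toℕ i ℕ.< suc r → toℕ i ℕ.< r ⊎ i ≡ i₀
        below i i<1+r with toℕ i ℕ.<? r
        ... | yes i<r = inj₁ i<r
        ... | no  i≮r = inj₂ (Fin.toℕ-injective (trans
          (ℕ.≤-antisym (ℕ.<⇒≤pred i<1+r) (ℕ.≮⇒≥ i≮r)) (sym (Fin.toℕ-fromℕ< r<n))))
        r+1+g≡n : suc r ℕ.+ g ≡ n
        r+1+g≡n = trans (sym (ℕ.+-suc r g)) r+g+1≡n
        pivot : _ → ∃[ m ] ∑ (λ i → W i i) ≡ ι (+ m) * N
        pivot (no none) = traceFrom g (suc r) r+1+g≡n W N W²≡NW zeros′
          where
          zeros′ : ∀ i → toℕ i ℕ.< suc r → ∀ k → W i k ≡ 0#
          zeros′ i i<1+r k with below i i<1+r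
          ... | inj₁ i<r  = zeros i i<r k
          ... | inj₂ refl = decidable-stable (W i₀ k ≟ 0#) (λ W≢0 → none (k , W≢0))
        pivot (yes (j₀ , p≢0)) = add (traceFrom g (suc r) r+1+g≡n W′ (p * N) W′²≡pNW′ zeros′)
          where
          open Clear W N W²≡NW i₀ j₀
          zeros′ : ∀ i → toℕ i ℕ.< suc r → ∀ k → W′ i k ≡ 0#
          zeros′ i i<1+r with below i i<1+r
          ... | inj₁ i<r  = stays-zero i (zeros i i<r)
          ... | inj₂ refl = cleared
          add : ∃[ m ] ∑ (λ i → W′ i i) ≡ ι (+ m) * (p * N) → ∃[ m ] ∑ (λ i → W i i) ≡ ι (+ m) * N
          add (m , trW′≡) = suc m , (begin
            tr                   ≡⟨ solve 2 (λ t N → t := (t :- N) :+ N) refl tr N ⟩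
            (tr - N) + N         ≡⟨ cong (_+ N) (*-cancelˡ p p≢0 (trans (sym trace-W′) (trans trW′≡
                                      (solve 3 (λ m p N → m :* (p :* N) := p :* (m :* N)) refl (ι (+ m)) p N)))) ⟩
            ι (+ m) * N + N      ≡⟨ solve 2 (λ m N → m :* N :+ N := (con (+ 1) :+ m) :* N) refl (ι (+ m)) N ⟩
            (ι (+ 1) + ι (+ m)) * N ≡⟨ cong (_* N) (ι-+ (+ 1) (+ m)) ⟨
            ι (+ suc m) * N      ∎)
            where
            open ≡-Reasoning
            tr : Carrier
            tr = ∑ (λ i → W i i)

    -- For N ≠ 0 the matrix W / N is idempotent over the field of fractions and m is its rank. In
    -- the applications it is the multiplicity of an eigenvalue.
    trace-multiple : (W : Fin n → Fin n → Carrier) (N : Carrier) →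
      (∀ i k → ∑ (λ j → W i j * W j k) ≡ N * W i k) →
      ∃[ m ] ∑ (λ i → W i i) ≡ ι (+ m) * N
    trace-multiple W N W²≡NW = traceFrom n 0 refl W N W²≡NW (λ _ ())

does-⇔ : ∀ {A B : Set} (A? : Dec A) (B? : Dec B) → (A → B) → (B → A) → does A? ≡ does B?
does-⇔ (yes a) B? to from = sym (dec-true B? (to a))
does-⇔ (no ¬a) B? to from = sym (dec-false B? (¬a ∘ from))

count-none : ∀ {n} {P : Pred (Fin n) 0ℓ} (P? : Decidable P) → (∀ i → ¬ P i) → count P? ≡ 0
count-none {n} {P} P? ¬P = go id
  where
  go : ∀ {m} (f : Fin m → Fin n) → length (filter P? (tabulate f)) ≡ 0
  go {zero}  f = refl
  go {suc m} f rewrite dec-false (P? (f zero)) (¬P (f zero)) = go (f ∘ suc)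

-- Distances and neighbour counts in a distance-regular graph of diameter 3

module Distance {n} (Γ : Graph n) (G : DistanceRegular Γ 3) where
  open Graph Γ public
  open DistanceRegular G public

  walk-snoc : ∀ ℓ {x y z} → Walk Γ ℓ x y → Adj y z → Walk Γ (suc ℓ) x z
  walk-snoc zero    refl        yz = _ , yz , refl
  walk-snoc (suc ℓ) (w , xw , wy) yz = w , xw , walk-snoc ℓ wy yz

  walk-sym : ∀ ℓ {x y} → Walk Γ ℓ x y → Walk Γ ℓ y x
  walk-sym zero    refl          = refl
  walk-sym (suc ℓ) (w , xw , wy) = walk-snoc ℓ (walk-sym ℓ wy) (symm xw)

  at-sym : ∀ {i x y} → AtDistance Γ i x y → AtDistance Γ i y x
  at-sym {i} (w , shortest) = walk-sym i w , λ {j} j<i w′ → shortest j<i (walk-sym j w′)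

  at-unique : ∀ {i j x y} → AtDistance Γ i x y → AtDistance Γ j x y → i ≡ j
  at-unique {i} {j} (wᵢ , minᵢ) (wⱼ , minⱼ) with ℕ.<-cmp i j
  ... | tri< i<j _ _ = contradiction wᵢ (minⱼ i<j)
  ... | tri≈ _ i≡j _ = i≡j
  ... | tri> _ _ j<i = contradiction wⱼ (minᵢ j<i)

  shortest : ∀ {x y} ℓ → Walk Γ ℓ x y → ∃[ i ] i ℕ.≤ ℓ × AtDistance Γ i x y
  shortest {x} {y} = <-rec _ step
    where
    step : ∀ ℓ → (∀ {m} → m ℕ.< ℓ → Walk Γ m x y → ∃[ i ] i ℕ.≤ m × AtDistance Γ i x y) →
           Walk Γ ℓ x y → ∃[ i ] i ℕ.≤ ℓ × AtDistance Γ i x y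
    step ℓ rec w with ℕ.anyUpTo? (λ j → walk? Γ j x y) ℓ
    ... | yes (j , j<ℓ , w′) with i , i≤j , at ← rec j<ℓ w′ = i , ℕ.≤-trans i≤j (ℕ.<⇒≤ j<ℓ) , at
    ... | no none = ℓ , ℕ.≤-refl , w , λ {j} j<ℓ w′ → none (j , j<ℓ , w′)

  at-total : ∀ x y → ∃[ i ] AtDistance Γ (toℕ {4} i) x y
  at-total x y with ℓ , w ← connected x y with i , _ , at ← shortest ℓ w =
    fromℕ< i<4 , subst (λ i → AtDistance Γ i x y) (sym (Fin.toℕ-fromℕ< i<4)) at
    where
    i<4 : i ℕ.< 4
    i<4 = s≤s (proj₁ diameter at)

  -- Abstract, so that goals mention `dist x y` and not the search for a shortest walk behind it.
  abstract
    dist : Fin n → Fin n → Fin 4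
    dist x y = proj₁ (at-total x y)

    dist-at : ∀ x y → AtDistance Γ (toℕ (dist x y)) x y
    dist-at x y = proj₂ (at-total x y)

  at⇒dist : ∀ {x y} i → AtDistance Γ (toℕ i) x y → dist x y ≡ i
  at⇒dist {x} {y} i at = Fin.toℕ-injective (at-unique (dist-at x y) at)

  dist⇒at : ∀ {x y i} → dist x y ≡ i → AtDistance Γ (toℕ i) x y
  dist⇒at {x} {y} refl = dist-at x y

  dist-sym : ∀ x y → dist x y ≡ dist y x
  dist-sym x y = at⇒dist _ (at-sym (dist-at y x))

  at-0 : ∀ x → AtDistance Γ 0 x x
  at-0 x = refl , λ ()

  dist-refl : ∀ x → dist x x ≡ 0F
  dist-refl x = at⇒dist 0F (at-0 x)

  dist≡0⇒≡ : ∀ {x y} → dist x y ≡ 0F → x ≡ y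
  dist≡0⇒≡ eq = proj₁ (dist⇒at eq)

  adj⇒at : ∀ {x y} → Adj x y → AtDistance Γ 1 x y
  adj⇒at xy = (_ , xy , refl) , λ { (s≤s z≤n) x≡y → irrefl x≡y xy }

  adj⇒dist : ∀ {x y} → Adj x y → dist x y ≡ 1F
  adj⇒dist xy = at⇒dist 1F (adj⇒at xy)

  dist≡1⇒adj : ∀ {x y} → dist x y ≡ 1F → Adj x y
  dist≡1⇒adj eq with (_ , xz , refl) ← proj₁ (dist⇒at eq) = xz

  dist-step : ∀ x {y z} → Adj y z → toℕ (dist x z) ℕ.≤ suc (toℕ (dist x y))
  dist-step x {y} {z} yz with shortest (suc (toℕ (dist x y))) (walk-snoc (toℕ (dist x y)) (proj₁ (dist-at x y)) yz)
  ... | i , i≤ , at = subst (ℕ._≤ suc (toℕ (dist x y))) (at-unique at (dist-at x z)) i≤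

  nbr? : ∀ i x y → Decidable (λ z → Adj y z × AtDistance Γ i x z)
  nbr? i x y z = adj? y z ×-dec atDistance? Γ i x z

  nbrs : Fin 4 → Fin n → Fin n → ℕ
  nbrs j x y = neighboursAtDistance Γ (toℕ j) x y

  nbrs-further : ∀ {x y} i j → toℕ j ≡ suc (toℕ i) → dist x y ≡ i → nbrs j x y ≡ b i
  nbrs-further {x} {y} i j eq d≡i = subst (λ m → neighboursAtDistance Γ m x y ≡ b i) (sym eq) (further i (dist⇒at d≡i))

  nbrs-far : ∀ {x y} j → suc (toℕ (dist x y)) ℕ.< toℕ j → nbrs j x y ≡ 0
  nbrs-far {x} {y} j far = count-none (nbr? (toℕ j) x y) λ z (yz , at) →
    ℕ.<⇒≱ far (subst (ℕ._≤ suc (toℕ (dist x y))) (cong toℕ (at⇒dist j at)) (dist-step x yz))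

  nbrs-near : ∀ {x y} j → suc (toℕ j) ℕ.< toℕ (dist x y) → nbrs j x y ≡ 0
  nbrs-near {x} {y} j near = count-none (nbr? (toℕ j) x y) λ z (yz , at) →
    ℕ.<⇒≱ near (subst (λ m → toℕ (dist x y) ℕ.≤ suc m) (cong toℕ (at⇒dist j at)) (dist-step x (symm yz)))

-- The intersection matrix and sums over spheres

module Counting (R : Domain) where
  open DomainProperties R

  -- Written with `ι` of 1 and 0 instead of `1#` and `0#`, so that the ring solver reads indicators
  -- as constants.
  [_] : Bool → Carrier
  [ t ] = if t then ι (+ 1) else ι (+ 0)

  ι1* : ∀ x → ι (+ 1) * x ≡ x
  ι1* x = trans (cong (_* x) ι-1) (*-identityˡ x)

  ι0* : ∀ x → ι (+ 0) * x ≡ 0#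
  ι0* x = trans (cong (_* x) ι-0) (zeroˡ x)

  ι-count : ∀ {n} {P : Pred (Fin n) 0ℓ} (P? : Decidable P) → ι (+ count P?) ≡ ∑ (λ i → [ does (P? i) ])
  ι-count {n} P? = go id
    where
    open ≡-Reasoning
    go : ∀ {m} (f : Fin m → Fin n) → ι (+ length (filter P? (tabulate f))) ≡ ∑ (λ i → [ does (P? (f i)) ])
    go {zero}  f = trans ι-0 (sym (∑-empty _))
    go {suc m} f with does (P? (f zero)) in eq
    ... | true  = begin
      ι (+ suc (length (filter P? (tabulate (f ∘ suc)))))     ≡⟨ ι-+ (+ 1) _ ⟩
      ι (+ 1) + ι (+ length (filter P? (tabulate (f ∘ suc)))) ≡⟨ cong₂ _+_ (cong [_] (sym eq)) (go (f ∘ suc)) ⟩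
      [ does (P? (f zero)) ] + ∑ (λ i → [ does (P? (f (suc i))) ])  ≡⟨ ∑-suc _ ⟨
      ∑ (λ i → [ does (P? (f i)) ])                           ∎
    ... | false = begin
      ι (+ length (filter P? (tabulate (f ∘ suc))))           ≡⟨ go (f ∘ suc) ⟩
      ∑ (λ i → [ does (P? (f (suc i))) ])                     ≡⟨ trans (cong (_+ ∑ (λ i → [ does (P? (f (suc i))) ])) ι-0) (+-identityˡ _) ⟨
      ι (+ 0) + ∑ (λ i → [ does (P? (f (suc i))) ])           ≡⟨ cong (λ t → [ t ] + ∑ (λ i → [ does (P? (f (suc i))) ])) (sym eq) ⟩
      [ does (P? (f zero)) ] + ∑ (λ i → [ does (P? (f (suc i))) ])  ≡⟨ ∑-suc _ ⟨
      ∑ (λ i → [ does (P? (f i)) ])                           ∎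

  e : ∀ {m} → Fin m → Fin m → Carrier
  e j i = [ does (j Fin.≟ i) ]

  e-comm : ∀ {m} (i j : Fin m) → e i j ≡ e j i
  e-comm i j = cong [_] (does-⇔ (i Fin.≟ j) (j Fin.≟ i) sym sym)

  ∑-e : ∀ {m} (f : Fin m → Carrier) (i : Fin m) → ∑ (λ j → e i j * f j) ≡ f i
  ∑-e {suc m} f zero = begin
    ∑ (λ j → e zero j * f j)   ≡⟨ ∑-suc _ ⟩
    ι (+ 1) * f zero + ∑ (λ j → ι (+ 0) * f (suc j))  ≡⟨ cong₂ _+_ (ι1* _) (∑-0 (λ j → ι0* _)) ⟩
    f zero + 0#   ≡⟨ +-identityʳ _ ⟩
    f zero ∎
    where open ≡-Reasoning
  ∑-e {suc m} f (suc i) = begin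
    ∑ (λ j → e (suc i) j * f j)   ≡⟨ ∑-suc _ ⟩
    ι (+ 0) * f zero + ∑ (λ j → e i j * f (suc j))  ≡⟨ cong₂ _+_ (ι0* _) (∑-e (f ∘ suc) i) ⟩
    0# + f (suc i)  ≡⟨ +-identityˡ _ ⟩
    f (suc i) ∎
    where open ≡-Reasoning

  ∑4 : (f : Fin 4 → Carrier) → ∑ f ≡ f 0F + (f 1F + (f 2F + f 3F))
  ∑4 f = trans (∑-suc _) (cong (λ s → f 0F + s) (trans (∑-suc _) (cong (λ s → f 1F + s) (trans (∑-suc _) (cong (λ s → f 2F + s)
    (trans (∑-suc _) (trans (cong (λ s → f 3F + s) (∑-empty _)) (+-identityʳ _))))))))

module Spectral (R : Domain) {n} (Γ : Graph n) (G : DistanceRegular Γ 3) where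
  open DomainProperties R
  open Counting R
  open Distance Γ G
  open Solver

  α : Fin n → Fin n → Carrier
  α y z = [ does (adj? y z) ]

  α-sym : ∀ y z → α y z ≡ α z y
  α-sym y z = cong [_] (does-⇔ (adj? y z) (adj? z y) symm symm)

  ι-nbrs : ∀ j x y → ι (+ nbrs j x y) ≡ ∑ (λ z → α y z * e j (dist x z))
  ι-nbrs j x y = trans (ι-count (nbr? (toℕ j) x y)) (∑-cong λ z → trans
    (cong (λ t → [ does (adj? y z) ∧ t ]) (does-⇔ (atDistance? Γ (toℕ j) x z) (j Fin.≟ dist x z)
      (sym ∘ at⇒dist j) (dist⇒at ∘ sym)))
    ([∧] (does (adj? y z)) _))
    where
    [∧] : ∀ s t → [ s ∧ t ] ≡ [ s ] * [ t ]
    [∧] true  t = sym (ι1* _)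
    [∧] false t = sym (trans (ι0* _) (sym ι-0))

  L₀ : (Fin 4 → Carrier) → Fin n → Fin n → Carrier
  L₀ f x y = ι (+ nbrs 0F x y) * f 0F + (ι (+ nbrs 1F x y) * f 1F + (ι (+ nbrs 2F x y) * f 2F + ι (+ nbrs 3F x y) * f 3F))

  sum-over-nbrs : ∀ f x y → ∑ (λ z → α y z * f (dist x z)) ≡ L₀ f x y
  sum-over-nbrs f x y = begin
    ∑ (λ z → α y z * f (dist x z))
      ≡⟨ ∑-cong (λ z → trans (cong (α y z *_) (trans (sym (∑-e f (dist x z))) (∑-cong (λ j → cong (_* f j) (e-comm (dist x z) j)))))
                       (trans (sym (∑-*ˡ (α y z) _)) (∑-cong (λ j → sym (*-assoc _ _ _))))) ⟩
    ∑ (λ z → ∑ (λ j → (α y z * e j (dist x z)) * f j))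
      ≡⟨ ∑-swap _ ⟩
    ∑ (λ j → ∑ (λ z → (α y z * e j (dist x z)) * f j))
      ≡⟨ ∑-cong (λ j → trans (∑-*ʳ (f j) _) (cong (_* f j) (sym (ι-nbrs j x y)))) ⟩
    ∑ (λ j → ι (+ nbrs j x y) * f j)
      ≡⟨ ∑4 _ ⟩
    L₀ f x y ∎
    where open ≡-Reasoning

  private
    nb : ∀ j {x y} {m} → nbrs j x y ≡ m → ∀ f → ι (+ nbrs j x y) * f ≡ ι (+ m) * f
    nb j eq f = cong (λ m → ι (+ m) * f) eq

  -- The number of neighbours of y does not depend on the base point, so it is evaluated from y,
  -- where all of them are at distance 1.
  degree : ∀ x y → L₀ (λ _ → ι (+ 1)) x y ≡ ι (+ valency)
  degree x y = begin
    L₀ (λ _ → ι (+ 1)) x y                  ≡⟨ sum-over-nbrs (λ _ → ι (+ 1)) x y ⟨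
    ∑ (λ z → α y z * ι (+ 1))               ≡⟨ sum-over-nbrs (λ _ → ι (+ 1)) y y ⟩
    L₀ (λ _ → ι (+ 1)) y y                  ≡⟨ cong₂ _+_ (nb 0F n0 _) (cong₂ _+_ (nb 1F n1 _) (cong₂ _+_ (nb 2F n2 _) (nb 3F n3 _))) ⟩
    ι (+ 0) * ι (+ 1) + (ι (+ valency) * ι (+ 1) + (ι (+ 0) * ι (+ 1) + ι (+ 0) * ι (+ 1)))
      ≡⟨ solve 1 (λ k → con (+ 0) :* con (+ 1) :+ (k :* con (+ 1) :+ (con (+ 0) :* con (+ 1) :+ con (+ 0) :* con (+ 1))) := k) refl (ι (+ valency)) ⟩
    ι (+ valency) ∎
    where
    open ≡-Reasoning
    d : dist y y ≡ 0F
    d = dist-refl y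
    n0 : nbrs 0F y y ≡ 0
    n0 = count-none (nbr? 0 y y) λ z (yz , at) → irrefl (proj₁ at) yz
    n1 : nbrs 1F y y ≡ valency
    n1 = nbrs-further 0F 1F refl d
    n2 : nbrs 2F y y ≡ 0
    n2 = nbrs-far 2F (subst (λ i → suc (toℕ i) ℕ.< 2) (sym d) (s≤s (s≤s z≤n)))
    n3 : nbrs 3F y y ≡ 0
    n3 = nbrs-far 3F (subst (λ i → suc (toℕ i) ℕ.< 3) (sym d) (s≤s (s≤s z≤n)))

  -- The tridiagonal intersection matrix acting on functions of the distance to a fixed vertex. In
  -- the last row the term with b₃ = 0 is left out.
  L : (Fin 4 → Carrier) → Fin 4 → Carrier
  L f 0F = ι (+ valency) * f 1F
  L f 1F = ι (+ c 1F) * f 0F + ι (a 1F) * f 1F + ι (+ b 1F) * f 2F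
  L f 2F = ι (+ c 2F) * f 1F + ι (a 2F) * f 2F + ι (+ b 2F) * f 3F
  L f 3F = ι (+ c 3F) * f 2F + ι (a 3F) * f 3F

  -- The counts at the four distances add up to k, so the count at distance i is traded for k - bᵢ -
  -- cᵢ = aᵢ. Counts at distances that differ from i by two or more vanish.
  sum-over-nbrs′ : ∀ f x y → ∑ (λ z → α y z * f (dist x z)) ≡ L f (dist x y)
  sum-over-nbrs′ f x y = trans (sum-over-nbrs f x y) (by (dist x y) refl)
    where
    open ≡-Reasoning
    N0 N1 N2 N3 k : Carrier
    N0 = ι (+ nbrs 0F x y)
    N1 = ι (+ nbrs 1F x y)
    N2 = ι (+ nbrs 2F x y)
    N3 = ι (+ nbrs 3F x y)
    k = ι (+ valency)
    total : N0 + N1 + N2 + N3 ≡ k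
    total = trans (solve 4 (λ p q r s → p :+ q :+ r :+ s :=
      p :* con (+ 1) :+ (q :* con (+ 1) :+ (r :* con (+ 1) :+ s :* con (+ 1)))) refl N0 N1 N2 N3) (degree x y)
    drop : ∀ p q → p + 0# * q ≡ p
    drop p q = trans (cong (λ s → p + s) (zeroˡ q)) (+-identityʳ p)
    fall : ∀ {m} → m ≡ 0 → ι (+ m) ≡ 0#
    fall refl = ι-0
    ι-a : ∀ i → ι (a i) ≡ k - ι (+ b i) - ι (+ c i)
    ι-a i = trans (ι-+ _ _) (cong₂ _+_ (trans (ι-+ _ _) (cong (λ s → k + s) (ι-neg _))) (ι-neg _))
    by : ∀ i → dist x y ≡ i → L₀ f x y ≡ L f i
    by 0F eq = begin
      N0 * f 0F + (N1 * f 1F + (N2 * f 2F + N3 * f 3F))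
        ≡⟨ cong₂ (λ p q → p * f 0F + (N1 * f 1F + (N2 * f 2F + q * f 3F))) n0 n3 ⟩
      0# * f 0F + (N1 * f 1F + (N2 * f 2F + 0# * f 3F))
        ≡⟨ cong₂ (λ p q → 0# * f 0F + (p * f 1F + (q * f 2F + 0# * f 3F))) n1 n2 ⟩
      0# * f 0F + (k * f 1F + (0# * f 2F + 0# * f 3F))
        ≡⟨ cong (λ o → o * f 0F + (k * f 1F + (o * f 2F + o * f 3F))) ι-0 ⟨
      ι (+ 0) * f 0F + (k * f 1F + (ι (+ 0) * f 2F + ι (+ 0) * f 3F))
        ≡⟨ solve 5 (λ k p q r s → con (+ 0) :* p :+ (k :* q :+ (con (+ 0) :* r :+ con (+ 0) :* s)) := k :* q) refl k (f 0F) (f 1F) (f 2F) (f 3F) ⟩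
      k * f 1F ∎
      where
      n0 : N0 ≡ 0#
      n0 = fall (count-none (nbr? 0 x y) λ z (yz , at) → irrefl (trans (sym (dist≡0⇒≡ eq)) (proj₁ at)) yz)
      n1 : N1 ≡ k
      n1 = cong (λ m → ι (+ m)) (nbrs-further 0F 1F refl eq)
      n2 : N2 ≡ 0#
      n2 = fall (nbrs-far 2F (subst (λ i → suc (toℕ i) ℕ.< 2) (sym eq) (s≤s (s≤s z≤n))))
      n3 : N3 ≡ 0#
      n3 = fall (nbrs-far 3F (subst (λ i → suc (toℕ i) ℕ.< 3) (sym eq) (s≤s (s≤s z≤n))))
    by 1F eq = begin
      N0 * f 0F + (N1 * f 1F + (N2 * f 2F + N3 * f 3F))
        ≡⟨ solve 8 (λ n0 n1 n2 n3 p q r s → n0 :* p :+ (n1 :* q :+ (n2 :* r :+ n3 :* s)) :=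
             n0 :* p :+ (n0 :+ n1 :+ n2 :+ n3 :- n2 :- n0) :* q :+ n2 :* r :+ n3 :* (s :- q))
             refl N0 N1 N2 N3 (f 0F) (f 1F) (f 2F) (f 3F) ⟩
      N0 * f 0F + (N0 + N1 + N2 + N3 - N2 - N0) * f 1F + N2 * f 2F + N3 * (f 3F - f 1F)
        ≡⟨ cong₂ (λ t o → N0 * f 0F + (t - N2 - N0) * f 1F + N2 * f 2F + o * (f 3F - f 1F)) total n3 ⟩
      N0 * f 0F + (k - N2 - N0) * f 1F + N2 * f 2F + 0# * (f 3F - f 1F)
        ≡⟨ drop _ _ ⟩
      N0 * f 0F + (k - N2 - N0) * f 1F + N2 * f 2F
        ≡⟨ cong₂ (λ p q → p * f 0F + (k - q - p) * f 1F + q * f 2F) n0 n2 ⟩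
      ι (+ c 1F) * f 0F + (k - ι (+ b 1F) - ι (+ c 1F)) * f 1F + ι (+ b 1F) * f 2F
        ≡⟨ cong (λ t → ι (+ c 1F) * f 0F + t * f 1F + ι (+ b 1F) * f 2F) (ι-a 1F) ⟨
      L f 1F ∎
      where
      n0 : N0 ≡ ι (+ c 1F)
      n0 = cong (λ m → ι (+ m)) (closer 1F (dist⇒at eq))
      n2 : N2 ≡ ι (+ b 1F)
      n2 = cong (λ m → ι (+ m)) (nbrs-further 1F 2F refl eq)
      n3 : N3 ≡ 0#
      n3 = fall (nbrs-far 3F (subst (λ i → suc (toℕ i) ℕ.< 3) (sym eq) (s≤s (s≤s (s≤s z≤n)))))
    by 2F eq = begin
      N0 * f 0F + (N1 * f 1F + (N2 * f 2F + N3 * f 3F))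
        ≡⟨ solve 8 (λ n0 n1 n2 n3 p q r s → n0 :* p :+ (n1 :* q :+ (n2 :* r :+ n3 :* s)) :=
             n1 :* q :+ (n0 :+ n1 :+ n2 :+ n3 :- n3 :- n1) :* r :+ n3 :* s :+ n0 :* (p :- r))
             refl N0 N1 N2 N3 (f 0F) (f 1F) (f 2F) (f 3F) ⟩
      N1 * f 1F + (N0 + N1 + N2 + N3 - N3 - N1) * f 2F + N3 * f 3F + N0 * (f 0F - f 2F)
        ≡⟨ cong₂ (λ t o → N1 * f 1F + (t - N3 - N1) * f 2F + N3 * f 3F + o * (f 0F - f 2F)) total n0 ⟩
      N1 * f 1F + (k - N3 - N1) * f 2F + N3 * f 3F + 0# * (f 0F - f 2F)
        ≡⟨ drop _ _ ⟩
      N1 * f 1F + (k - N3 - N1) * f 2F + N3 * f 3F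
        ≡⟨ cong₂ (λ p q → p * f 1F + (k - q - p) * f 2F + q * f 3F) n1 n3 ⟩
      ι (+ c 2F) * f 1F + (k - ι (+ b 2F) - ι (+ c 2F)) * f 2F + ι (+ b 2F) * f 3F
        ≡⟨ cong (λ t → ι (+ c 2F) * f 1F + t * f 2F + ι (+ b 2F) * f 3F) (ι-a 2F) ⟨
      L f 2F ∎
      where
      n1 : N1 ≡ ι (+ c 2F)
      n1 = cong (λ m → ι (+ m)) (closer 2F (dist⇒at eq))
      n3 : N3 ≡ ι (+ b 2F)
      n3 = cong (λ m → ι (+ m)) (nbrs-further 2F 3F refl eq)
      n0 : N0 ≡ 0#
      n0 = fall (nbrs-near 0F (subst (λ i → 1 ℕ.< toℕ i) (sym eq) (s≤s (s≤s z≤n))))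
    by 3F eq = begin
      N0 * f 0F + (N1 * f 1F + (N2 * f 2F + N3 * f 3F))
        ≡⟨ solve 8 (λ n0 n1 n2 n3 p q r s → n0 :* p :+ (n1 :* q :+ (n2 :* r :+ n3 :* s)) :=
             n2 :* r :+ (n0 :+ n1 :+ n2 :+ n3 :- n2) :* s :+ n0 :* (p :- s) :+ n1 :* (q :- s))
             refl N0 N1 N2 N3 (f 0F) (f 1F) (f 2F) (f 3F) ⟩
      N2 * f 2F + (N0 + N1 + N2 + N3 - N2) * f 3F + N0 * (f 0F - f 3F) + N1 * (f 1F - f 3F)
        ≡⟨ cong₂ (λ p q → N2 * f 2F + (N0 + N1 + N2 + N3 - N2) * f 3F + p * (f 0F - f 3F) + q * (f 1F - f 3F)) n0 n1 ⟩
      N2 * f 2F + (N0 + N1 + N2 + N3 - N2) * f 3F + 0# * (f 0F - f 3F) + 0# * (f 1F - f 3F)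
        ≡⟨ trans (drop _ _) (drop _ _) ⟩
      N2 * f 2F + (N0 + N1 + N2 + N3 - N2) * f 3F
        ≡⟨ cong₂ (λ t p → p * f 2F + (t - p) * f 3F) total n2 ⟩
      ι (+ c 3F) * f 2F + (k - ι (+ c 3F)) * f 3F
        ≡⟨ cong (λ t → ι (+ c 3F) * f 2F + t * f 3F) ι-a₃ ⟨
      L f 3F ∎
      where
      n2 : N2 ≡ ι (+ c 3F)
      n2 = cong (λ m → ι (+ m)) (closer 3F (dist⇒at eq))
      n0 : N0 ≡ 0#
      n0 = fall (nbrs-near 0F (subst (λ i → 1 ℕ.< toℕ i) (sym eq) (s≤s (s≤s z≤n))))
      n1 : N1 ≡ 0#
      n1 = fall (nbrs-near 1F (subst (λ i → 2 ℕ.< toℕ i) (sym eq) (s≤s (s≤s (s≤s z≤n)))))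
      b₃≡0 : b 3F ≡ 0
      b₃≡0 = trans (sym (further 3F (dist⇒at eq))) (count-none (nbr? 4 x y) λ z (_ , at) → ℕ.<⇒≱ (proj₁ diameter at) ℕ.≤-refl)
      ι-a₃ : ι (a 3F) ≡ k - ι (+ c 3F)
      ι-a₃ = trans (ι-a 3F) (trans (cong (λ t → k - t - ι (+ c 3F)) (fall b₃≡0))
        (trans (cong (λ t → k - t - ι (+ c 3F)) (sym ι-0)) (solve 2 (λ k c → k :- con (+ 0) :- c := k :- c) refl k (ι (+ c 3F)))))

  -- The matrix with entries g (dist y z), applied to φ. For g = `e i` this is the sum over the
  -- sphere of radius i.
  T : (Fin 4 → Carrier) → (Fin n → Carrier) → Fin n → Carrier
  T g φ y = ∑ (λ z → g (dist y z) * φ z)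

  A· : (Fin n → Carrier) → Fin n → Carrier
  A· φ y = ∑ (λ z → α y z * φ z)

  -- The matrix of `L g` is the matrix of g times the adjacency matrix, because the latter is
  -- symmetric.
  T-L : ∀ g φ y → T (L g) φ y ≡ T g (A· φ) y
  T-L g φ y = begin
    ∑ (λ w → L g (dist y w) * φ w)
      ≡⟨ ∑-cong (λ w → trans (cong (_* φ w) (sym (sum-over-nbrs′ g y w))) (sym (∑-*ʳ (φ w) _))) ⟩
    ∑ (λ w → ∑ (λ z → (α w z * g (dist y z)) * φ w))
      ≡⟨ ∑-swap _ ⟩
    ∑ (λ z → ∑ (λ w → (α w z * g (dist y z)) * φ w))
      ≡⟨ ∑-cong (λ z → trans (∑-cong (λ w → trans (cong (λ s → (s * _) * φ w) (α-sym w z))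
           (solve 3 (λ s g p → (s :* g) :* p := g :* (s :* p)) refl (α z w) (g (dist y z)) (φ w)))) (∑-*ˡ _ _)) ⟩
    ∑ (λ z → g (dist y z) * ∑ (λ w → α z w * φ w)) ∎
    where open ≡-Reasoning

  τ : Fin 4 → (Fin n → Carrier) → Fin n → Carrier
  τ i = T (e i)

  T-expand : ∀ g φ y → T g φ y ≡ g 0F * τ 0F φ y + (g 1F * τ 1F φ y + (g 2F * τ 2F φ y + g 3F * τ 3F φ y))
  T-expand g φ y = begin
    ∑ (λ z → g (dist y z) * φ z)
      ≡⟨ ∑-cong (λ z → trans (cong (_* φ z) (trans (sym (∑-e g (dist y z))) (∑-cong (λ j → trans (cong (_* g j) (e-comm (dist y z) j)) (*-comm _ _)))))
           (trans (sym (∑-*ʳ (φ z) _)) (∑-cong (λ j → *-assoc _ _ _)))) ⟩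
    ∑ (λ z → ∑ (λ j → g j * (e j (dist y z) * φ z)))
      ≡⟨ ∑-swap _ ⟩
    ∑ (λ j → ∑ (λ z → g j * (e j (dist y z) * φ z)))
      ≡⟨ ∑-cong (λ j → ∑-*ˡ (g j) _) ⟩
    ∑ (λ j → g j * τ j φ y)
      ≡⟨ ∑4 _ ⟩
    _ ∎
    where open ≡-Reasoning

  τ₀ : ∀ φ y → τ 0F φ y ≡ φ y
  τ₀ φ y = trans (∑-cong λ z → cong (_* φ z) (cong [_] (does-⇔ (0F Fin.≟ dist y z) (y Fin.≟ z)
    (dist≡0⇒≡ ∘ sym) (λ { refl → sym (dist-refl y) })))) (∑-e φ y)

  T-+ : ∀ g φ ψ y → T g (λ z → φ z + ψ z) y ≡ T g φ y + T g ψ y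
  T-+ g φ ψ y = trans (∑-cong (λ z → solve 3 (λ g p q → g :* (p :+ q) := g :* p :+ g :* q) refl (g (dist y z)) (φ z) (ψ z))) (∑-+ _ _)

  T-* : ∀ g s φ y → T g (λ z → s * φ z) y ≡ s * T g φ y
  T-* g s φ y = trans (∑-cong (λ z → solve 3 (λ g s p → g :* (s :* p) := s :* (g :* p)) refl (g (dist y z)) s (φ z))) (∑-*ˡ s _)

  -- The relations A A_g = A_{L g} applied to a vector that is an eigenvector
  -- up to the defect r.
  recurrence : ∀ θ φ r → (∀ z → A· φ z ≡ θ * φ z + r z) → ∀ g y →
    L g 0F * τ 0F φ y + (L g 1F * τ 1F φ y + (L g 2F * τ 2F φ y + L g 3F * τ 3F φ y)) ≡ θ * T g φ y + T g r y
  recurrence θ φ r Aφ g y = begin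
    _                                  ≡⟨ T-expand (L g) φ y ⟨
    T (L g) φ y                        ≡⟨ T-L g φ y ⟩
    T g (A· φ) y                       ≡⟨ ∑-cong (λ z → cong (g (dist y z) *_) (Aφ z)) ⟩
    T g (λ z → θ * φ z + r z) y        ≡⟨ T-+ g (λ z → θ * φ z) r y ⟩
    T g (λ z → θ * φ z) y + T g r y    ≡⟨ cong (_+ T g r y) (T-* g θ φ y) ⟩
    θ * T g φ y + T g r y              ∎
    where open ≡-Reasoning

  -- For an indicator g = `e j` at most three values of `L g` are nonzero, which gives short
  -- recurrences for the sphere sums. The defect r has two uses: it is the error of an approximate
  -- eigenvector, and with θ = 0 it lets the recurrences be applied to an arbitrary φ.
  module _ (θ : Carrier) (φ r : Fin n → Carrier) (Aφ : ∀ z → A· φ z ≡ θ * φ z + r z) (y : Fin n) where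
    private
      k c1 a1 b1 c2 a2 b2 c3 a3 t0 t1 t2 t3 : Carrier
      k = ι (+ valency)
      c1 = ι (+ c 1F)
      a1 = ι (a 1F)
      b1 = ι (+ b 1F)
      c2 = ι (+ c 2F)
      a2 = ι (a 2F)
      b2 = ι (+ b 2F)
      c3 = ι (+ c 3F)
      a3 = ι (a 3F)
      t0 = τ 0F φ y
      t1 = τ 1F φ y
      t2 = τ 2F φ y
      t3 = τ 3F φ y

    recurrence₀ : c1 * τ 1F φ y ≡ θ * φ y + r y
    recurrence₀ = trans (solve 13 (λ k c1 a1 b1 c2 a2 b2 c3 a3 t0 t1 t2 t3 → c1 :* t1 :=
        k :* con (+ 0) :* t0 :+ ((c1 :* con (+ 1) :+ a1 :* con (+ 0) :+ b1 :* con (+ 0)) :* t1 :+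
        ((c2 :* con (+ 0) :+ a2 :* con (+ 0) :+ b2 :* con (+ 0)) :* t2 :+ (c3 :* con (+ 0) :+ a3 :* con (+ 0)) :* t3))) refl
        k c1 a1 b1 c2 a2 b2 c3 a3 t0 t1 t2 t3)
      (trans (recurrence θ φ r Aφ (e 0F) y) (cong₂ (λ p q → θ * p + q) (τ₀ φ y) (τ₀ r y)))

    recurrence₁ : k * φ y + a1 * τ 1F φ y + c2 * τ 2F φ y ≡ θ * τ 1F φ y + τ 1F r y
    recurrence₁ = trans (cong (λ t → k * t + a1 * t1 + c2 * t2) (sym (τ₀ φ y)))
      (trans (solve 13 (λ k c1 a1 b1 c2 a2 b2 c3 a3 t0 t1 t2 t3 → k :* t0 :+ a1 :* t1 :+ c2 :* t2 :=
        k :* con (+ 1) :* t0 :+ ((c1 :* con (+ 0) :+ a1 :* con (+ 1) :+ b1 :* con (+ 0)) :* t1 :+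
        ((c2 :* con (+ 1) :+ a2 :* con (+ 0) :+ b2 :* con (+ 0)) :* t2 :+ (c3 :* con (+ 0) :+ a3 :* con (+ 0)) :* t3))) refl
        k c1 a1 b1 c2 a2 b2 c3 a3 t0 t1 t2 t3)
      (recurrence θ φ r Aφ (e 1F) y))

    recurrence₂ : b1 * τ 1F φ y + a2 * τ 2F φ y + c3 * τ 3F φ y ≡ θ * τ 2F φ y + τ 2F r y
    recurrence₂ = trans (solve 13 (λ k c1 a1 b1 c2 a2 b2 c3 a3 t0 t1 t2 t3 → b1 :* t1 :+ a2 :* t2 :+ c3 :* t3 :=
        k :* con (+ 0) :* t0 :+ ((c1 :* con (+ 0) :+ a1 :* con (+ 0) :+ b1 :* con (+ 1)) :* t1 :+
        ((c2 :* con (+ 0) :+ a2 :* con (+ 1) :+ b2 :* con (+ 0)) :* t2 :+ (c3 :* con (+ 1) :+ a3 :* con (+ 0)) :* t3))) refl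
        k c1 a1 b1 c2 a2 b2 c3 a3 t0 t1 t2 t3)
      (recurrence θ φ r Aφ (e 2F) y)

    recurrence₃ : b2 * τ 2F φ y + a3 * τ 3F φ y ≡ θ * τ 3F φ y + τ 3F r y
    recurrence₃ = trans (solve 13 (λ k c1 a1 b1 c2 a2 b2 c3 a3 t0 t1 t2 t3 → b2 :* t2 :+ a3 :* t3 :=
        k :* con (+ 0) :* t0 :+ ((c1 :* con (+ 0) :+ a1 :* con (+ 0) :+ b1 :* con (+ 0)) :* t1 :+
        ((c2 :* con (+ 0) :+ a2 :* con (+ 0) :+ b2 :* con (+ 1)) :* t2 :+ (c3 :* con (+ 0) :+ a3 :* con (+ 1)) :* t3))) refl
        k c1 a1 b1 c2 a2 b2 c3 a3 t0 t1 t2 t3)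
      (recurrence θ φ r Aφ (e 3F) y)

  T-ι0 : ∀ g y → T g (λ _ → ι (+ 0)) y ≡ ι (+ 0)
  T-ι0 g y = trans (∑-0 (λ z → trans (*-comm _ _) (ι0* _))) (sym ι-0)

  M : (Fin 4 → Carrier) → Fin n → Fin n → Carrier
  M f x y = f (dist x y)

  M-sym : ∀ f x y → M f x y ≡ M f y x
  M-sym f x y = cong f (dist-sym x y)

  ∑-const : ∀ {m} s → ∑ {m} (λ _ → s) ≡ ι (+ m) * s
  ∑-const {zero}  s = trans (∑-empty _) (sym (ι0* s))
  ∑-const {suc m} s = begin
    ∑ {suc m} (λ _ → s)    ≡⟨ ∑-suc _ ⟩
    s + ∑ {m} (λ _ → s)    ≡⟨ cong (λ u → s + u) (∑-const s) ⟩
    s + ι (+ m) * s        ≡⟨ solve 2 (λ m s → s :+ m :* s := (con (+ 1) :+ m) :* s) refl (ι (+ m)) s ⟩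
    (ι (+ 1) + ι (+ m)) * s ≡⟨ cong (_* s) (ι-+ (+ 1) (+ m)) ⟨
    ι (+ suc m) * s        ∎
    where open ≡-Reasoning

  trace-M : ∀ f → ∑ (λ x → M f x x) ≡ ι (+ n) * f 0F
  trace-M f = trans (∑-cong (λ x → cong f (dist-refl x))) (∑-const (f 0F))

-- The domains of integers, of rationals and of quadratic integers

ℤ-domain : Domain
ℤ-domain = record
  { isCommutativeRing = ℤ.+-*-isCommutativeRing
  ; ι = λ z → z ; ι-+ = λ _ _ → refl ; ι-* = λ _ _ → refl ; ι-neg = λ _ → refl ; ι-0 = refl ; ι-1 = refl
  ; integral = λ x _ → ℤ.i*j≡0⇒i≡0∨j≡0 x
  ; _≟_ = ℤ._≟_
  }

fromInteger : ℤ → ℚ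
fromInteger z = z ℚ./ 1

module _ where
  private
    toℚᵘ-fromInteger : ∀ z → toℚᵘ (fromInteger z) ℚᵘ.≃ mkℚᵘ z 0
    toℚᵘ-fromInteger z = ℚ.toℚᵘ-fromℚᵘ (mkℚᵘ z 0)

  fromInteger-+ : ∀ x y → fromInteger (x ℤ.+ y) ≡ fromInteger x ℚ.+ fromInteger y
  fromInteger-+ x y = ℚ.toℚᵘ-injective (begin
    toℚᵘ (fromInteger (x ℤ.+ y))                   ≈⟨ toℚᵘ-fromInteger (x ℤ.+ y) ⟩
    mkℚᵘ (x ℤ.+ y) 0                               ≈⟨ *≡* (cong (ℤ._* + 1) (cong₂ ℤ._+_ (sym (ℤ.*-identityʳ x)) (sym (ℤ.*-identityʳ y)))) ⟩
    mkℚᵘ x 0 ℚᵘ.+ mkℚᵘ y 0                         ≈⟨ ℚᵘ.+-cong (toℚᵘ-fromInteger x) (toℚᵘ-fromInteger y) ⟨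
    toℚᵘ (fromInteger x) ℚᵘ.+ toℚᵘ (fromInteger y) ≈⟨ ℚ.toℚᵘ-homo-+ (fromInteger x) (fromInteger y) ⟨
    toℚᵘ (fromInteger x ℚ.+ fromInteger y)         ∎)
    where open ℚᵘ.≃-Reasoning

  fromInteger-* : ∀ x y → fromInteger (x ℤ.* y) ≡ fromInteger x ℚ.* fromInteger y
  fromInteger-* x y = ℚ.toℚᵘ-injective (begin
    toℚᵘ (fromInteger (x ℤ.* y))                   ≈⟨ toℚᵘ-fromInteger (x ℤ.* y) ⟩
    mkℚᵘ x 0 ℚᵘ.* mkℚᵘ y 0                         ≈⟨ ℚᵘ.*-cong (toℚᵘ-fromInteger x) (toℚᵘ-fromInteger y) ⟨
    toℚᵘ (fromInteger x) ℚᵘ.* toℚᵘ (fromInteger y) ≈⟨ ℚ.toℚᵘ-homo-* (fromInteger x) (fromInteger y) ⟨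
    toℚᵘ (fromInteger x ℚ.* fromInteger y)         ∎)
    where open ℚᵘ.≃-Reasoning

  fromInteger-neg : ∀ x → fromInteger (ℤ.- x) ≡ ℚ.- fromInteger x
  fromInteger-neg x = ℚ.toℚᵘ-injective (begin
    toℚᵘ (fromInteger (ℤ.- x))   ≈⟨ toℚᵘ-fromInteger (ℤ.- x) ⟩
    ℚᵘ.- mkℚᵘ x 0                ≈⟨ ℚᵘ.-‿cong (toℚᵘ-fromInteger x) ⟨
    ℚᵘ.- toℚᵘ (fromInteger x)    ≈⟨ ℚ.toℚᵘ-homo‿- (fromInteger x) ⟨
    toℚᵘ (ℚ.- fromInteger x)     ∎)
    where open ℚᵘ.≃-Reasoning

  ℚ-integral : ∀ p q → p ℚ.* q ≡ 0ℚ → p ≡ 0ℚ ⊎ q ≡ 0ℚ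
  ℚ-integral p q pq≡0 with p ℚ.≟ 0ℚ
  ... | yes p≡0 = inj₁ p≡0
  ... | no  p≢0 = inj₂ (begin
    q                    ≡⟨ ℚ.*-identityˡ q ⟨
    1ℚ ℚ.* q             ≡⟨ cong (ℚ._* q) (ℚ.*-inverseˡ p) ⟨
    1/p ℚ.* p ℚ.* q      ≡⟨ ℚ.*-assoc 1/p p q ⟩
    1/p ℚ.* (p ℚ.* q)    ≡⟨ cong (1/p ℚ.*_) pq≡0 ⟩
    1/p ℚ.* 0ℚ           ≡⟨ ℚ.*-zeroʳ 1/p ⟩
    0ℚ                   ∎)
    where
    open ≡-Reasoning
    instance
      p-nonZero : ℚ.NonZero p
      p-nonZero = ℚ.≢-nonZero p≢0
    1/p : ℚ
    1/p = ℚ.1/ p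

ℚ-domain : Domain
ℚ-domain = record
  { isCommutativeRing = ℚ.+-*-isCommutativeRing
  ; ι = fromInteger ; ι-+ = fromInteger-+ ; ι-* = fromInteger-* ; ι-neg = fromInteger-neg ; ι-0 = refl ; ι-1 = refl
  ; integral = ℚ-integral
  ; _≟_ = ℚ._≟_
  }

-- After division by the gcd the quotients m′ and n′ are coprime and m′² divides n′², so m′ divides
-- n′ and is therefore 1.
m*m∣n*n⇒m∣n : ∀ m n .{{_ : ℕ.NonZero m}} → m ℕ.* m ∣ n ℕ.* n → m ∣ n
m*m∣n*n⇒m∣n m n m²∣n² = subst (_∣ n) (sym m≡g) (gcd[m,n]∣n m n)
  where
  g : ℕ
  g = gcd m n
  instance
    g-nonZero : ℕ.NonZero g
    g-nonZero = ℕ.≢-nonZero (gcd[m,n]≢0 m n (inj₁ (ℕ.≢-nonZero⁻¹ m)))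
    g²-nonZero : ℕ.NonZero (g ℕ.* g)
    g²-nonZero = ℕ.m*n≢0 g g
  m′ n′ : ℕ
  m′ = m ℕ./ g
  n′ = n ℕ./ g
  square : ∀ x → g ∣ x → (x ℕ./ g) ℕ.* (x ℕ./ g) ℕ.* (g ℕ.* g) ≡ x ℕ.* x
  square x g∣x = trans (lemma (x ℕ./ g) g) (cong₂ ℕ._*_ (m/n*n≡m g∣x) (m/n*n≡m g∣x))
    where
    lemma : ∀ q g → q ℕ.* q ℕ.* (g ℕ.* g) ≡ (q ℕ.* g) ℕ.* (q ℕ.* g)
    lemma = ℕRing.solve-∀
  m′²∣n′² : m′ ℕ.* m′ ∣ n′ ℕ.* n′
  m′²∣n′² = ℕ.*-cancelʳ-∣ (g ℕ.* g) (subst₂ _∣_ (sym (square m (gcd[m,n]∣m m n))) (sym (square n (gcd[m,n]∣n m n))) m²∣n²)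
  coprime : Coprime m′ n′
  coprime = coprime-/gcd m n
  m′∣n′ : m′ ∣ n′
  m′∣n′ = coprime-divisor coprime (ℕ.∣-trans (ℕ.m∣m*n m′) m′²∣n′²)
  m≡g : m ≡ g
  m≡g = trans (sym (m/n*n≡m (gcd[m,n]∣m m n))) (trans (cong (ℕ._* g) (coprime (ℕ.∣-refl , m′∣n′))) (ℕ.*-identityˡ g))

-- The pair (p , q) stands for p + q τ, where τ² + S τ + P = 0.
module Quadratic (S P : ℤ) where
  open ℤ.+-*-Solver

  discriminant : ℤ
  discriminant = S ℤ.* S ℤ.- + 4 ℤ.* P

  infixl 6 _⊕_
  infixl 7 _⊛_

  _⊕_ _⊛_ : ℤ × ℤ → ℤ × ℤ → ℤ × ℤ
  (p , q) ⊕ (r , s) = p ℤ.+ r , q ℤ.+ s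
  (p , q) ⊛ (r , s) = p ℤ.* r ℤ.- P ℤ.* (q ℤ.* s) , p ℤ.* s ℤ.+ q ℤ.* r ℤ.- S ℤ.* (q ℤ.* s)

  ⊝_ : ℤ × ℤ → ℤ × ℤ
  ⊝ (p , q) = ℤ.- p , ℤ.- q

  private
    *-assoc′ : ∀ x y z → (x ⊛ y) ⊛ z ≡ x ⊛ (y ⊛ z)
    *-assoc′ (p , q) (r , s) (t , u) = cong₂ _,_
      (solve 8 (λ S P p q r s t u → (p :* r :- P :* (q :* s)) :* t :- P :* ((p :* s :+ q :* r :- S :* (q :* s)) :* u) :=
        p :* (r :* t :- P :* (s :* u)) :- P :* (q :* (r :* u :+ s :* t :- S :* (s :* u)))) refl S P p q r s t u)
      (solve 8 (λ S P p q r s t u →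
        (p :* r :- P :* (q :* s)) :* u :+ (p :* s :+ q :* r :- S :* (q :* s)) :* t :- S :* ((p :* s :+ q :* r :- S :* (q :* s)) :* u) :=
        p :* (r :* u :+ s :* t :- S :* (s :* u)) :+ q :* (r :* t :- P :* (s :* u)) :- S :* (q :* (r :* u :+ s :* t :- S :* (s :* u))))
        refl S P p q r s t u)

    *-comm′ : ∀ x y → x ⊛ y ≡ y ⊛ x
    *-comm′ (p , q) (r , s) = cong₂ _,_
      (solve 5 (λ P p q r s → p :* r :- P :* (q :* s) := r :* p :- P :* (s :* q)) refl P p q r s)
      (solve 5 (λ S p q r s → p :* s :+ q :* r :- S :* (q :* s) := r :* q :+ s :* p :- S :* (s :* q)) refl S p q r s)

    *-identityˡ′ : ∀ x → (+ 1 , + 0) ⊛ x ≡ x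
    *-identityˡ′ (p , q) = cong₂ _,_
      (solve 3 (λ P p q → con (+ 1) :* p :- P :* (con (+ 0) :* q) := p) refl P p q)
      (solve 3 (λ S p q → con (+ 1) :* q :+ con (+ 0) :* p :- S :* (con (+ 0) :* q) := q) refl S p q)

    distribˡ′ : ∀ x y z → x ⊛ (y ⊕ z) ≡ x ⊛ y ⊕ x ⊛ z
    distribˡ′ (p , q) (r , s) (t , u) = cong₂ _,_
      (solve 7 (λ P p q r s t u → p :* (r :+ t) :- P :* (q :* (s :+ u)) := (p :* r :- P :* (q :* s)) :+ (p :* t :- P :* (q :* u)))
        refl P p q r s t u)
      (solve 7 (λ S p q r s t u → p :* (s :+ u) :+ q :* (r :+ t) :- S :* (q :* (s :+ u)) :=
        (p :* s :+ q :* r :- S :* (q :* s)) :+ (p :* u :+ q :* t :- S :* (q :* u))) refl S p q r s t u)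

  ⊕-⊛-isCommutativeRing : IsCommutativeRing _≡_ _⊕_ _⊛_ ⊝_ (+ 0 , + 0) (+ 1 , + 0)
  ⊕-⊛-isCommutativeRing = record
    { isRing = record
      { +-isAbelianGroup = record
        { isGroup = record
          { isMonoid = record
            { isSemigroup = record
              { isMagma = record { isEquivalence = isEquivalence ; ∙-cong = cong₂ _⊕_ }
              ; assoc = λ { (p , q) (r , s) (t , u) → cong₂ _,_ (ℤ.+-assoc p r t) (ℤ.+-assoc q s u) }
              }
            ; identity = (λ { (p , q) → cong₂ _,_ (ℤ.+-identityˡ p) (ℤ.+-identityˡ q) })
                       , (λ { (p , q) → cong₂ _,_ (ℤ.+-identityʳ p) (ℤ.+-identityʳ q) })
            }
          ; inverse = (λ { (p , q) → cong₂ _,_ (ℤ.+-inverseˡ p) (ℤ.+-inverseˡ q) })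
                    , (λ { (p , q) → cong₂ _,_ (ℤ.+-inverseʳ p) (ℤ.+-inverseʳ q) })
          ; ⁻¹-cong = cong ⊝_
          }
        ; comm = λ { (p , q) (r , s) → cong₂ _,_ (ℤ.+-comm p r) (ℤ.+-comm q s) }
        }
      ; *-cong = cong₂ _⊛_
      ; *-assoc = *-assoc′
      ; *-identity = *-identityˡ′ , λ x → trans (*-comm′ x (+ 1 , + 0)) (*-identityˡ′ x)
      ; distrib = distribˡ′ , λ x y z → trans (*-comm′ (y ⊕ z) x) (trans (distribˡ′ x y z) (cong₂ _⊕_ (*-comm′ x y) (*-comm′ x z)))
      }
    ; *-comm = *-comm′
    }

  -- The product of p + q τ with its conjugate: the two values of τ have sum - S and product P.
  norm : ℤ × ℤ → ℤ
  norm (p , q) = p ℤ.* p ℤ.- S ℤ.* (p ℤ.* q) ℤ.+ P ℤ.* (q ℤ.* q)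

  norm-⊛ : ∀ x y → norm (x ⊛ y) ≡ norm x ℤ.* norm y
  norm-⊛ (p , q) (r , s) = solve 6 (λ S P p q r s →
    let u = p :* r :- P :* (q :* s) ; v = p :* s :+ q :* r :- S :* (q :* s) in
    u :* u :- S :* (u :* v) :+ P :* (v :* v) :=
    (p :* p :- S :* (p :* q) :+ P :* (q :* q)) :* (r :* r :- S :* (r :* s) :+ P :* (s :* s))) refl S P p q r s

  module _ (nonsquare : ∀ d → discriminant ≢ d ℤ.* d) where

    -- Four times the norm is x² - D q² with x = 2 p - S q and D the discriminant. If it vanishes
    -- and q ≠ 0, then q divides x, and D is the square of x / q.
    norm≡0 : ∀ x → norm x ≡ + 0 → x ≡ (+ 0 , + 0)
    norm≡0 (p , q) n≡0 with q ℤ.≟ + 0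
    ... | yes refl = cong (_, + 0) p≡0
      where
      p²≡0 : p ℤ.* p ≡ + 0
      p²≡0 = trans (solve 3 (λ S P p → p :* p := p :* p :- S :* (p :* con (+ 0)) :+ P :* (con (+ 0) :* con (+ 0))) refl S P p) n≡0
      p≡0 : p ≡ + 0
      p≡0 with ℤ.i*j≡0⇒i≡0∨j≡0 p p²≡0
      ... | inj₁ eq = eq
      ... | inj₂ eq = eq
    ... | no q≢0 = contradiction D≡d² (nonsquare (+ d))
      where
      open ≡-Reasoning
      x : ℤ
      x = + 2 ℤ.* p ℤ.- S ℤ.* q
      x²≡Dq² : x ℤ.* x ≡ discriminant ℤ.* (q ℤ.* q)
      x²≡Dq² = begin
        x ℤ.* x ≡⟨ solve 4 (λ S P p q → (con (+ 2) :* p :- S :* q) :* (con (+ 2) :* p :- S :* q) :=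
                     (S :* S :- con (+ 4) :* P) :* (q :* q) :+ con (+ 4) :* (p :* p :- S :* (p :* q) :+ P :* (q :* q))) refl S P p q ⟩
        discriminant ℤ.* (q ℤ.* q) ℤ.+ + 4 ℤ.* norm (p , q) ≡⟨ cong (λ n → discriminant ℤ.* (q ℤ.* q) ℤ.+ + 4 ℤ.* n) n≡0 ⟩
        discriminant ℤ.* (q ℤ.* q) ℤ.+ + 0 ≡⟨ ℤ.+-identityʳ _ ⟩
        discriminant ℤ.* (q ℤ.* q) ∎
      instance
        ∣q∣-nonZero : ℕ.NonZero (abs q)
        ∣q∣-nonZero = ℤ.≢-nonZero q≢0
        q²-nonZero : ℤ.NonZero (q ℤ.* q)
        q²-nonZero = ℤ.i*j≢0 q q
      ∣q∣²∣∣x∣² : (abs q) ℕ.* (abs q) ∣ (abs x) ℕ.* (abs x)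
      ∣q∣²∣∣x∣² = divides (abs discriminant) (begin
        (abs x) ℕ.* (abs x)                          ≡⟨ ℤ.abs-* x x ⟨
        (abs (x ℤ.* x))                              ≡⟨ cong abs x²≡Dq² ⟩
        (abs (discriminant ℤ.* (q ℤ.* q)))           ≡⟨ ℤ.abs-* discriminant (q ℤ.* q) ⟩
        (abs discriminant) ℕ.* (abs (q ℤ.* q))         ≡⟨ cong ((abs discriminant) ℕ.*_) (ℤ.abs-* q q) ⟩
        (abs discriminant) ℕ.* ((abs q) ℕ.* (abs q))   ∎)
      ∣q∣∣∣x∣ : (abs q) ∣ (abs x)
      ∣q∣∣∣x∣ = m*m∣n*n⇒m∣n (abs q) (abs x) ∣q∣²∣∣x∣²
      d : ℕ
      d = ℕ.quotient ∣q∣∣∣x∣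
      ∣x∣≡d∣q∣ : (abs x) ≡ d ℕ.* (abs q)
      ∣x∣≡d∣q∣ = ℕ._∣_.equality ∣q∣∣∣x∣
      sq : ∀ i → i ℤ.* i ≡ + ((abs i) ℕ.* (abs i))
      sq (+ n)      = sym (ℤ.pos-* n n)
      sq ℤ.-[1+ n ] = refl
      D≡d² : discriminant ≡ + d ℤ.* + d
      D≡d² = ℤ.*-cancelʳ-≡ _ _ (q ℤ.* q) (begin
        discriminant ℤ.* (q ℤ.* q)                ≡⟨ x²≡Dq² ⟨
        x ℤ.* x                                   ≡⟨ sq x ⟩
        + ((abs x) ℕ.* (abs x))                       ≡⟨ cong (λ m → + (m ℕ.* m)) ∣x∣≡d∣q∣ ⟩
        + ((d ℕ.* (abs q)) ℕ.* (d ℕ.* (abs q)))       ≡⟨ cong +_ (lemma d (abs q)) ⟩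
        + (d ℕ.* d ℕ.* ((abs q) ℕ.* (abs q)))         ≡⟨ ℤ.pos-* (d ℕ.* d) _ ⟩
        + (d ℕ.* d) ℤ.* + ((abs q) ℕ.* (abs q))       ≡⟨ cong₂ ℤ._*_ (ℤ.pos-* d d) (sym (sq q)) ⟩
        + d ℤ.* + d ℤ.* (q ℤ.* q)                 ∎)
        where
        lemma : ∀ d q → (d ℕ.* q) ℕ.* (d ℕ.* q) ≡ d ℕ.* d ℕ.* (q ℕ.* q)
        lemma = ℕRing.solve-∀

    quadratic-domain : Domain
    quadratic-domain = record
      { isCommutativeRing = ⊕-⊛-isCommutativeRing
      ; ι = λ z → z , + 0
      ; ι-+ = λ _ _ → refl
      ; ι-* = λ x y → cong₂ _,_
          (solve 3 (λ P x y → x :* y := x :* y :- P :* (con (+ 0) :* con (+ 0))) refl P x y)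
          (solve 3 (λ S x y → con (+ 0) := x :* con (+ 0) :+ con (+ 0) :* y :- S :* (con (+ 0) :* con (+ 0))) refl S x y)
      ; ι-neg = λ _ → refl
      ; ι-0 = refl
      ; ι-1 = refl
      ; integral = λ x y xy≡0 → zero-divisor x y (ℤ.i*j≡0⇒i≡0∨j≡0 (norm x) (trans (sym (norm-⊛ x y)) (trans (cong norm xy≡0)
          (solve 2 (λ S P → con (+ 0) :* con (+ 0) :- S :* (con (+ 0) :* con (+ 0)) :+ P :* (con (+ 0) :* con (+ 0)) := con (+ 0)) refl S P))))
      ; _≟_ = ≡-dec ℤ._≟_ ℤ._≟_
      }
      where
      zero-divisor : ∀ x y → norm x ≡ + 0 ⊎ norm y ≡ + 0 → x ≡ (+ 0 , + 0) ⊎ y ≡ (+ 0 , + 0)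
      zero-divisor x y (inj₁ eq) = inj₁ (norm≡0 x eq)
      zero-divisor x y (inj₂ eq) = inj₂ (norm≡0 y eq)

-- Null sequences and the relation forced by the eigenvalue a₃

count-some : ∀ {n} {P : Pred (Fin n) 0ℓ} (P? : Decidable P) {i} → P i → 1 ℕ.≤ count P?
count-some {n} {P} P? {i} Pi = go id i refl
  where
  go : ∀ {m} (f : Fin m → Fin n) j → f j ≡ i → 1 ℕ.≤ length (filter P? (tabulate f))
  go f zero    refl rewrite dec-true (P? (f zero)) Pi = s≤s z≤n
  go f (suc j) eq with does (P? (f zero))
  ... | true  = s≤s z≤n
  ... | false = go (f ∘ suc) j eq

-- For reals, x ≈ y unfolds to the difference of the two sequences being null, so an equation
-- between reals becomes a rational equation at every stage with a null error.
Null : (ℕ → ℚ) → Set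
Null s = ∀ ε → 0ℚ ℚ.< ε → ∃[ N ] (∀ m → N ℕ.≤ m → ∣ s m ∣ ℚ.< ε)

null-cong : ∀ {s t} → (∀ m → s m ≡ t m) → Null s → Null t
null-cong s≗t ns ε ε>0 with N , close ← ns ε ε>0 = N , λ m N≤m → subst (λ q → ∣ q ∣ ℚ.< ε) (s≗t m) (close m N≤m)

null-0 : Null (λ _ → 0ℚ)
null-0 ε ε>0 = 0 , λ _ _ → ε>0

null-+ : ∀ {s t} → Null s → Null t → Null (λ m → s m ℚ.+ t m)
null-+ {s} {t} ns nt ε ε>0 = combine (ns (ε ℚ.* ½) δ>0) (nt (ε ℚ.* ½) δ>0)
  where
  δ>0 : 0ℚ ℚ.< ε ℚ.* ½
  δ>0 = ℚ.positive⁻¹ _ {{ℚ.pos*pos⇒pos ε {{positive ε>0}} ½}}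
  half+half : ε ℚ.* ½ ℚ.+ ε ℚ.* ½ ≡ ε
  half+half = trans (sym (ℚ.*-distribˡ-+ ε ½ ½)) (ℚ.*-identityʳ ε)
  combine : ∃[ M ] (∀ m → M ℕ.≤ m → ∣ s m ∣ ℚ.< ε ℚ.* ½) → ∃[ N ] (∀ m → N ℕ.≤ m → ∣ t m ∣ ℚ.< ε ℚ.* ½) →
            ∃[ N ] (∀ m → N ℕ.≤ m → ∣ s m ℚ.+ t m ∣ ℚ.< ε)
  combine (M , s-close) (N , t-close) = M ℕ.⊔ N , λ m h → begin-strict
    ∣ s m ℚ.+ t m ∣        ≤⟨ ℚ.∣p+q∣≤∣p∣+∣q∣ (s m) (t m) ⟩
    ∣ s m ∣ ℚ.+ ∣ t m ∣    <⟨ ℚ.+-mono-< (s-close m (ℕ.m⊔n≤o⇒m≤o M N h)) (t-close m (ℕ.m⊔n≤o⇒n≤o M N h)) ⟩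
    ε ℚ.* ½ ℚ.+ ε ℚ.* ½    ≡⟨ half+half ⟩
    ε                      ∎
    where open ℚ.≤-Reasoning

null-* : ∀ q {s} → Null s → Null (λ m → q ℚ.* s m)
null-* q {s} ns ε ε>0 = scale (ns (1/B ℚ.* ε) δ>0)
  where
  B 1/B : ℚ
  B = 1ℚ ℚ.+ ∣ q ∣
  B>0 : 0ℚ ℚ.< B
  B>0 = ℚ.+-mono-<-≤ (ℚ.positive⁻¹ 1ℚ) (ℚ.0≤∣p∣ q)
  instance
    B-pos : Positive B
    B-pos = positive B>0
  1/B = (ℚ.1/ B) {{ℚ.pos⇒nonZero B}}
  δ>0 : 0ℚ ℚ.< 1/B ℚ.* ε
  δ>0 = ℚ.positive⁻¹ _ {{ℚ.pos*pos⇒pos 1/B {{ℚ.1/pos⇒pos B}} ε {{positive ε>0}}}}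
  B*δ≡ε : B ℚ.* (1/B ℚ.* ε) ≡ ε
  B*δ≡ε = trans (sym (ℚ.*-assoc B 1/B ε))
    (trans (cong (ℚ._* ε) (ℚ.*-inverseʳ B {{ℚ.pos⇒nonZero B}})) (ℚ.*-identityˡ ε))
  scale : ∃[ N ] (∀ m → N ℕ.≤ m → ∣ s m ∣ ℚ.< 1/B ℚ.* ε) → ∃[ N ] (∀ m → N ℕ.≤ m → ∣ q ℚ.* s m ∣ ℚ.< ε)
  scale (N , close) = N , λ m N≤m → begin-strict
    ∣ q ℚ.* s m ∣        ≡⟨ ℚ.∣p*q∣≡∣p∣*∣q∣ q (s m) ⟩
    ∣ q ∣ ℚ.* ∣ s m ∣    ≤⟨ ℚ.*-monoʳ-≤-nonNeg ∣ s m ∣ {{ℚ.nonNegative (ℚ.0≤∣p∣ (s m))}} ∣q∣≤B ⟩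
    B ℚ.* ∣ s m ∣        <⟨ ℚ.*-monoʳ-<-pos B (close m N≤m) ⟩
    B ℚ.* (1/B ℚ.* ε)    ≡⟨ B*δ≡ε ⟩
    ε                    ∎
    where
    open ℚ.≤-Reasoning
    ∣q∣≤B : ∣ q ∣ ℚ.≤ B
    ∣q∣≤B = subst (ℚ._≤ B) (ℚ.+-identityˡ ∣ q ∣) (ℚ.+-monoˡ-≤ ∣ q ∣ (ℚ.<⇒≤ (ℚ.positive⁻¹ 1ℚ)))

null-unscale : ∀ q {s} → q ≢ 0ℚ → Null (λ m → q ℚ.* s m) → Null s
null-unscale q {s} q≢0 ns = null-cong (λ m → begin
    1/q ℚ.* (q ℚ.* s m)   ≡⟨ ℚ.*-assoc 1/q q (s m) ⟨
    1/q ℚ.* q ℚ.* s m     ≡⟨ cong (ℚ._* s m) (ℚ.*-inverseˡ q) ⟩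
    1ℚ ℚ.* s m            ≡⟨ ℚ.*-identityˡ (s m) ⟩
    s m                   ∎) (null-* 1/q ns)
  where
  open ≡-Reasoning
  instance
    q-nonZero : ℚ.NonZero q
    q-nonZero = ℚ.≢-nonZero q≢0
  1/q : ℚ
  1/q = ℚ.1/ q

module ℚD = DomainProperties ℚ-domain

null-∑ : ∀ {n} (s : Fin n → ℕ → ℚ) → (∀ i → Null (s i)) → Null (λ m → ℚD.∑ (λ i → s i m))
null-∑ {zero}  s ns = null-cong (λ m → sym (ℚD.∑-empty _)) null-0
null-∑ {suc n} s ns = null-cong (λ m → sym (ℚD.∑-suc _)) (null-+ (ns zero) (null-∑ (s ∘ suc) (ns ∘ suc)))

fromInteger-injective₀ : ∀ z → fromInteger z ≡ 0ℚ → z ≡ + 0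
fromInteger-injective₀ z eq with ℚᵘ.≃-trans (ℚᵘ.≃-sym (ℚ.toℚᵘ-fromℚᵘ (ℚᵘ.mkℚᵘ z 0))) (ℚ.toℚᵘ-cong eq)
... | ℚᵘ.*≡* z*1≡0 = trans (sym (ℤ.*-identityʳ z)) z*1≡0

seq-∑ : ∀ {n} (f : Vector ℝ n) m → seq (D.∑ f) m ≡ ℚD.∑ (λ i → seq (f i) m)
seq-∑ {zero}  f m = sym (ℚD.∑-empty _)
seq-∑ {suc n} f m = trans (cong (seq (f zero) m ℚ.+_) (seq-∑ (f ∘ suc) m)) (sym (ℚD.∑-suc _))

module Parameters {n} (Γ : Graph n) (G : DistanceRegular Γ 3) where
  open Distance Γ G
  private
    module ℤS = Spectral ℤ-domain Γ G
    module ℤC = Counting ℤ-domain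
    module ℤD = DomainProperties ℤ-domain

  -- A shortest path between vertices at distance 3 supplies a pair at each positive distance, so
  -- that the intersection numbers are counts of actual sets.
  geodesic : ∃[ x ] ∃[ u ] ∃[ w ] ∃[ y ]
    Adj u w × Adj w y × dist x u ≡ 1F × dist x w ≡ 2F × dist x y ≡ 3F
  geodesic with x , y , at@((u , xu , w , uw , y′ , wy , refl) , _) ← proj₂ diameter =
    x , u , w , y , uw , wy , du , dw , dy
    where
    dy : dist x y ≡ 3F
    dy = at⇒dist 3F at
    du : dist x u ≡ 1F
    du = adj⇒dist xu
    low : 2 ℕ.≤ toℕ (dist x w)
    low = ℕ.≤-pred (subst (λ i → toℕ i ℕ.≤ suc (toℕ (dist x w))) dy (dist-step x wy))
    high : toℕ (dist x w) ℕ.≤ 2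
    high = subst (λ i → toℕ (dist x w) ℕ.≤ suc (toℕ i)) du (dist-step x uw)
    dw : dist x w ≡ 2F
    dw = Fin.toℕ-injective (ℕ.≤-antisym high low)

  -- Applying `L` to the indicator of i and evaluating at i isolates the coefficient aᵢ. Being a
  -- count, it is nonnegative.
  a≡nbrs : ∀ {x y} i → i ≢ 0F → dist x y ≡ i → a i ≡ + nbrs i x y
  a≡nbrs {x} {y} i i≢0 eq = begin
    a i                                  ≡⟨ middle i i≢0 ⟨
    ℤS.L (ℤC.e i) i                      ≡⟨ cong (ℤS.L (ℤC.e i)) eq ⟨
    ℤS.L (ℤC.e i) (dist x y)             ≡⟨ ℤS.sum-over-nbrs′ (ℤC.e i) x y ⟨
    ℤD.∑ (λ z → ℤS.α y z ℤ.* ℤC.e i (dist x z))  ≡⟨ ℤS.ι-nbrs i x y ⟨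
    + nbrs i x y                         ∎
    where
    open ≡-Reasoning
    lemma₁ : ∀ p q r → p ℤ.* + 0 ℤ.+ q ℤ.* + 1 ℤ.+ r ℤ.* + 0 ≡ q
    lemma₁ = ℤRing.solve-∀
    lemma₂ : ∀ p q → p ℤ.* + 0 ℤ.+ q ℤ.* + 1 ≡ q
    lemma₂ = ℤRing.solve-∀
    middle : ∀ i → i ≢ 0F → ℤS.L (ℤC.e i) i ≡ a i
    middle 0F i≢0 = contradiction refl i≢0
    middle 1F _ = lemma₁ (+ c 1F) (a 1F) (+ b 1F)
    middle 2F _ = lemma₁ (+ c 2F) (a 2F) (+ b 2F)
    middle 3F _ = lemma₂ (+ c 3F) (a 3F)

  c₁≡1 : c 1F ≡ 1
  c₁≡1 with x , y , _ , _ , _ , _ , d≡1 , _ ← geodesic = ℤ.+-injective (begin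
    + c 1F                                        ≡⟨ cong +_ (closer 1F (dist⇒at d≡1)) ⟨
    + nbrs 0F x y                                 ≡⟨ ℤS.ι-nbrs 0F x y ⟩
    ℤD.∑ (λ z → ℤS.α y z ℤ.* ℤC.e 0F (dist x z))  ≡⟨ ℤD.∑-cong (λ z → ℤ.*-comm (ℤS.α y z) _) ⟩
    ℤS.τ 0F (ℤS.α y) x                            ≡⟨ ℤS.τ₀ (ℤS.α y) x ⟩
    ℤS.α y x                                      ≡⟨ cong ℤC.[_] (dec-true (adj? y x) (symm (dist≡1⇒adj d≡1))) ⟩
    + 1                                           ∎)
    where open ≡-Reasoning

  b₂≥1 : 1 ℕ.≤ b 2F
  b₂≥1 with x , u , w , y , uw , wy , du , dw , dy ← geodesic =
    subst (1 ℕ.≤_) (further 2F (dist⇒at dw)) (count-some (nbr? 3 x w) (wy , dist⇒at dy))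

  c₂≥1 : 1 ℕ.≤ c 2F
  c₂≥1 with x , u , w , y , uw , wy , du , dw , dy ← geodesic =
    subst (1 ℕ.≤_) (closer 2F (dist⇒at dw)) (count-some (nbr? 1 x w) (symm uw , dist⇒at du))

  a≥0 : ∀ i → i ≢ 0F → ∃[ m ] a i ≡ + m
  a≥0 i i≢0 with geodesic
  a≥0 0F i≢0 | _ = contradiction refl i≢0
  a≥0 1F i≢0 | x , u , w , y , uw , wy , du , dw , dy = _ , a≡nbrs 1F i≢0 du
  a≥0 2F i≢0 | x , u , w , y , uw , wy , du , dw , dy = _ , a≡nbrs 2F i≢0 dw
  a≥0 3F i≢0 | x , u , w , y , uw , wy , du , dw , dy = _ , a≡nbrs 3F i≢0 dy

  b₃≡0 : b 3F ≡ 0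
  b₃≡0 with x , u , w , y , uw , wy , du , dw , dy ← geodesic =
    trans (sym (further 3F (dist⇒at dy))) (count-none (nbr? 4 x y) λ z (_ , at) → ℕ.<⇒≱ (proj₁ diameter at) ℕ.≤-refl)

  module _ (v : Vector ℝ n)
    (eigen : ∀ i → D.∑ (λ j → adjacencyMatrix Γ i j D.* v j) D.≈ fromℤ (a 3F) D.* v i) where
    private
      module S = Spectral ℚ-domain Γ G
      module C = Counting ℚ-domain
    open ℚD
    open Solver

    private
      θ : ℚ
      θ = ι (a 3F)

      φ r : ℕ → Fin n → ℚ
      φ m z = seq (v z) m
      r m z = S.A· (φ m) z - θ * φ m z

      r-null : ∀ z → Null (λ m → r m z)
      r-null z = null-cong (λ m → cong (_- θ * φ m z) (trans (seq-∑ _ m) (∑-cong (entry m)))) (eigen z)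
        where
        entry : ∀ m j → seq (adjacencyMatrix Γ z j D.* v j) m ≡ S.α z j * φ m j
        entry m j with does (adj? z j)
        ... | true  = refl
        ... | false = refl

      τ-null : ∀ i y → Null (λ m → S.τ i (r m) y)
      τ-null i y = null-∑ (λ z m → C.e i (dist y z) * r m z) (λ z → null-* (C.e i (dist y z)) {λ m → r m z} (r-null z))

      -- Without errors, the last recurrence at θ = a₃ reads b₂ τ₂ = 0, while `recurrence₁` gives c₂
      -- τ₂ = (θ² - a₁ θ - k) φ. Multiplying the latter by b₂ yields 0; the right-hand side here
      -- collects the errors.
      defect : ∀ m y → ι (+ b 2F ℤ.* (a 3F ℤ.* a 3F ℤ.- a 1F ℤ.* a 3F ℤ.- + valency)) * φ m y ≡
        ι (+ c 2F) * S.τ 3F (r m) y + ι (ℤ.- + b 2F) * S.τ 1F (r m) y + ι (+ b 2F ℤ.* (a 1F ℤ.- a 3F)) * r m y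
      defect m y = begin
        ι (+ b 2F ℤ.* (a 3F ℤ.* a 3F ℤ.- a 1F ℤ.* a 3F ℤ.- + valency)) * t0
          ≡⟨ cong (_* t0) (trans (ι-* (+ b 2F) (θ′ ℤ.* θ′ ℤ.- a 1F ℤ.* θ′ ℤ.- + valency)) (cong (B *_)
               (trans (ι-+ (θ′ ℤ.* θ′ ℤ.- a 1F ℤ.* θ′) (ℤ.- + valency)) (cong₂ _+_
                 (trans (ι-+ (θ′ ℤ.* θ′) (ℤ.- (a 1F ℤ.* θ′))) (cong₂ _+_ (ι-* θ′ θ′)
                   (trans (ι-neg (a 1F ℤ.* θ′)) (cong -_ (ι-* (a 1F) θ′)))))
                 (ι-neg (+ valency)))))) ⟩
        B * (θ * θ - a1 * θ - k) * t0
          ≡⟨ solve 11 (λ B θ a1 k c2 t0 t1 t2 r0 r1 r3 →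
               B :* (θ :* θ :- a1 :* θ :- k) :* t0 :=
               (c2 :* r3 :+ (:- B) :* r1 :+ B :* (a1 :- θ) :* r0)
               :+ B :* (θ :- a1) :* ((θ :* t0 :+ r0) :- t1)
               :+ (:- B) :* ((k :* t0 :+ a1 :* t1 :+ c2 :* t2) :- (θ :* t1 :+ r1))
               :+ c2 :* (B :* t2 :- r3)) refl
               B θ a1 k C2 t0 t1 t2 r0 r1 r3 ⟩
        R + B * (θ - a1) * ((θ * t0 + r0) - t1) + (- B) * ((k * t0 + a1 * t1 + C2 * t2) - (θ * t1 + r1)) + C2 * (B * t2 - r3)
          ≡⟨ using-eq _ C2 eq₃ ⟩
        R + B * (θ - a1) * ((θ * t0 + r0) - t1) + (- B) * ((k * t0 + a1 * t1 + C2 * t2) - (θ * t1 + r1))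
          ≡⟨ using-eq _ (- B) eq₁ ⟩
        R + B * (θ - a1) * ((θ * t0 + r0) - t1)
          ≡⟨ using-eq _ (B * (θ - a1)) eq₀ ⟩
        R
          ≡⟨ cong₂ (λ p q → C2 * r3 + p * r1 + q * r0) (sym (ι-neg (+ b 2F)))
               (sym (trans (ι-* (+ b 2F) (a 1F ℤ.- θ′)) (cong (B *_) (trans (ι-+ (a 1F) (ℤ.- θ′)) (cong (λ s → a1 + s) (ι-neg θ′)))))) ⟩
        C2 * r3 + ι (ℤ.- + b 2F) * r1 + ι (+ b 2F ℤ.* (a 1F ℤ.- a 3F)) * r0 ∎
        where
        open ≡-Reasoning
        θ′ : ℤ
        θ′ = a 3F
        B C2 a1 k t0 t1 t2 t3 r0 r1 r3 R : ℚ
        B = ι (+ b 2F)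
        C2 = ι (+ c 2F)
        a1 = ι (a 1F)
        k = ι (+ valency)
        t0 = φ m y
        t1 = S.τ 1F (φ m) y
        t2 = S.τ 2F (φ m) y
        t3 = S.τ 3F (φ m) y
        r0 = r m y
        r1 = S.τ 1F (r m) y
        r3 = S.τ 3F (r m) y
        R = C2 * r3 + (- B) * r1 + B * (a1 - θ) * r0
        Aφ : ∀ z → S.A· (φ m) z ≡ θ * φ m z + r m z
        Aφ z = solve 2 (λ p q → p := q :+ (p :- q)) refl (S.A· (φ m) z) (θ * φ m z)
        eq₀ : θ * t0 + r0 ≡ t1
        eq₀ = trans (sym (S.recurrence₀ θ (φ m) (r m) Aφ y)) (trans (cong (λ p → ι (+ p) * t1) c₁≡1) (C.ι1* t1))
        eq₁ : k * t0 + a1 * t1 + C2 * t2 ≡ θ * t1 + r1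
        eq₁ = S.recurrence₁ θ (φ m) (r m) Aφ y
        eq₃ : B * t2 ≡ r3
        eq₃ = begin
          B * t2                    ≡⟨ solve 2 (λ p q → p := (p :+ q) :- q) refl (B * t2) (θ * t3) ⟩
          (B * t2 + θ * t3) - θ * t3 ≡⟨ cong (_- θ * t3) (S.recurrence₃ θ (φ m) (r m) Aφ y) ⟩
          (θ * t3 + r3) - θ * t3    ≡⟨ solve 2 (λ p q → (p :+ q) :- p := q) refl (θ * t3) r3 ⟩
          r3                        ∎

    module _ (v≉0 : ¬ (∀ i → v i D.≈ 0ℝ)) where

      -- The coefficient in `defect` is an integer, so it can be tested for zero. Were it nonzero,
      -- every coordinate of v would be null.
      eigenvalue-relation : + valency ≡ a 3F ℤ.* (a 3F ℤ.- a 1F)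
      eigenvalue-relation with (+ b 2F ℤ.* (a 3F ℤ.* a 3F ℤ.- a 1F ℤ.* a 3F ℤ.- + valency)) ℤ.≟ + 0
      ... | no κ≢0 = contradiction φ-null v≉0
        where
        φ-null : ∀ i → v i D.≈ 0ℝ
        φ-null i = null-cong (λ m → sym (trans (cong (λ z → φ m i ℚ.+ z) refl) (ℚ.+-identityʳ (φ m i))))
          (null-unscale _ (κ≢0 ∘ fromInteger-injective₀ _) (null-cong (λ m → sym (defect m i))
            (null-+ {λ m → ι (+ c 2F) * S.τ 3F (r m) i + ι (ℤ.- + b 2F) * S.τ 1F (r m) i}
              (null-+ {λ m → ι (+ c 2F) * S.τ 3F (r m) i} (null-* (ι (+ c 2F)) (τ-null 3F i)) (null-* (ι (ℤ.- + b 2F)) (τ-null 1F i)))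
              (null-* (ι (+ b 2F ℤ.* (a 1F ℤ.- a 3F))) {λ m → r m i} (r-null i)))))
      ... | yes κ≡0 with ℤ.i*j≡0⇒i≡0∨j≡0 (+ b 2F) κ≡0
      ...   | inj₁ b₂≡0 = contradiction (subst (1 ℕ.≤_) (ℤ.+-injective b₂≡0) b₂≥1) λ ()
      ...   | inj₂ eq = trans (lemma (a 3F) (a 1F) (+ valency)) (trans (cong (λ s → a 3F ℤ.* (a 3F ℤ.- a 1F) ℤ.- s) eq) (ℤ.+-identityʳ _))
        where
        lemma : ∀ p q k → k ≡ p ℤ.* (p ℤ.- q) ℤ.- (p ℤ.* p ℤ.- q ℤ.* p ℤ.- k)
        lemma = ℤRing.solve-∀

-- Eigenmatrices of a graph with array {3 α, 2 α + 2, β; 1, γ, 2 α}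

record HasArray {n} {Γ : Graph n} (G : DistanceRegular Γ 3) (α β γ : ℕ) : Set where
  open DistanceRegular G
  field
    k≡  : + valency ≡ + 3 ℤ.* + α
    b₁≡ : + b 1F ≡ + 2 ℤ.* + α ℤ.+ + 2
    b₂≡ : + b 2F ≡ + β
    c₁≡ : + c 1F ≡ + 1
    c₂≡ : + c 2F ≡ + γ
    c₃≡ : + c 3F ≡ + 2 ℤ.* + α
    a₁≡ : a 1F ≡ + α ℤ.- + 3
    a₂≡ : a 2F ≡ + 3 ℤ.* + α ℤ.- + β ℤ.- + γ
    a₃≡ : a 3F ≡ + α
    α≥1 : 1 ℕ.≤ α
    β≥1 : 1 ℕ.≤ β
    γ≥1 : 1 ℕ.≤ γ

module ArraySpectral (R : Domain) {n} (Γ : Graph n) (G : DistanceRegular Γ 3) {α β γ : ℕ} (H : HasArray G α β γ) where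
  open DomainProperties R
  open Counting R
  open Distance Γ G
  open Spectral R Γ G renaming (α to adjacency)
  open HasArray H
  open Solver

  A B C : Carrier
  A = ι (+ α)
  B = ι (+ β)
  C = ι (+ γ)

  private
    ιk : ι (+ valency) ≡ ι (+ 3) * A
    ιk = trans (cong ι k≡) (ι-* (+ 3) (+ α))
    ιb₁ : ι (+ b 1F) ≡ ι (+ 2) * A + ι (+ 2)
    ιb₁ = trans (cong ι b₁≡) (trans (ι-+ (+ 2 ℤ.* + α) (+ 2)) (cong (_+ ι (+ 2)) (ι-* (+ 2) (+ α))))
    ιc₃ : ι (+ c 3F) ≡ ι (+ 2) * A
    ιc₃ = trans (cong ι c₃≡) (ι-* (+ 2) (+ α))
    ιa₁ : ι (a 1F) ≡ A - ι (+ 3)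
    ιa₁ = trans (cong ι a₁≡) (trans (ι-+ (+ α) (ℤ.- + 3)) (cong (λ s → A + s) (ι-neg (+ 3))))
    ιa₂ : ι (a 2F) ≡ ι (+ 3) * A - B - C
    ιa₂ = trans (cong ι a₂≡) (trans (ι-+ (+ 3 ℤ.* + α ℤ.- + β) (ℤ.- + γ)) (cong₂ _+_
      (trans (ι-+ (+ 3 ℤ.* + α) (ℤ.- + β)) (cong₂ _+_ (ι-* (+ 3) (+ α)) (ι-neg (+ β)))) (ι-neg (+ γ))))

  Λ : (Fin 4 → Carrier) → Fin 4 → Carrier
  Λ f 0F = ι (+ 3) * A * f 1F
  Λ f 1F = f 0F + (A - ι (+ 3)) * f 1F + (ι (+ 2) * A + ι (+ 2)) * f 2F
  Λ f 2F = C * f 1F + (ι (+ 3) * A - B - C) * f 2F + B * f 3F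
  Λ f 3F = ι (+ 2) * A * f 2F + A * f 3F

  L≡Λ : ∀ f i → L f i ≡ Λ f i
  L≡Λ f 0F = cong (_* f 1F) ιk
  L≡Λ f 1F = cong₂ _+_ (cong₂ _+_ (trans (cong (_* f 0F) (cong ι c₁≡)) (ι1* (f 0F))) (cong (_* f 1F) ιa₁)) (cong (_* f 2F) ιb₁)
  L≡Λ f 2F = cong₂ _+_ (cong₂ _+_ (cong (_* f 1F) (cong ι c₂≡)) (cong (_* f 2F) ιa₂)) (cong (_* f 3F) (cong ι b₂≡))
  L≡Λ f 3F = cong₂ _+_ (cong (_* f 2F) ιc₃) (cong (_* f 3F) (cong ι a₃≡))

  sum-over-adjacent : ∀ f x y → ∑ (λ z → adjacency y z * f (dist x z)) ≡ Λ f (dist x y)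
  sum-over-adjacent f x y = trans (sum-over-nbrs′ f x y) (L≡Λ f (dist x y))

  module Eigen (θ : Carrier) (φ : Fin n → Carrier) (Aφ : ∀ z → A· φ z ≡ θ * φ z) (y : Fin n) where
    private
      r : Fin n → Carrier
      r _ = ι (+ 0)
      t0 t1 t2 t3 : Carrier
      t0 = φ y
      t1 = τ 1F φ y
      t2 = τ 2F φ y
      t3 = τ 3F φ y
      +0 : ∀ s → s + ι (+ 0) ≡ s
      +0 s = trans (cong (λ u → s + u) ι-0) (+-identityʳ s)
      Aφ′ : ∀ z → A· φ z ≡ θ * φ z + r z
      Aφ′ z = trans (Aφ z) (sym (+0 _))
      tidy : ∀ i s → s + τ i r y ≡ s
      tidy i s = trans (cong (λ u → s + u) (T-ι0 (e i) y)) (+0 s)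

    eigen₀ : τ 1F φ y ≡ θ * φ y
    eigen₀ = trans (sym (trans (cong (_* t1) (cong ι c₁≡)) (ι1* t1)))
      (trans (recurrence₀ θ φ r Aφ′ y) (+0 _))

    eigen₁ : ι (+ 3) * A * φ y + (A - ι (+ 3)) * τ 1F φ y + C * τ 2F φ y ≡ θ * τ 1F φ y
    eigen₁ = trans (sym (cong₂ _+_ (cong₂ _+_ (cong (_* t0) ιk) (cong (_* t1) ιa₁)) (cong (_* t2) (cong ι c₂≡))))
      (trans (recurrence₁ θ φ r Aφ′ y) (tidy 1F _))

    eigen₂ : (ι (+ 2) * A + ι (+ 2)) * τ 1F φ y + (ι (+ 3) * A - B - C) * τ 2F φ y + ι (+ 2) * A * τ 3F φ y ≡ θ * τ 2F φ y
    eigen₂ = trans (sym (cong₂ _+_ (cong₂ _+_ (cong (_* t1) ιb₁) (cong (_* t2) ιa₂)) (cong (_* t3) ιc₃)))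
      (trans (recurrence₂ θ φ r Aφ′ y) (tidy 2F _))

    eigen₃ : B * τ 2F φ y + A * τ 3F φ y ≡ θ * τ 3F φ y
    eigen₃ = trans (sym (cong₂ _+_ (cong (_* t2) (cong ι b₂≡)) (cong (_* t3) (cong ι a₃≡))))
      (trans (recurrence₃ θ φ r Aφ′ y) (tidy 3F _))

    expand : ∀ g → T g φ y ≡ g 0F * φ y + (g 1F * τ 1F φ y + (g 2F * τ 2F φ y + g 3F * τ 3F φ y))
    expand g = trans (T-expand g φ y) (cong (λ u → g 0F * u + (g 1F * t1 + (g 2F * t2 + g 3F * t3))) (τ₀ φ y))

  Λ-eigen : ∀ {θ f} → (∀ i → Λ f i ≡ θ * f i) → ∀ x z → A· (M f x) z ≡ θ * M f x z
  Λ-eigen {θ} {f} Λf x z = trans (sum-over-adjacent f x z) (Λf (dist x z))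

  -- The eigenvalue - t, for a root t of t² + S t + P = 0.
  module Minimal (t : Carrier) (root : (t - ι (+ 3)) * (A + t) ≡ (B + C) * t - (ι (+ 3) * B + C))
                 (A+t≢0 : A + t ≢ 0#) where

    -- The cosine sequence of - t, which begins 1, - t / (3 A), multiplied by 6 A (A + 1) to clear
    -- denominators. The equation for t enters at distance 2.
    ω : Fin 4 → Carrier
    ω 0F = ι (+ 6) * A * (A + ι (+ 1))
    ω 1F = ι (+ 0) - ι (+ 2) * t * (A + ι (+ 1))
    ω 2F = (t - ι (+ 3)) * (A + t)
    ω 3F = ι (+ 0) - ι (+ 2) * A * (t - ι (+ 3))

    Λω : ∀ i → Λ ω i ≡ (ι (+ 0) - t) * ω i
    Λω 0F = solve 2 (λ A t → con (+ 3) :* A :* (con (+ 0) :- con (+ 2) :* t :* (A :+ con (+ 1))) :=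
      (con (+ 0) :- t) :* (con (+ 6) :* A :* (A :+ con (+ 1)))) refl A t
    Λω 1F = solve 2 (λ A t → con (+ 6) :* A :* (A :+ con (+ 1)) :+ (A :- con (+ 3)) :* (con (+ 0) :- con (+ 2) :* t :* (A :+ con (+ 1))) :+
      (con (+ 2) :* A :+ con (+ 2)) :* ((t :- con (+ 3)) :* (A :+ t)) :=
      (con (+ 0) :- t) :* (con (+ 0) :- con (+ 2) :* t :* (A :+ con (+ 1)))) refl A t
    Λω 2F = trans (solve 4 (λ A B C t →
        C :* (con (+ 0) :- con (+ 2) :* t :* (A :+ con (+ 1))) :+ (con (+ 3) :* A :- B :- C) :* ((t :- con (+ 3)) :* (A :+ t)) :+
        B :* (con (+ 0) :- con (+ 2) :* A :* (t :- con (+ 3))) :=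
        (con (+ 0) :- t) :* ((t :- con (+ 3)) :* (A :+ t)) :+
        (t :+ con (+ 3) :* A) :* ((t :- con (+ 3)) :* (A :+ t) :- ((B :+ C) :* t :- (con (+ 3) :* B :+ C)))) refl A B C t)
      (using-eq _ (t + ι (+ 3) * A) root)
    Λω 3F = solve 2 (λ A t → con (+ 2) :* A :* ((t :- con (+ 3)) :* (A :+ t)) :+ A :* (con (+ 0) :- con (+ 2) :* A :* (t :- con (+ 3))) :=
      (con (+ 0) :- t) :* (con (+ 0) :- con (+ 2) :* A :* (t :- con (+ 3)))) refl A t

    -- This is c₂ Σ kᵢ ωᵢ² / ω₀ for the sphere sizes kᵢ. The factor c₂ clears the denominators of k₂
    -- and k₃.
    N′ : Carrier
    N′ = ι (+ 6) * A * (A + ι (+ 1)) * C + ι (+ 2) * t * t * (A + ι (+ 1)) * C +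
         ((t - ι (+ 3)) * (A + t)) * ((t - ι (+ 3)) * (A + t)) + ι (+ 2) * A * B * ((t - ι (+ 3)) * (t - ι (+ 3)))

    γω : Fin 4 → Carrier
    γω i = C * ω i

    -- As a function of z, `M ω x z` is an eigenvector, so its sums over spheres around y are
    -- multiples of its value at y.
    γω² : ∀ x y → C * ∑ (λ z → M ω y z * M ω x z) ≡ N′ * M ω y x
    γω² x y = begin
      C * ∑ (λ z → M ω y z * M ω x z)
        ≡⟨ cong (C *_) (expand ω) ⟩
      C * (ω 0F * t0 + (ω 1F * t1 + (ω 2F * t2 + ω 3F * t3)))
        ≡⟨ solve 9 (λ C o0 o1 o2 o3 t0 t1 t2 t3 → C :* (o0 :* t0 :+ (o1 :* t1 :+ (o2 :* t2 :+ o3 :* t3))) :=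
             C :* o0 :* t0 :+ C :* o1 :* t1 :+ o2 :* (C :* t2) :+ o3 :* (C :* t3)) refl C (ω 0F) (ω 1F) (ω 2F) (ω 3F) t0 t1 t2 t3 ⟩
      C * ω 0F * t0 + C * ω 1F * t1 + ω 2F * (C * t2) + ω 3F * (C * t3)
        ≡⟨ cong₂ _+_ (cong₂ _+_ (cong (λ u → C * ω 0F * t0 + C * ω 1F * u) eigen₀) (cong (ω 2F *_) γτ₂)) (cong (ω 3F *_) γτ₃) ⟩
      C * ω 0F * t0 + C * ω 1F * ((ι (+ 0) - t) * t0) + ω 2F * (ω 2F * t0) + ω 3F * ((ι (+ 0) - B) * (t - ι (+ 3)) * t0)
        ≡⟨ solve 8 (λ C o0 o1 o2 o3 u w t0 → C :* o0 :* t0 :+ C :* o1 :* (u :* t0) :+ o2 :* (o2 :* t0) :+ o3 :* (w :* t0) :=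
             (C :* o0 :+ C :* o1 :* u :+ o2 :* o2 :+ o3 :* w) :* t0) refl C (ω 0F) (ω 1F) (ω 2F) (ω 3F) (ι (+ 0) - t) ((ι (+ 0) - B) * (t - ι (+ 3))) t0 ⟩
      (C * ω 0F + C * ω 1F * (ι (+ 0) - t) + ω 2F * ω 2F + ω 3F * ((ι (+ 0) - B) * (t - ι (+ 3)))) * t0
        ≡⟨ cong (_* t0) (solve 5 (λ A B C t q →
             C :* (con (+ 6) :* A :* (A :+ con (+ 1))) :+ C :* (con (+ 0) :- con (+ 2) :* t :* (A :+ con (+ 1))) :* (con (+ 0) :- t) :+
             q :* q :+ (con (+ 0) :- con (+ 2) :* A :* (t :- con (+ 3))) :* ((con (+ 0) :- B) :* (t :- con (+ 3))) :=
             con (+ 6) :* A :* (A :+ con (+ 1)) :* C :+ con (+ 2) :* t :* t :* (A :+ con (+ 1)) :* C :+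
               q :* q :+ con (+ 2) :* A :* B :* ((t :- con (+ 3)) :* (t :- con (+ 3)))) refl A B C t (ω 2F)) ⟩
      N′ * t0
        ≡⟨ cong (N′ *_) (M-sym ω x y) ⟩
      N′ * M ω y x ∎
      where
      open ≡-Reasoning
      open Eigen (ι (+ 0) - t) (M ω x) (Λ-eigen Λω x) y
      t0 t1 t2 t3 : Carrier
      t0 = M ω x y
      t1 = τ 1F (M ω x) y
      t2 = τ 2F (M ω x) y
      t3 = τ 3F (M ω x) y
      γτ₂ : C * t2 ≡ ω 2F * t0
      γτ₂ = begin
        C * t2
          ≡⟨ solve 6 (λ A C t t0 t1 t2 → C :* t2 := (t :- con (+ 3)) :* (A :+ t) :* t0 :+
               con (+ 1) :* ((con (+ 3) :* A :* t0 :+ (A :- con (+ 3)) :* t1 :+ C :* t2) :- (con (+ 0) :- t) :* t1) :+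
               (con (+ 3) :- A :- t) :* (t1 :- (con (+ 0) :- t) :* t0)) refl A C t t0 t1 t2 ⟩
        ω 2F * t0 + ι (+ 1) * ((ι (+ 3) * A * t0 + (A - ι (+ 3)) * t1 + C * t2) - (ι (+ 0) - t) * t1) +
          (ι (+ 3) - A - t) * (t1 - (ι (+ 0) - t) * t0)
          ≡⟨ using-eq _ (ι (+ 3) - A - t) eigen₀ ⟩
        ω 2F * t0 + ι (+ 1) * ((ι (+ 3) * A * t0 + (A - ι (+ 3)) * t1 + C * t2) - (ι (+ 0) - t) * t1)
          ≡⟨ using-eq _ (ι (+ 1)) eigen₁ ⟩
        ω 2F * t0 ∎
      -- The last recurrence says (A + t) τ₃ = - B τ₂, and A + t is a factor of ω₂, so it can be
      -- cancelled.
      γτ₃ : C * t3 ≡ (ι (+ 0) - B) * (t - ι (+ 3)) * t0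
      γτ₃ = *-cancelˡ (A + t) A+t≢0 (begin
        (A + t) * (C * t3)
          ≡⟨ solve 6 (λ A B C t t2 t3 → (A :+ t) :* (C :* t3) := (con (+ 0) :- B) :* (C :* t2) :+
               C :* ((B :* t2 :+ A :* t3) :- (con (+ 0) :- t) :* t3)) refl A B C t t2 t3 ⟩
        (ι (+ 0) - B) * (C * t2) + C * ((B * t2 + A * t3) - (ι (+ 0) - t) * t3)
          ≡⟨ using-eq _ C eigen₃ ⟩
        (ι (+ 0) - B) * (C * t2)
          ≡⟨ cong ((ι (+ 0) - B) *_) γτ₂ ⟩
        (ι (+ 0) - B) * (ω 2F * t0)
          ≡⟨ solve 4 (λ B p q t0 → B :* (p :* q :* t0) := q :* (B :* p :* t0)) refl (ι (+ 0) - B) (t - ι (+ 3)) (A + t) t0 ⟩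
        (A + t) * ((ι (+ 0) - B) * (t - ι (+ 3)) * t0) ∎)

    γω-idempotent : ∀ i k → ∑ (λ j → M γω i j * M γω j k) ≡ N′ * M γω i k
    γω-idempotent i k = begin
      ∑ (λ j → M γω i j * M γω j k)
        ≡⟨ ∑-cong (λ j → trans (cong (λ u → M γω i j * u) (M-sym γω j k))
             (solve 3 (λ C x y → (C :* x) :* (C :* y) := C :* (C :* (x :* y))) refl C (M ω i j) (M ω k j))) ⟩
      ∑ (λ j → C * (C * (M ω i j * M ω k j)))   ≡⟨ trans (∑-*ˡ C _) (cong (C *_) (∑-*ˡ C _)) ⟩
      C * (C * ∑ (λ j → M ω i j * M ω k j))     ≡⟨ cong (C *_) (γω² k i) ⟩
      C * (N′ * M ω i k)                        ≡⟨ solve 3 (λ C N x → C :* (N :* x) := N :* (C :* x)) refl C N′ (M ω i k) ⟩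
      N′ * M γω i k                             ∎
      where open ≡-Reasoning

    multiplicity : ∃[ m ] ι (+ n) * (C * ω 0F) ≡ ι (+ m) * N′
    multiplicity = let m , eq = trace-multiple (M γω) N′ γω-idempotent in m , trans (sym (trace-M γω)) eq

    private
      a′ b′ c′ k′ n′ : Expr
      a′ = int (+ α)
      b′ = int (+ β)
      c′ = int (+ γ)
      k′ = int (+ 2) ⊠ (a′ ⊞ int (+ 1)) ⊠ c′ ⊞ (b′ ⊞ c′) ⊠ (b′ ⊞ c′) ⊞ int (+ 2) ⊠ a′ ⊠ b′
      n′ = b′ ⊞ c′ ⊞ ⊟ a′ ⊞ int (+ 3)

    -- `N′` is reduced to x + y t by t² = n′ t - (3 B + C - 3 A), where k′ is its coefficient of t²
    -- once `root` has made ω₂ linear in t. As an `Expr`, each of x and y exists both as an integer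
    -- and as an element of the domain.
    rational-part irrational-part leading : Expr
    rational-part = int (+ 6) ⊠ a′ ⊠ (a′ ⊞ int (+ 1)) ⊠ c′ ⊞ k′ ⊠ (int (+ 3) ⊠ a′ ⊞ ⊟ (int (+ 3) ⊠ b′ ⊞ c′)) ⊞
      (int (+ 3) ⊠ b′ ⊞ c′) ⊠ (int (+ 3) ⊠ b′ ⊞ c′) ⊞ int (+ 18) ⊠ a′ ⊠ b′
    irrational-part = n′ ⊠ k′ ⊞ ⊟ (int (+ 2) ⊠ (b′ ⊞ c′) ⊠ (int (+ 3) ⊠ b′ ⊞ c′) ⊞ int (+ 12) ⊠ a′ ⊠ b′)
    leading = int (+ n) ⊠ (c′ ⊠ (int (+ 6) ⊠ a′ ⊠ (a′ ⊞ int (+ 1))))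

    N′≡ : N′ ≡ eval rational-part + eval irrational-part * t
    N′≡ = begin
      N′
        ≡⟨ cong (λ q → ι (+ 6) * A * (A + ι (+ 1)) * C + ι (+ 2) * t * t * (A + ι (+ 1)) * C + q * q +
             ι (+ 2) * A * B * ((t - ι (+ 3)) * (t - ι (+ 3)))) root ⟩
      ι (+ 6) * A * (A + ι (+ 1)) * C + ι (+ 2) * t * t * (A + ι (+ 1)) * C + Q * Q + ι (+ 2) * A * B * ((t - ι (+ 3)) * (t - ι (+ 3)))
        ≡⟨ solve 4 (λ A B C t →
             let q = (B :+ C) :* t :- (con (+ 3) :* B :+ C)
                 k = con (+ 2) :* (A :+ con (+ 1)) :* C :+ (B :+ C) :* (B :+ C) :+ con (+ 2) :* A :* B in
             con (+ 6) :* A :* (A :+ con (+ 1)) :* C :+ con (+ 2) :* t :* t :* (A :+ con (+ 1)) :* C :+ q :* q :+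
               con (+ 2) :* A :* B :* ((t :- con (+ 3)) :* (t :- con (+ 3))) :=
             (con (+ 6) :* A :* (A :+ con (+ 1)) :* C :+ k :* (con (+ 3) :* A :+ :- (con (+ 3) :* B :+ C)) :+
               (con (+ 3) :* B :+ C) :* (con (+ 3) :* B :+ C) :+ con (+ 18) :* A :* B) :+
             ((B :+ C :+ :- A :+ con (+ 3)) :* k :+ :- (con (+ 2) :* (B :+ C) :* (con (+ 3) :* B :+ C) :+ con (+ 12) :* A :* B)) :* t :+
             k :* ((t :- con (+ 3)) :* (A :+ t) :- q)) refl A B C t ⟩
      (eval rational-part + eval irrational-part * t) + eval k′ * ((t - ι (+ 3)) * (A + t) - Q)
        ≡⟨ using-eq _ (eval k′) root ⟩
      eval rational-part + eval irrational-part * t ∎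
      where
      open ≡-Reasoning
      Q : Carrier
      Q = (B + C) * t - (ι (+ 3) * B + C)

    linear-multiplicity : ∃[ m ] ι (evalℤ leading) ≡ ι (+ m) * (ι (evalℤ rational-part) + ι (evalℤ irrational-part) * t)
    linear-multiplicity = let m , eq = multiplicity in m , trans (ι-eval leading) (trans eq (cong (ι (+ m) *_)
      (trans N′≡ (cong₂ (λ p q → p + q * t) (sym (ι-eval rational-part)) (sym (ι-eval irrational-part))))))

-- Positive semidefinite forms and the Krein conditions

open import Data.Integer.Base using (_+_; _*_; _-_; _≤_; _<_)

module ℤD = DomainProperties ℤ-domain
open ℤD using (∑; ∑-cong; ∑-+; ∑-*ˡ; ∑-*ʳ; ∑-swap; ∑-0; ∑-suc; ∑-empty; using-eq)

nonNeg⇒natural : ∀ {i} → 0ℤ ≤ i → ∃[ m ] i ≡ + m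
nonNeg⇒natural (ℤ.+≤+ _) = _ , refl

*-pos : ∀ {i j} → 0ℤ < i → 0ℤ < j → 0ℤ < i * j
*-pos {i} {j} i>0 j>0 = subst (_< i * j) (ℤ.*-zeroʳ i) (ℤ.*-monoˡ-<-pos i {{ℤ.positive i>0}} j>0)

*-nonNeg : ∀ {i j} → 0ℤ ≤ i → 0ℤ ≤ j → 0ℤ ≤ i * j
*-nonNeg {i} {j} i≥0 j≥0 = subst (_≤ i * j) (ℤ.*-zeroʳ i) (ℤ.*-monoˡ-≤-nonNeg i {{ℤ.nonNegative i≥0}} j≥0)

square-nonNeg : ∀ x → 0ℤ ≤ x * x
square-nonNeg (+ n)      = subst (0ℤ ≤_) (ℤ.pos-* n n) (ℤ.+≤+ z≤n)
square-nonNeg ℤ.-[1+ n ] = ℤ.+≤+ z≤n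

*-cancelˡ-pos : ∀ {i j k} → 0ℤ < i → i * j ≡ i * k → j ≡ k
*-cancelˡ-pos {i} {j} {k} i>0 = ℤ.*-cancelˡ-≡ i j k {{ℤ.>-nonZero i>0}}

∑-nonNeg : ∀ {n} {f : Fin n → ℤ} → (∀ i → 0ℤ ≤ f i) → 0ℤ ≤ ∑ f
∑-nonNeg {zero}  f≥0 = ℤ.≤-reflexive (sym (∑-empty _))
∑-nonNeg {suc n} f≥0 = subst (0ℤ ≤_) (sym (∑-suc _)) (ℤ.+-mono-≤ (f≥0 zero) (∑-nonNeg (f≥0 ∘ suc)))

∑-mono : ∀ {n} {f g : Fin n → ℤ} → (∀ i → f i ≤ g i) → ∑ f ≤ ∑ g
∑-mono {zero}  f≤g = ℤ.≤-reflexive (trans (∑-empty _) (sym (∑-empty _)))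
∑-mono {suc n} f≤g = subst₂ _≤_ (sym (∑-suc _)) (sym (∑-suc _)) (ℤ.+-mono-≤ (f≤g zero) (∑-mono (f≤g ∘ suc)))

∑-nonNeg≡0 : ∀ {n} {f : Fin n → ℤ} → (∀ i → 0ℤ ≤ f i) → ∑ f ≡ 0ℤ → ∀ i → f i ≡ 0ℤ
∑-nonNeg≡0 {suc n} {f} f≥0 ∑≡0 = λ { zero → head≡0 ; (suc i) → ∑-nonNeg≡0 (f≥0 ∘ suc) tail≡0 i }
  where
  total : f zero + ∑ (f ∘ suc) ≡ 0ℤ
  total = trans (sym (∑-suc _)) ∑≡0
  tail≥0 : 0ℤ ≤ ∑ (f ∘ suc)
  tail≥0 = ∑-nonNeg (f≥0 ∘ suc)
  head≡0 : f zero ≡ 0ℤ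
  head≡0 = ℤ.≤-antisym (subst₂ _≤_ (ℤ.+-identityʳ _) total (ℤ.+-monoʳ-≤ (f zero) tail≥0)) (f≥0 zero)
  tail≡0 : ∑ (f ∘ suc) ≡ 0ℤ
  tail≡0 = ℤ.≤-antisym (subst₂ _≤_ (ℤ.+-identityˡ _) total (ℤ.+-monoˡ-≤ (∑ (f ∘ suc)) (f≥0 zero))) tail≥0

-- The Krein condition: a positive semidefinite kernel stays so when multiplied
-- entrywise by a symmetric matrix U with U² = N U, since N U is a Gram matrix.
module _ {n : ℕ} where
  Kernel : Set
  Kernel = Fin n → Fin n → ℤ

  form : (Fin n → ℤ) → Kernel → ℤ
  form g K = ∑ (λ x → ∑ (λ y → g x * g y * K x y))

  -- Records rather than functions, so that their indices can be inferred.
  record PSD (K : Kernel) : Set where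
    constructor psd
    field form≥0 : ∀ g → 0ℤ ≤ form g K
  open PSD

  record GramOf (U : Kernel) (N : ℤ) : Set where
    constructor gram
    field product : ∀ x y → ∑ (λ p → U x p * U y p) ≡ N * U x y
  open GramOf public

  form-1 : ∀ g → form g (λ _ _ → + 1) ≡ ∑ g * ∑ g
  form-1 g = trans (∑-cong (λ x → trans (∑-cong (λ y → ℤ.*-identityʳ (g x * g y))) (∑-*ˡ (g x) g))) (∑-*ʳ (∑ g) g)

  PSD-1 : PSD (λ _ _ → + 1)
  PSD-1 = psd λ g → subst (0ℤ ≤_) (sym (form-1 g)) (square-nonNeg (∑ g))

  -- Replacing N U x y by the sum of U x p U y p over p, and exchanging sums, turns the form of an
  -- entrywise product into a sum of forms of K.
  form-gram : ∀ {U N} → GramOf U N → ∀ g K →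
    N * form g (λ x y → U x y * K x y) ≡ ∑ (λ p → form (λ x → g x * U x p) K)
  form-gram {U} {N} gu g K = begin
    N * form g (λ x y → U x y * K x y)
      ≡⟨ trans (sym (∑-*ˡ N _)) (∑-cong (λ x → trans (sym (∑-*ˡ N _)) (∑-cong (λ y →
           trans (lemma₁ N (g x) (g y) (U x y) (K x y)) (trans (cong (g x * g y * K x y *_) (sym (product gu x y)))
             (trans (sym (∑-*ˡ (g x * g y * K x y) (λ p → U x p * U y p))) (∑-cong (λ p → lemma₂ (g x) (g y) (K x y) (U x p) (U y p))))))))) ⟩
    ∑ (λ x → ∑ (λ y → ∑ (λ p → (g x * U x p) * (g y * U y p) * K x y)))
      ≡⟨ ∑-cong (λ x → ∑-swap _) ⟩
    ∑ (λ x → ∑ (λ p → ∑ (λ y → (g x * U x p) * (g y * U y p) * K x y)))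
      ≡⟨ ∑-swap _ ⟩
    ∑ (λ p → form (λ x → g x * U x p) K) ∎
    where
    open ≡-Reasoning
    lemma₁ : ∀ N g h u k → N * (g * h * (u * k)) ≡ g * h * k * (N * u)
    lemma₁ = ℤRing.solve-∀
    lemma₂ : ∀ g h k u w → g * h * k * (u * w) ≡ (g * u) * (h * w) * k
    lemma₂ = ℤRing.solve-∀

  PSD-gram : ∀ {U N K} → 0ℤ < N → GramOf U N → PSD K → PSD (λ x y → U x y * K x y)
  PSD-gram {U} {N} {K} N>0 gu pk = psd λ g → ℤ.*-cancelˡ-≤-pos 0ℤ _ N {{ℤ.positive N>0}}
    (subst₂ _≤_ (sym (ℤ.*-zeroʳ N)) (sym (form-gram gu g K)) (∑-nonNeg (λ p → form≥0 pk (λ x → g x * U x p))))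

  form-gram≡0 : ∀ {U N K} → GramOf U N → PSD K → ∀ g → form g (λ x y → U x y * K x y) ≡ 0ℤ →
    ∀ p → form (λ x → g x * U x p) K ≡ 0ℤ
  form-gram≡0 {U} {N} {K} gu pk g eq = ∑-nonNeg≡0 (λ p → form≥0 pk (λ x → g x * U x p))
    (trans (sym (form-gram gu g K)) (trans (cong (N *_) eq) (ℤ.*-zeroʳ N)))

  krein : ∀ {U V W N₁ N₂ N₃} → 0ℤ < N₁ → 0ℤ < N₂ → 0ℤ < N₃ → GramOf U N₁ → GramOf V N₂ → GramOf W N₃ →
    0ℤ ≤ ∑ (λ x → ∑ (λ y → U x y * (V x y * W x y)))
  krein {U} {V} {W} N₁>0 N₂>0 N₃>0 gu gv gw = subst (0ℤ ≤_)
    (∑-cong (λ x → ∑-cong (λ y → lemma (U x y) (V x y) (W x y))))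
    (form≥0 (PSD-gram N₁>0 gu (PSD-gram N₂>0 gv (PSD-gram N₃>0 gw PSD-1))) (λ _ → + 1))
    where
    lemma : ∀ u v w → + 1 * + 1 * (u * (v * (w * + 1))) ≡ u * (v * w)
    lemma = ℤRing.solve-∀

  -- When the total vanishes, so does every term of the three nested sums of nonnegative forms. The
  -- innermost terms are the squares of these triple sums.
  krein≡0 : ∀ {U V W N₁ N₂ N₃} → 0ℤ < N₁ → 0ℤ < N₂ → 0ℤ < N₃ → GramOf U N₁ → GramOf V N₂ → GramOf W N₃ →
    ∑ (λ x → ∑ (λ y → U x y * (V x y * W x y))) ≡ 0ℤ → ∀ p q r → ∑ (λ x → U x p * (V x q * W x r)) ≡ 0ℤ
  krein≡0 {U} {V} {W} N₁>0 N₂>0 N₃>0 gu gv gw eq p q r = trans (∑-cong (λ x → sym (lemma₂ (U x p) (V x q) (W x r))))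
    (square≡0 _ (trans (sym (form-1 (λ x → + 1 * U x p * V x q * W x r)))
      (form-gram≡0 gw PSD-1 (λ x → + 1 * U x p * V x q) (form-gram≡0 gv (PSD-gram N₃>0 gw PSD-1) (λ x → + 1 * U x p)
        (form-gram≡0 gu (PSD-gram N₂>0 gv (PSD-gram N₃>0 gw PSD-1)) (λ _ → + 1)
          (trans (∑-cong (λ x → ∑-cong (λ y → lemma (U x y) (V x y) (W x y)))) eq) p) q) r)))
    where
    lemma : ∀ u v w → + 1 * + 1 * (u * (v * (w * + 1))) ≡ u * (v * w)
    lemma = ℤRing.solve-∀
    lemma₂ : ∀ u v w → + 1 * u * v * w ≡ u * (v * w)
    lemma₂ = ℤRing.solve-∀
    square≡0 : ∀ x → x * x ≡ 0ℤ → x ≡ 0ℤ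
    square≡0 x eq with ℤ.i*j≡0⇒i≡0∨j≡0 x eq
    ... | inj₁ x≡0 = x≡0
    ... | inj₂ x≡0 = x≡0

-- Sphere sizes and the eigenmatrix of a₃

module ArrayInteger {n} (Γ : Graph n) (G : DistanceRegular Γ 3) {α β γ : ℕ} (H : HasArray G α β γ) where
  open Distance Γ G using (dist)
  open HasArray H
  open ArraySpectral ℤ-domain Γ G H public
  open Spectral ℤ-domain Γ G public using (T; A·; τ; M; M-sym; ∑-const; trace-M) renaming (α to adjacency)

  private
    pos : ∀ {m} → 1 ℕ.≤ m → 0ℤ < + m
    pos m≥1 = ℤ.+<+ m≥1

  A>0 : 0ℤ < A
  A>0 = pos α≥1
  B>0 : 0ℤ < B
  B>0 = pos β≥1
  C>0 : 0ℤ < C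
  C>0 = pos γ≥1

  pos⇒≢0 : ∀ {i} → 0ℤ < i → i ≢ 0ℤ
  pos⇒≢0 i>0 i≡0 = ℤ.<-irrefl (sym i≡0) i>0

  module Sizes where
    -- An eigenvector for k = 3 A, so its sums over spheres, which are the sphere sizes kᵢ, come out
    -- of the recurrences.
    one : Fin n → ℤ
    one _ = + 1

    A·one : ∀ z → A· one z ≡ (+ 3 * A) * one z
    A·one z = trans (sum-over-adjacent (λ _ → + 1) z z) (Λone (dist z z))
      where
      l1 : ∀ A → + 1 + (A - + 3) * + 1 + (+ 2 * A + + 2) * + 1 ≡ (+ 3 * A) * + 1
      l1 = ℤRing.solve-∀
      l2 : ∀ A B C → C * + 1 + (+ 3 * A - B - C) * + 1 + B * + 1 ≡ (+ 3 * A) * + 1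
      l2 = ℤRing.solve-∀
      l3 : ∀ A → + 2 * A * + 1 + A * + 1 ≡ (+ 3 * A) * + 1
      l3 = ℤRing.solve-∀
      Λone : ∀ i → Λ (λ _ → + 1) i ≡ (+ 3 * A) * + 1
      Λone 0F = refl
      Λone 1F = l1 A
      Λone 2F = l2 A B C
      Λone 3F = l3 A

    module _ (y : Fin n) where
      open Eigen (+ 3 * A) one A·one y

      k₁ : τ 1F one y ≡ + 3 * A
      k₁ = trans eigen₀ (ℤ.*-identityʳ _)

      γk₂ : C * τ 2F one y ≡ + 6 * A * (A + + 1)
      γk₂ = begin
        C * k2                                                    ≡⟨ lemma A C (+ 3 * A) k2 ⟩
        (+ 3 * A * + 1 + (A - + 3) * (+ 3 * A) + C * k2) + (+ 3 * (+ 3 * A) - + 3 * A - A * (+ 3 * A))  ≡⟨ cong (_+ (+ 3 * (+ 3 * A) - + 3 * A - A * (+ 3 * A))) (subst (λ k → + 3 * A * + 1 + (A - + 3) * k + C * k2 ≡ (+ 3 * A) * k) k₁ eigen₁) ⟩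
        (+ 3 * A) * (+ 3 * A) + (+ 3 * (+ 3 * A) - + 3 * A - A * (+ 3 * A))  ≡⟨ lemma′ A ⟩
        + 6 * A * (A + + 1) ∎
        where
        open ≡-Reasoning
        k2 : ℤ
        k2 = τ 2F one y
        lemma : ∀ A C k k2 → C * k2 ≡ (+ 3 * A * + 1 + (A - + 3) * k + C * k2) + (+ 3 * k - + 3 * A - A * k)
        lemma = ℤRing.solve-∀
        lemma′ : ∀ A → (+ 3 * A) * (+ 3 * A) + (+ 3 * (+ 3 * A) - + 3 * A - A * (+ 3 * A)) ≡ + 6 * A * (A + + 1)
        lemma′ = ℤRing.solve-∀

      γk₃ : C * τ 3F one y ≡ + 3 * (A + + 1) * B
      γk₃ = *-cancelˡ-pos A>0 (ℤ.*-cancelˡ-≡ (+ 2) _ _ (begin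
        + 2 * (A * (C * k3))       ≡⟨ lemma A B C k2 k3 ⟩
        C * ((+ 3 * A) * k3 - A * k3) ≡⟨ cong (λ s → C * (s - A * k3)) (sym eigen₃) ⟩
        C * ((B * k2 + A * k3) - A * k3) ≡⟨ lemma₂ A B C k2 k3 ⟩
        B * (C * k2)               ≡⟨ cong (B *_) γk₂ ⟩
        B * (+ 6 * A * (A + + 1))  ≡⟨ lemma₃ A B ⟩
        + 2 * (A * (+ 3 * (A + + 1) * B)) ∎))
        where
        open ≡-Reasoning
        k2 k3 : ℤ
        k2 = τ 2F one y
        k3 = τ 3F one y
        lemma : ∀ A B C k2 k3 → + 2 * (A * (C * k3)) ≡ C * ((+ 3 * A) * k3 - A * k3)
        lemma = ℤRing.solve-∀
        lemma₂ : ∀ A B C k2 k3 → C * ((B * k2 + A * k3) - A * k3) ≡ B * (C * k2)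
        lemma₂ = ℤRing.solve-∀
        lemma₃ : ∀ A B → B * (+ 6 * A * (A + + 1)) ≡ + 2 * (A * (+ 3 * (A + + 1) * B))
        lemma₃ = ℤRing.solve-∀

      γ-weighted-size : ∀ f → C * ∑ (λ z → f (dist y z)) ≡
        C * f 0F + + 3 * A * C * f 1F + + 6 * A * (A + + 1) * f 2F + + 3 * (A + + 1) * B * f 3F
      γ-weighted-size f = begin
        C * ∑ (λ z → f (dist y z))   ≡⟨ cong (C *_) (∑-cong (λ z → sym (ℤ.*-identityʳ _))) ⟩
        C * T f one y                ≡⟨ cong (C *_) (expand f) ⟩
        C * (f 0F * + 1 + (f 1F * τ 1F one y + (f 2F * τ 2F one y + f 3F * τ 3F one y)))
          ≡⟨ lemma C (f 0F) (f 1F) (f 2F) (f 3F) (τ 1F one y) (τ 2F one y) (τ 3F one y) ⟩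
        C * f 0F + τ 1F one y * C * f 1F + (C * τ 2F one y) * f 2F + (C * τ 3F one y) * f 3F
          ≡⟨ cong₂ _+_ (cong₂ _+_ (cong (λ k → C * f 0F + k * C * f 1F) k₁) (cong (_* f 2F) γk₂)) (cong (_* f 3F) γk₃) ⟩
        _ ∎
        where
        open ≡-Reasoning
        lemma : ∀ C f0 f1 f2 f3 t1 t2 t3 → C * (f0 * + 1 + (f1 * t1 + (f2 * t2 + f3 * t3))) ≡
          C * f0 + t1 * C * f1 + (C * t2) * f2 + (C * t3) * f3
        lemma = ℤRing.solve-∀

    γ-total : ∀ f → C * ∑ (λ x → ∑ (λ y → f (dist x y))) ≡
      + n * (C * f 0F + + 3 * A * C * f 1F + + 6 * A * (A + + 1) * f 2F + + 3 * (A + + 1) * B * f 3F)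
    γ-total f = trans (sym (∑-*ˡ C _)) (trans (∑-cong (λ x → γ-weighted-size x f)) (∑-const _))

    γ-order : Fin n → C * + n ≡ C + + 3 * A * C + + 6 * A * (A + + 1) + + 3 * (A + + 1) * B
    γ-order y = begin
      C * + n                 ≡⟨ cong (C *_) (trans (∑-const (+ 1)) (ℤ.*-identityʳ _)) ⟨
      C * ∑ {n} (λ z → + 1)   ≡⟨ γ-weighted-size y (λ _ → + 1) ⟩
      _                       ≡⟨ lemma A B C ⟩
      _                       ∎
      where
      open ≡-Reasoning
      lemma : ∀ A B C → C * + 1 + + 3 * A * C * + 1 + + 6 * A * (A + + 1) * + 1 + + 3 * (A + + 1) * B * + 1 ≡
        C + + 3 * A * C + + 6 * A * (A + + 1) + + 3 * (A + + 1) * B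
      lemma = ℤRing.solve-∀

  -- The cosine sequence of the eigenvalue a₃, times 3 b₂.
  η : Fin 4 → ℤ
  η 0F = + 3 * B
  η 1F = B
  η 2F = + 0
  η 3F = ℤ.- C

  Λη : ∀ i → Λ η i ≡ A * η i
  Λη 0F = lemma A B
    where
    lemma : ∀ A B → + 3 * A * B ≡ A * (+ 3 * B)
    lemma = ℤRing.solve-∀
  Λη 1F = lemma A B
    where
    lemma : ∀ A B → + 3 * B + (A - + 3) * B + (+ 2 * A + + 2) * + 0 ≡ A * B
    lemma = ℤRing.solve-∀
  Λη 2F = lemma A B C
    where
    lemma : ∀ A B C → C * B + (+ 3 * A - B - C) * + 0 + B * (ℤ.- C) ≡ A * + 0
    lemma = ℤRing.solve-∀
  Λη 3F = lemma A C
    where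
    lemma : ∀ A C → + 2 * A * + 0 + A * (ℤ.- C) ≡ A * (ℤ.- C)
    lemma = ℤRing.solve-∀

  -- This is Σ kᵢ ηᵢ² / η₀, already integral: η₂ = 0, and η₃ = - c₂ cancels the denominator c₂ of
  -- k₃.
  N : ℤ
  N = (A + + 3) * B + C * (A + + 1)

  N>0 : 0ℤ < N
  N>0 = ℤ.+-mono-<-≤ (subst (0ℤ <_) (ℤ.pos-* (α ℕ.+ 3) β) (ℤ.+<+ (ℕ.*-mono-≤ {1} {α ℕ.+ 3} (ℕ.≤-trans α≥1 (ℕ.m≤m+n α 3)) β≥1)))
    (subst (0ℤ ≤_) (ℤ.pos-* γ (α ℕ.+ 1)) (ℤ.+≤+ z≤n))

  η² : ∀ x y → ∑ (λ z → M η x z * M η y z) ≡ N * M η x y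
  η² x y = begin
    ∑ (λ z → M η x z * M η y z)   ≡⟨ ∑-cong (λ z → refl) ⟩
    T η (M η y) x                 ≡⟨ expand η ⟩
    + 3 * B * t0 + (B * t1 + (+ 0 * t2 + (ℤ.- C) * t3))
      ≡⟨ lemma B C t0 t1 t2 t3 ⟩
    + 3 * B * t0 + B * t1 - C * t3
      ≡⟨ cong₂ (λ p q → + 3 * B * t0 + B * p - C * q) eigen₀ t3≡ ⟩
    + 3 * B * t0 + B * (A * t0) - C * (ℤ.- (A + + 1) * t0)
      ≡⟨ lemma′ A B C t0 ⟩
    N * t0                        ≡⟨ cong (N *_) (M-sym η y x) ⟩
    N * M η x y                   ∎
    where
    open ≡-Reasoning
    open Eigen A (M η y) (Λ-eigen {A} {η} Λη y) x
    t0 t1 t2 t3 : ℤ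
    t0 = M η y x
    t1 = τ 1F (M η y) x
    t2 = τ 2F (M η y) x
    t3 = τ 3F (M η y) x
    lemma : ∀ B C t0 t1 t2 t3 → + 3 * B * t0 + (B * t1 + (+ 0 * t2 + (ℤ.- C) * t3)) ≡ + 3 * B * t0 + B * t1 - C * t3
    lemma = ℤRing.solve-∀
    lemma′ : ∀ A B C t0 → + 3 * B * t0 + B * (A * t0) - C * (ℤ.- (A + + 1) * t0) ≡ ((A + + 3) * B + C * (A + + 1)) * t0
    lemma′ = ℤRing.solve-∀
    t2≡0 : t2 ≡ + 0
    t2≡0 = *-cancelˡ-pos C>0 (begin
      C * t2                                            ≡⟨ l A C t0 t2 ⟩
      (+ 3 * A * t0 + (A - + 3) * (A * t0) + C * t2) - A * (A * t0)
        ≡⟨ cong (_- A * (A * t0)) (subst (λ s → + 3 * A * t0 + (A - + 3) * s + C * t2 ≡ A * s) eigen₀ eigen₁) ⟩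
      A * (A * t0) - A * (A * t0)                       ≡⟨ ℤ.+-inverseʳ (A * (A * t0)) ⟩
      + 0                                               ≡⟨ ℤ.*-zeroʳ C ⟨
      C * + 0                                           ∎)
      where
      l : ∀ A C t0 t2 → C * t2 ≡ (+ 3 * A * t0 + (A - + 3) * (A * t0) + C * t2) - A * (A * t0)
      l = ℤRing.solve-∀
    t3≡ : t3 ≡ ℤ.- (A + + 1) * t0
    t3≡ = *-cancelˡ-pos A>0 (ℤ.*-cancelˡ-≡ (+ 2) _ _ (begin
      + 2 * (A * t3)  ≡⟨ l A B C t0 t3 ⟩
      ((+ 2 * A + + 2) * (A * t0) + (+ 3 * A - B - C) * + 0 + + 2 * A * t3) - (+ 2 * A + + 2) * (A * t0)
        ≡⟨ cong (_- (+ 2 * A + + 2) * (A * t0)) (subst₂ (λ s u → (+ 2 * A + + 2) * s + (+ 3 * A - B - C) * u + + 2 * A * t3 ≡ A * u) eigen₀ t2≡0 eigen₂) ⟩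
      A * + 0 - (+ 2 * A + + 2) * (A * t0) ≡⟨ l′ A t0 ⟩
      + 2 * (A * (ℤ.- (A + + 1) * t0)) ∎))
      where
      l : ∀ A B C t0 t3 → + 2 * (A * t3) ≡ ((+ 2 * A + + 2) * (A * t0) + (+ 3 * A - B - C) * + 0 + + 2 * A * t3) - (+ 2 * A + + 2) * (A * t0)
      l = ℤRing.solve-∀
      l′ : ∀ A t0 → A * + 0 - (+ 2 * A + + 2) * (A * t0) ≡ + 2 * (A * (ℤ.- (A + + 1) * t0))
      l′ = ℤRing.solve-∀

  η-gram : GramOf (M η) N
  η-gram = gram η²

  η-multiplicity : ∃[ m ] + n * (+ 3 * B) ≡ + m * N
  η-multiplicity = let m , eq = ℤD.trace-multiple (M η) N (λ i k → trans (∑-cong (λ j → cong (M η i j *_) (M-sym η j k))) (η² i k))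
                   in m , trans (sym (trace-M η)) eq

-- Krein inequalities and divisibility conditions on the array

∑∑-even : ∀ {n} (s : Fin n → Fin n → ℤ) → (∀ i j → s i j ≡ s j i) → (∀ i → s i i ≡ 0ℤ) →
  ∃[ q ] ∑ (λ i → ∑ (λ j → s i j)) ≡ + 2 * q
∑∑-even {zero}  s s-sym s-irrefl = 0ℤ , ∑-empty _
∑∑-even {suc n} s s-sym s-irrefl with q , eq ← ∑∑-even (λ i j → s (suc i) (suc j)) (λ i j → s-sym _ _) (λ i → s-irrefl _) =
  r + q , (begin
    ∑ (λ i → ∑ (λ j → s i j))
      ≡⟨ trans (∑-suc _) (cong₂ _+_ (∑-suc _) (trans (∑-cong (λ i → ∑-suc _)) (∑-+ _ _))) ⟩
    (s zero zero + r) + (∑ (λ i → s (suc i) zero) + ∑ (λ i → ∑ (λ j → s (suc i) (suc j))))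
      ≡⟨ cong₂ (λ p t → (p + r) + t) (s-irrefl zero) (cong₂ _+_ (∑-cong (λ i → s-sym (suc i) zero)) eq) ⟩
    (0ℤ + r) + (r + + 2 * q)   ≡⟨ lemma r q ⟩
    + 2 * (r + q)              ∎)
  where
  open ≡-Reasoning
  r : ℤ
  r = ∑ (λ j → s zero (suc j))
  lemma : ∀ r q → (0ℤ + r) + (r + + 2 * q) ≡ + 2 * (r + q)
  lemma = ℤRing.solve-∀

module ArrayConditions {n} (Γ : Graph n) (G : DistanceRegular Γ 3) {α β γ : ℕ} (H : HasArray G α β γ) where
  open Distance Γ G
  open Parameters Γ G using (geodesic)
  open ArrayInteger Γ G H
  open Counting ℤ-domain using (e; [_])
  open Sizes

  n>0 : 0ℤ < + n
  n>0 = inhabited (proj₁ geodesic)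
    where
    inhabited : ∀ {m} → Fin m → 0ℤ < + m
    inhabited {suc _} _ = ℤ.+<+ (s≤s z≤n)

  private
    vertex : Fin n
    vertex = proj₁ geodesic

  total-nonNeg : ∀ f → 0ℤ ≤ ∑ (λ x → ∑ (λ y → f (dist x y))) →
    0ℤ ≤ C * f 0F + + 3 * A * C * f 1F + + 6 * A * (A + + 1) * f 2F + + 3 * (A + + 1) * B * f 3F
  total-nonNeg f ≥0 = ℤ.*-cancelˡ-≤-pos 0ℤ _ (+ n) {{ℤ.positive n>0}}
    (subst₂ _≤_ (trans (ℤ.*-zeroʳ C) (sym (ℤ.*-zeroʳ (+ n)))) (γ-total f) (ℤ.*-monoˡ-≤-nonNeg C {{ℤ.nonNegative (ℤ.<⇒≤ C>0)}} ≥0))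

  total≡0 : ∀ f → C * f 0F + + 3 * A * C * f 1F + + 6 * A * (A + + 1) * f 2F + + 3 * (A + + 1) * B * f 3F ≡ 0ℤ →
    ∑ (λ x → ∑ (λ y → f (dist x y))) ≡ 0ℤ
  total≡0 f eq = *-cancelˡ-pos C>0
    (trans (γ-total f) (trans (cong (+ n *_) eq) (trans (ℤ.*-zeroʳ (+ n)) (sym (ℤ.*-zeroʳ C)))))

  A+1>0 : 0ℤ < A + + 1
  A+1>0 = ℤ.+-mono-<-≤ A>0 (ℤ.+≤+ z≤n)

  private
    factor : ∀ {i j} → 0ℤ < i → 0ℤ ≤ i * j → 0ℤ ≤ j
    factor {i} {j} i>0 ij≥0 = ℤ.*-cancelˡ-≤-pos 0ℤ j i {{ℤ.positive i>0}} (subst (_≤ i * j) (sym (ℤ.*-zeroʳ i)) ij≥0)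

  -- The condition q₁₁¹ ≥ 0: the entrywise cube of the matrix of η has a nonnegative sum. Distance 2
  -- contributes nothing, as η₂ = 0, and the positive factor 3 B C divides out.
  krein₁₁₁ : (A + + 1) * (C * C) ≤ (A + + 9) * (B * B)
  krein₁₁₁ = ℤ.0≤i-j⇒j≤i (factor (*-pos (*-pos {+ 3} (ℤ.+<+ (s≤s z≤n)) B>0) C>0) (subst (0ℤ ≤_) (lemma A B C)
    (total-nonNeg (λ i → η i * (η i * η i)) (krein N>0 N>0 N>0 η-gram η-gram η-gram))))
    where
    lemma : ∀ A B C → C * ((+ 3 * B) * ((+ 3 * B) * (+ 3 * B))) + + 3 * A * C * (B * (B * B)) + + 6 * A * (A + + 1) * (+ 0 * (+ 0 * + 0)) +
      + 3 * (A + + 1) * B * ((ℤ.- C) * ((ℤ.- C) * (ℤ.- C))) ≡ + 3 * B * C * ((A + + 9) * (B * B) - (A + + 1) * (C * C))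
    lemma = ℤRing.solve-∀

  module Smallest (t : ℤ) (t≥0 : 0ℤ ≤ t) (root : (t - + 3) * (A + t) ≡ (B + C) * t - (+ 3 * B + C)) where
    A+t>0 : 0ℤ < A + t
    A+t>0 = ℤ.+-mono-<-≤ A>0 t≥0

    open Minimal t root (pos⇒≢0 A+t>0) public

    N′>0 : 0ℤ < N′
    N′>0 = ℤ.+-mono-<-≤ (ℤ.+-mono-<-≤ (ℤ.+-mono-<-≤
        (*-pos (*-pos (*-pos {+ 6} (ℤ.+<+ (s≤s z≤n)) A>0) A+1>0) C>0)
        (*-nonNeg (*-nonNeg (*-nonNeg (*-nonNeg {+ 2} (ℤ.+≤+ z≤n) t≥0) t≥0) (ℤ.<⇒≤ A+1>0)) (ℤ.<⇒≤ C>0)))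
        (square-nonNeg ((t - + 3) * (A + t))))
        (*-nonNeg (*-nonNeg (*-nonNeg {+ 2} (ℤ.+≤+ z≤n) (ℤ.<⇒≤ A>0)) (ℤ.<⇒≤ B>0)) (square-nonNeg (t - + 3)))

    γω-gram : GramOf (M γω) N′
    γω-gram = gram λ x y → trans (∑-cong (λ j → cong (M γω x j *_) (M-sym γω y j))) (γω-idempotent x y)

    private
      weights : Fin 4 → ℤ
      weights i = η i * (η i * γω i)

      -- The quadratic value ω₂ disappears because η₂ = 0, so the resulting condition is linear in
      -- t.
      weighted : C * weights 0F + + 3 * A * C * weights 1F + + 6 * A * (A + + 1) * weights 2F + + 3 * (A + + 1) * B * weights 3F ≡
        + 6 * A * (A + + 1) * B * (C * C) * ((+ 9 - t) * B - (t - + 3) * C)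
      weighted = lemma A B C t (ω 2F)
        where
        lemma : ∀ A B C t w → C * ((+ 3 * B) * ((+ 3 * B) * (C * (+ 6 * A * (A + + 1))))) +
          + 3 * A * C * (B * (B * (C * (+ 0 - + 2 * t * (A + + 1))))) + + 6 * A * (A + + 1) * (+ 0 * (+ 0 * (C * w))) +
          + 3 * (A + + 1) * B * ((ℤ.- C) * ((ℤ.- C) * (C * (+ 0 - + 2 * A * (t - + 3))))) ≡
          + 6 * A * (A + + 1) * B * (C * C) * ((+ 9 - t) * B - (t - + 3) * C)
        lemma = ℤRing.solve-∀

    krein₁₁₃ : (t - + 3) * C ≤ (+ 9 - t) * B
    krein₁₁₃ = ℤ.0≤i-j⇒j≤i (factor (*-pos (*-pos (*-pos (*-pos {+ 6} (ℤ.+<+ (s≤s z≤n)) A>0) A+1>0) B>0) (*-pos C>0 C>0))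
      (subst (0ℤ ≤_) weighted (total-nonNeg weights (krein N>0 N>0 N′>0 η-gram η-gram γω-gram))))

    krein₁₁₃-tight : (t - + 3) * C ≡ (+ 9 - t) * B → ∀ p q r → ∑ (λ x → M η x p * (M η x q * M γω x r)) ≡ 0ℤ
    krein₁₁₃-tight eq = krein≡0 N>0 N>0 N′>0 η-gram η-gram γω-gram (total≡0 weights (trans weighted
      (trans (cong (λ s → + 6 * A * (A + + 1) * B * (C * C) * ((+ 9 - t) * B - s)) eq)
        (trans (cong (+ 6 * A * (A + + 1) * B * (C * C) *_) (ℤ.+-inverseʳ ((+ 9 - t) * B))) (ℤ.*-zeroʳ (+ 6 * A * (A + + 1) * B * (C * C)))))))

  private
    A₂ : ℤ
    A₂ = + 3 * A - B - C

  -- The relation c₂ A₂ = A² - a₁ A - k between distance matrices, written for functions of the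
  -- distance.
  γp₂ : (Fin 4 → ℤ) → Fin 4 → ℤ
  γp₂ f i = Λ (Λ f) i - (A - + 3) * Λ f i - + 3 * A * f i

  module _ (x y : Fin n) where
    private
      module S = Spectral ℤ-domain Γ G
      open HasArray H

      0*+ : ∀ p q → 0ℤ * p + q ≡ q
      0*+ p q = trans (cong (_+ q) (ℤ.*-zeroˡ p)) (ℤ.+-identityˡ q)

      -- Any function of the distance to x is an eigenvector for 0 with defect `Λ f`. The
      -- recurrences then express sums over spheres through powers of `Λ`.
      A·M : ∀ f z → A· (M f x) z ≡ 0ℤ * M f x z + M (Λ f) x z
      A·M f z = trans (sum-over-adjacent f x z) (sym (0*+ (f (dist x z)) (Λ f (dist x z))))

    first-sum : ∀ f → τ 1F (M f x) y ≡ Λ f (dist x y)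
    first-sum f = trans (sym (trans (cong (_* τ 1F (M f x) y) c₁≡) (ℤ.*-identityˡ _)))
      (trans (S.recurrence₀ 0ℤ (M f x) (M (Λ f) x) (A·M f) y) (0*+ (f (dist x y)) (Λ f (dist x y))))

    second-sum : ∀ f → C * τ 2F (M f x) y ≡ γp₂ f (dist x y)
    second-sum f = begin
      C * t2                                                   ≡⟨ lemma (+ 3 * A * φ y) ((A - + 3) * τ 1F φ y) (C * t2) ⟩
      (+ 3 * A * φ y + (A - + 3) * τ 1F φ y + C * t2) - (A - + 3) * τ 1F φ y - + 3 * A * φ y
        ≡⟨ cong₂ (λ p q → p - (A - + 3) * q - + 3 * A * φ y) second (first-sum f) ⟩
      γp₂ f (dist x y) ∎
      where
      open ≡-Reasoning
      φ : Fin n → ℤ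
      φ = M f x
      t2 : ℤ
      t2 = τ 2F φ y
      lemma : ∀ p q s → s ≡ (p + q + s) - q - p
      lemma = ℤRing.solve-∀
      second : + 3 * A * φ y + (A - + 3) * τ 1F φ y + C * t2 ≡ Λ (Λ f) (dist x y)
      second = trans (sym (cong₂ _+_ (cong₂ _+_ (cong (_* φ y) k≡) (cong (_* τ 1F φ y) a₁≡)) (cong (_* t2) c₂≡)))
        (trans (S.recurrence₁ 0ℤ φ (M (Λ f) x) (A·M f) y) (trans (0*+ (τ 1F φ y) _) (first-sum (Λ f))))

    third-sum : ∀ f → + 2 * A * (C * τ 3F (M f x) y) ≡
      γp₂ (Λ f) (dist x y) - (+ 2 * A + + 2) * C * Λ f (dist x y) - A₂ * γp₂ f (dist x y)
    third-sum f = begin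
      + 2 * A * (C * t3)
        ≡⟨ lemma A C (+ 2 * A + + 2) A₂ t1 t2 t3 ⟩
      C * ((+ 2 * A + + 2) * t1 + A₂ * t2 + + 2 * A * t3) - (+ 2 * A + + 2) * C * t1 - A₂ * (C * t2)
        ≡⟨ cong₂ (λ p q → C * p - (+ 2 * A + + 2) * C * t1 - A₂ * q) third (second-sum f) ⟩
      C * τ 2F (M (Λ f) x) y - (+ 2 * A + + 2) * C * t1 - A₂ * γp₂ f (dist x y)
        ≡⟨ cong₂ (λ p q → p - (+ 2 * A + + 2) * C * q - A₂ * γp₂ f (dist x y)) (second-sum (Λ f)) (first-sum f) ⟩
      _ ∎
      where
      open ≡-Reasoning
      φ : Fin n → ℤ
      φ = M f x
      t1 t2 t3 : ℤ
      t1 = τ 1F φ y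
      t2 = τ 2F φ y
      t3 = τ 3F φ y
      lemma : ∀ A C b₁ a₂ t1 t2 t3 → + 2 * A * (C * t3) ≡ C * (b₁ * t1 + a₂ * t2 + + 2 * A * t3) - b₁ * C * t1 - a₂ * (C * t2)
      lemma = ℤRing.solve-∀
      third : (+ 2 * A + + 2) * t1 + A₂ * t2 + + 2 * A * t3 ≡ τ 2F (M (Λ f) x) y
      third = trans (sym (cong₂ _+_ (cong₂ _+_ (cong (_* t1) b₁≡) (cong (_* t2) a₂≡)) (cong (_* t3) c₃≡)))
        (trans (S.recurrence₂ 0ℤ φ (M (Λ f) x) (A·M f) y) (0*+ t2 _))

  private
    counted : ∀ {x y} i → dist x y ≡ i → ∃[ q ] C * q ≡ γp₂ (e 2F) i
    counted {x} {y} i refl = _ , second-sum x y (e 2F)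

  -- The witness is the intersection number p¹₂₂, the number of vertices at distance 2 from both
  -- ends of an edge. The next two use pairs at distance 2 and 3.
  γ∣p¹₂₂ : ∃[ q ] C * q ≡ (+ 2 * A + + 2) * A₂
  γ∣p¹₂₂ with x , u , w , y , uw , wy , du , dw , dy ← geodesic with q , eq ← counted 1F du = q , trans eq (lemma A B C)
    where
    lemma : ∀ A B C →
      let l0 = + 3 * A * + 0 ; l1 = + 0 + (A - + 3) * + 0 + (+ 2 * A + + 2) * + 1 ; l2 = C * + 0 + (+ 3 * A - B - C) * + 1 + B * + 0 in
      (l0 + (A - + 3) * l1 + (+ 2 * A + + 2) * l2) - (A - + 3) * l1 - + 3 * A * + 0 ≡ (+ 2 * A + + 2) * (+ 3 * A - B - C)
    lemma = ℤRing.solve-∀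

  γ∣p²₂₂ : ∃[ q ] C * q ≡ C * (+ 2 * A + + 2) + A₂ * A₂ + B * (+ 2 * A) - (A - + 3) * A₂ - + 3 * A
  γ∣p²₂₂ with x , u , w , y , uw , wy , du , dw , dy ← geodesic with q , eq ← counted 2F dw = q , trans eq (lemma A B C)
    where
    lemma : ∀ A B C →
      let l1 = + 0 + (A - + 3) * + 0 + (+ 2 * A + + 2) * + 1 ; l2 = C * + 0 + (+ 3 * A - B - C) * + 1 + B * + 0 ; l3 = + 2 * A * + 1 + A * + 0 in
      (C * l1 + (+ 3 * A - B - C) * l2 + B * l3) - (A - + 3) * l2 - + 3 * A * + 1 ≡
      C * (+ 2 * A + + 2) + (+ 3 * A - B - C) * (+ 3 * A - B - C) + B * (+ 2 * A) - (A - + 3) * (+ 3 * A - B - C) - + 3 * A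
    lemma = ℤRing.solve-∀

  γ∣p³₂₂ : ∃[ q ] C * q ≡ + 2 * A * (A₂ + + 3)
  γ∣p³₂₂ with x , u , w , y , uw , wy , du , dw , dy ← geodesic with q , eq ← counted 3F dy = q , trans eq (lemma A B C)
    where
    lemma : ∀ A B C →
      let l2 = C * + 0 + (+ 3 * A - B - C) * + 1 + B * + 0 ; l3 = + 2 * A * + 1 + A * + 0 in
      (+ 2 * A * l2 + A * l3) - (A - + 3) * l3 - + 3 * A * + 0 ≡ + 2 * A * ((+ 3 * A - B - C) + + 3)
    lemma = ℤRing.solve-∀

  -- The difference of c₂ p³₂₂ and c₂ p¹₂₂ equals 2 β + 2 γ.
  γ∣2β : ∃[ q ] C * q ≡ + 2 * B
  γ∣2β with q₁ , eq₁ ← γ∣p¹₂₂ with q₃ , eq₃ ← γ∣p³₂₂ =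
    q₃ - q₁ - + 2 , (begin
      C * (q₃ - q₁ - + 2)        ≡⟨ lemma C q₁ q₃ ⟩
      C * q₃ - C * q₁ - + 2 * C  ≡⟨ cong₂ (λ p q → p - q - + 2 * C) eq₃ eq₁ ⟩
      + 2 * A * (A₂ + + 3) - (+ 2 * A + + 2) * A₂ - + 2 * C ≡⟨ lemma′ A B C ⟩
      + 2 * B                    ∎)
    where
    open ≡-Reasoning
    lemma : ∀ C p q → C * (q - p - + 2) ≡ C * q - C * p - + 2 * C
    lemma = ℤRing.solve-∀
    lemma′ : ∀ A B C → + 2 * A * ((+ 3 * A - B - C) + + 3) - (+ 2 * A + + 2) * (+ 3 * A - B - C) - + 2 * C ≡ + 2 * B
    lemma′ = ℤRing.solve-∀

  k₂ : ℤ
  k₂ = τ 2F one vertex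

  γk₂≡ : C * k₂ ≡ + 6 * A * (A + + 1)
  γk₂≡ = γk₂ vertex

  -- The second subconstituent is regular of valency a₂ on k₂ vertices.
  k₂a₂-even : ∃[ q ] k₂ * A₂ ≡ + 2 * q
  k₂a₂-even = let q , eq = ∑∑-even s s-sym s-irrefl in q , trans (sym total) eq
    where
    open ≡-Reasoning
    x : Fin n
    x = vertex
    s : Fin n → Fin n → ℤ
    s y z = e 2F (dist x y) * e 2F (dist x z) * adjacency y z
    s-sym : ∀ y z → s y z ≡ s z y
    s-sym y z = cong₂ _*_ (ℤ.*-comm (e 2F (dist x y)) (e 2F (dist x z))) (Spectral.α-sym ℤ-domain Γ G y z)
    s-irrefl : ∀ y → s y y ≡ 0ℤ
    s-irrefl y = trans (cong (λ t → e 2F (dist x y) * e 2F (dist x y) * [ t ]) (dec-false (adj? y y) (irrefl refl))) (ℤ.*-zeroʳ (e 2F (dist x y) * e 2F (dist x y)))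
    l : ∀ A B C → + 1 * (C * + 0 + (+ 3 * A - B - C) * + 1 + B * + 0) ≡ + 1 * + 1 * (+ 3 * A - B - C)
    l = ℤRing.solve-∀
    at : ∀ i → e 2F i * Λ (e 2F) i ≡ e 2F i * + 1 * A₂
    at 0F = refl
    at 1F = refl
    at 2F = l A B C
    at 3F = refl
    total : ∑ (λ y → ∑ (λ z → s y z)) ≡ k₂ * A₂
    total = begin
      ∑ (λ y → ∑ (λ z → s y z))
        ≡⟨ ∑-cong (λ y → trans (∑-cong (λ z → lemma (e 2F (dist x y)) (e 2F (dist x z)) (adjacency y z)))
             (trans (∑-*ˡ (e 2F (dist x y)) (λ z → adjacency y z * e 2F (dist x z))) (cong (e 2F (dist x y) *_) (sum-over-adjacent (e 2F) x y)))) ⟩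
      ∑ (λ y → e 2F (dist x y) * Λ (e 2F) (dist x y))
        ≡⟨ ∑-cong (λ y → at (dist x y)) ⟩
      ∑ (λ y → e 2F (dist x y) * + 1 * A₂)
        ≡⟨ ∑-*ʳ A₂ _ ⟩
      k₂ * A₂ ∎
      where
      lemma : ∀ p q s → p * q * s ≡ p * (s * q)
      lemma = ℤRing.solve-∀

-- Cocliques among the neighbours of a vertex

Indicator : ℤ → Set
Indicator i = i ≡ + 0 ⊎ i ≡ + 1

indicator-nonNeg : ∀ {i} → Indicator i → 0ℤ ≤ i
indicator-nonNeg (inj₁ refl) = ℤ.+≤+ z≤n
indicator-nonNeg (inj₂ refl) = ℤ.+≤+ z≤n

indicator-* : ∀ {i j} → Indicator i → Indicator j → Indicator (i * j)
indicator-* (inj₁ refl) _           = inj₁ refl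
indicator-* (inj₂ refl) (inj₁ refl) = inj₁ refl
indicator-* (inj₂ refl) (inj₂ refl) = inj₂ refl

∑-- : ∀ {n} (f g : Fin n → ℤ) → ∑ (λ i → f i - g i) ≡ ∑ f - ∑ g
∑-- f g = trans (∑-+ f (λ i → ℤ.- g i)) (cong (λ s → ∑ f + s)
  (trans (∑-cong (λ i → sym (ℤ.-1*i≡-i (g i)))) (trans (∑-*ˡ (ℤ.-[1+ 0 ]) g) (ℤ.-1*i≡-i (∑ g)))))

-- The number s (s - 1) / 2 of pairs among s chosen vertices.
triangular : ℕ → ℕ
triangular zero    = 0
triangular (suc s) = triangular s ℕ.+ s

module Coclique {n} (Γ : Graph n) (G : DistanceRegular Γ 3) {α β γ : ℕ} (H : HasArray G α β γ) where
  open Distance Γ G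
  open Parameters Γ G using (geodesic)
  open ArrayInteger Γ G H
  open Counting ℤ-domain using (e; [_])
  open Sizes

  e-indicator : ∀ {m} (i j : Fin m) → Indicator (e i j)
  e-indicator i j with i Fin.≟ j
  ... | yes _ = inj₂ refl
  ... | no  _ = inj₁ refl

  e≡1 : ∀ {m} {i j : Fin m} → j ≡ i → e i j ≡ + 1
  e≡1 {i = i} refl = cong [_] (dec-true (i Fin.≟ i) refl)

  e≡0 : ∀ {m} {i j : Fin m} → j ≢ i → e i j ≡ + 0
  e≡0 {i = i} {j} j≢i = cong [_] (dec-false (i Fin.≟ j) (j≢i ∘ sym))

  adjacency≡e : ∀ y z → adjacency y z ≡ e 1F (dist y z)
  adjacency≡e y z = cong [_] (does-⇔ (adj? y z) (1F Fin.≟ dist y z) (sym ∘ adj⇒dist) (dist≡1⇒adj ∘ sym))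

  sum-over-sphere : ∀ f x y → ∑ (λ z → e 1F (dist y z) * f (dist x z)) ≡ Λ f (dist x y)
  sum-over-sphere f x y = trans (∑-cong (λ z → cong (_* f (dist x z)) (sym (adjacency≡e y z)))) (sum-over-adjacent f x y)

  ∑-e₀ : ∀ (f : Fin n → ℤ) x → ∑ (λ z → e 0F (dist x z) * f z) ≡ f x
  ∑-e₀ f x = Spectral.τ₀ ℤ-domain Γ G f x

  module _ (x : Fin n) where
    -- The closed neighbourhood of y inside Γ(x). For y adjacent to x it has a₁ + 1 = A - 2
    -- vertices.
    ν : Fin n → Fin n → ℤ
    ν y w = e 1F (dist x w) * (e 0F (dist y w) + e 1F (dist y w))

    ν-indicator : ∀ y w → Indicator (ν y w)
    ν-indicator y w = indicator-* (e-indicator 1F (dist x w)) (e₀₁ (dist y w))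
      where
      e₀₁ : ∀ i → Indicator (e 0F i + e 1F i)
      e₀₁ 0F = inj₂ refl
      e₀₁ 1F = inj₂ refl
      e₀₁ 2F = inj₁ refl
      e₀₁ 3F = inj₁ refl

    ∑-ν : ∀ {y} → dist x y ≡ 1F → ∑ (ν y) ≡ A - + 2
    ∑-ν {y} xy = begin
      ∑ (ν y)  ≡⟨ ∑-cong (λ w → lemma (e 1F (dist x w)) (e 0F (dist y w)) (e 1F (dist y w))) ⟩
      ∑ (λ w → e 0F (dist y w) * e 1F (dist x w) + e 1F (dist y w) * e 1F (dist x w))  ≡⟨ ∑-+ _ _ ⟩
      ∑ (λ w → e 0F (dist y w) * e 1F (dist x w)) + ∑ (λ w → e 1F (dist y w) * e 1F (dist x w))
        ≡⟨ cong₂ _+_ (∑-e₀ (λ w → e 1F (dist x w)) y) (sum-over-sphere (e 1F) x y) ⟩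
      e 1F (dist x y) + Λ (e 1F) (dist x y)  ≡⟨ cong (λ i → e 1F i + Λ (e 1F) i) xy ⟩
      + 1 + (+ 0 + (A - + 3) * + 1 + (+ 2 * A + + 2) * + 0)  ≡⟨ lemma′ A ⟩
      A - + 2 ∎
      where
      open ≡-Reasoning
      lemma : ∀ p q r → p * (q + r) ≡ q * p + r * p
      lemma = ℤRing.solve-∀
      lemma′ : ∀ A → + 1 + (+ 0 + (A - + 3) * + 1 + (+ 2 * A + + 2) * + 0) ≡ A - + 2
      lemma′ = ℤRing.solve-∀

    -- Two vertices at distance 2 have c₂ common neighbours, and one of these is x, which lies
    -- outside Γ(x).
    meets-ν : ∀ {y y′} → dist x y ≡ 1F → dist x y′ ≡ 1F → dist y y′ ≡ 2F → ∑ (λ w → ν y w * ν y′ w) ≤ C - + 1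
    meets-ν {y} {y′} xy xy′ yy′ = subst (∑ (λ w → ν y w * ν y′ w) ≤_) total (∑-mono pointwise)
      where
      total : ∑ (λ w → e 1F (dist y′ w) * e 1F (dist y w) - e 0F (dist x w) * + 1) ≡ C - + 1
      total = trans (∑-- _ _) (cong₂ _-_ (trans (sum-over-sphere (e 1F) y y′) (trans (cong (Λ (e 1F)) yy′) (lemma A B C))) (∑-e₀ (λ _ → + 1) x))
        where
        lemma : ∀ A B C → C * + 1 + (+ 3 * A - B - C) * + 0 + B * + 0 ≡ C
        lemma = ℤRing.solve-∀
      pointwise : ∀ w → ν y w * ν y′ w ≤ e 1F (dist y′ w) * e 1F (dist y w) - e 0F (dist x w) * + 1
      pointwise w with dist x w in xw
      ... | 0F rewrite dist≡0⇒≡ xw | dist-sym y w | dist-sym y′ w | xy | xy′ = ℤ.+≤+ z≤n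
      ... | 2F = indicator-nonNeg (subst Indicator (sym (ℤ.+-identityʳ _)) (indicator-* (e-indicator 1F (dist y′ w)) (e-indicator 1F (dist y w))))
      ... | 3F = indicator-nonNeg (subst Indicator (sym (ℤ.+-identityʳ _)) (indicator-* (e-indicator 1F (dist y′ w)) (e-indicator 1F (dist y w))))
      ... | 1F with dist y w in yw | dist y′ w in y′w
      ...   | 1F | 1F = ℤ.≤-refl
      ...   | 1F | 0F = contradiction (trans (sym yy′) (trans (cong (dist y) (dist≡0⇒≡ y′w)) yw)) λ ()
      ...   | 1F | 2F = ℤ.≤-refl
      ...   | 1F | 3F = ℤ.≤-refl
      ...   | 2F | j  = subst (0ℤ ≤_) (sym (trans (ℤ.+-identityʳ _) (ℤ.*-zeroʳ (e 1F j)))) ℤ.≤-refl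
      ...   | 3F | j  = subst (0ℤ ≤_) (sym (trans (ℤ.+-identityʳ _) (ℤ.*-zeroʳ (e 1F j)))) ℤ.≤-refl
      ...   | 0F | j  with refl ← dist≡0⇒≡ yw with refl ← trans (sym y′w) (trans (dist-sym y′ y) yy′) = ℤ.≤-refl

    -- U stands for the union of the closed neighbourhoods in Γ(x) of s pairwise non-adjacent
    -- vertices. The vertices themselves are not recorded: `meets` keeps what the next choice has to
    -- know about them.
    record Cover (s : ℕ) : Set where
      field
        U         : Fin n → ℤ
        indicator : ∀ w → Indicator (U w)
        inside    : ∀ w → U w ≤ e 1F (dist x w)
        large     : + s * (A - + 2) - + triangular s * (C - + 1) ≤ ∑ U
        small     : ∑ U ≤ + s * (A - + 2)
        meets   : ∀ y → dist x y ≡ 1F → U y ≡ + 0 → ∑ (λ w → U w * ν y w) ≤ + s * (C - + 1)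

    empty : Cover 0
    empty = record
      { U = λ _ → + 0
      ; indicator = λ _ → inj₁ refl
      ; inside = λ w → indicator-nonNeg (e-indicator 1F (dist x w))
      ; large = ℤ.≤-reflexive (sym (∑-0 {n} (λ _ → refl)))
      ; small = ℤ.≤-reflexive (∑-0 {n} (λ _ → refl))
      ; meets = λ y _ _ → ℤ.≤-reflexive (∑-0 {n} (λ _ → refl))
      }

    valency≡ : ∑ (λ w → e 1F (dist x w)) ≡ + 3 * A
    valency≡ = trans (∑-cong (λ w → sym (ℤ.*-identityʳ _))) (k₁ x)

    uncovered : ∀ {s} (V : Cover s) → + s * (A - + 2) < + 3 * A → ∃[ y ] dist x y ≡ 1F × Cover.U V y ≡ + 0
    uncovered {s} V s< with Fin.any? (λ y → (dist x y Fin.≟ 1F) ×-dec (Cover.U V y ℤ.≟ + 0))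
    ... | yes found = found
    ... | no  none  = contradiction (ℤ.≤-<-trans (Cover.small V) s<) (ℤ.≤⇒≯ (subst (_≤ ∑ (Cover.U V)) valency≡ (∑-mono covered)))
      where
      covered : ∀ w → e 1F (dist x w) ≤ Cover.U V w
      covered w with e-indicator 1F (dist x w) | Cover.indicator V w
      ... | inj₁ e≡ | u       = subst (_≤ Cover.U V w) (sym e≡) (indicator-nonNeg u)
      ... | inj₂ e≡ | inj₂ u≡ = ℤ.≤-reflexive (trans e≡ (sym u≡))
      ... | inj₂ e≡ | inj₁ u≡ with dist x w Fin.≟ 1F
      ...   | yes xw = contradiction (w , xw , u≡) none
      ...   | no  ≢1 = contradiction (trans (sym e≡) (e≡0 ≢1)) λ ()

    -- Inclusion and exclusion: the new neighbourhood has A - 2 vertices and shares at most s (C -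
    -- 1) of them with U.
    extend : ∀ {s} (V : Cover s) y → dist x y ≡ 1F → Cover.U V y ≡ + 0 → Cover (suc s)
    extend {s} V y xy Uy≡0 = record
      { U = U′
      ; indicator = λ w → union (indicator w) (ν-indicator y w)
      ; inside = λ w → union-inside w (indicator w) (ν-indicator y w)
      ; large = subst₂ _≤_ (large-lemma (+ s) (+ triangular s) (A - + 2) (C - + 1)) (sym ∑U′)
          (ℤ.+-mono-≤ (ℤ.+-monoˡ-≤ (A - + 2) large) (ℤ.neg-mono-≤ (meets y xy Uy≡0)))
      ; small = subst₂ _≤_ (sym ∑U′) (small-lemma (+ s) (A - + 2))
          (ℤ.≤-trans (ℤ.+-monoʳ-≤ (∑ U + (A - + 2)) (ℤ.neg-mono-≤ (∑-nonNeg (λ w → indicator-nonNeg (indicator-* (indicator w) (ν-indicator y w))))))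
            (subst (_≤ + s * (A - + 2) + (A - + 2)) (sym (ℤ.+-identityʳ _)) (ℤ.+-monoˡ-≤ (A - + 2) small)))
      ; meets = meets′
      }
      where
      open Cover V
      U′ : Fin n → ℤ
      U′ w = U w + ν y w - U w * ν y w
      union : ∀ {i j} → Indicator i → Indicator j → Indicator (i + j - i * j)
      union (inj₁ refl) (inj₁ refl) = inj₁ refl
      union (inj₁ refl) (inj₂ refl) = inj₂ refl
      union (inj₂ refl) (inj₁ refl) = inj₂ refl
      union (inj₂ refl) (inj₂ refl) = inj₂ refl
      union≡0 : ∀ {i j} → Indicator i → Indicator j → i + j - i * j ≡ + 0 → i ≡ + 0 × j ≡ + 0
      union≡0 (inj₁ refl) (inj₁ refl) _ = refl , refl
      union≡0 (inj₁ refl) (inj₂ refl) ()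
      union≡0 (inj₂ refl) (inj₁ refl) ()
      union≡0 (inj₂ refl) (inj₂ refl) ()
      ν≤ : ∀ w → ν y w ≤ e 1F (dist x w)
      ν≤ w with dist x w | dist y w
      ... | 0F | _  = ℤ.≤-refl
      ... | 2F | _  = ℤ.≤-refl
      ... | 3F | _  = ℤ.≤-refl
      ... | 1F | 0F = ℤ.≤-refl
      ... | 1F | 1F = ℤ.≤-refl
      ... | 1F | 2F = ℤ.+≤+ z≤n
      ... | 1F | 3F = ℤ.+≤+ z≤n
      union-inside : ∀ w → Indicator (U w) → Indicator (ν y w) → U′ w ≤ e 1F (dist x w)
      union-inside w (inj₁ u≡) i        = subst (λ u → u + ν y w - u * ν y w ≤ e 1F (dist x w)) (sym u≡)
        (subst (_≤ e 1F (dist x w)) (sym (trans (ℤ.+-identityʳ _) (ℤ.+-identityˡ _))) (ν≤ w))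
      union-inside w (inj₂ u≡) (inj₁ v≡) = subst₂ (λ u v → u + v - u * v ≤ e 1F (dist x w)) (sym u≡) (sym v≡) (subst (_≤ e 1F (dist x w)) u≡ (inside w))
      union-inside w (inj₂ u≡) (inj₂ v≡) = subst₂ (λ u v → u + v - u * v ≤ e 1F (dist x w)) (sym u≡) (sym v≡) (subst (_≤ e 1F (dist x w)) u≡ (inside w))
      ∑U′ : ∑ U′ ≡ ∑ U + (A - + 2) - ∑ (λ w → U w * ν y w)
      ∑U′ = trans (∑-- _ _) (cong (_- ∑ (λ w → U w * ν y w)) (trans (∑-+ _ _) (cong (λ s → ∑ U + s) (∑-ν xy))))
      large-lemma : ∀ s t p q → (s * p - t * q) + p - s * q ≡ (+ 1 + s) * p - (t + s) * q
      large-lemma = ℤRing.solve-∀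
      small-lemma : ∀ s p → s * p + p ≡ (+ 1 + s) * p
      small-lemma = ℤRing.solve-∀
      meets′ : ∀ y′ → dist x y′ ≡ 1F → U′ y′ ≡ + 0 → ∑ (λ w → U′ w * ν y′ w) ≤ + suc s * (C - + 1)
      meets′ y′ xy′ U′y′≡0 = ℤ.≤-trans (∑-mono pointwise) (subst₂ _≤_ (sym (∑-+ _ _)) (small-lemma (+ s) (C - + 1))
        (ℤ.+-mono-≤ (meets y′ xy′ Uy′≡0) (meets-ν xy xy′ (far (dist y y′) refl))))
        where
        both : U y′ ≡ + 0 × ν y y′ ≡ + 0
        both = union≡0 (indicator y′) (ν-indicator y y′) U′y′≡0
        Uy′≡0 : U y′ ≡ + 0
        Uy′≡0 = proj₁ both
        νyy′≡0 : ∀ {i} → dist y y′ ≡ i → + 1 * (e 0F i + e 1F i) ≡ + 0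
        νyy′≡0 refl = trans (cong (_* (e 0F (dist y y′) + e 1F (dist y y′))) (sym (e≡1 xy′))) (proj₂ both)
        far : ∀ i → dist y y′ ≡ i → dist y y′ ≡ 2F
        far 0F eq = contradiction (νyy′≡0 eq) λ ()
        far 1F eq = contradiction (νyy′≡0 eq) λ ()
        far 2F eq = eq
        far 3F eq = contradiction (subst₂ (λ i j → toℕ i ℕ.≤ suc (toℕ j)) eq (trans (dist-sym y x) xy) (dist-step y (dist≡1⇒adj xy′))) λ { (s≤s (s≤s ())) }
        drop : ∀ {i j k} → Indicator i → Indicator j → Indicator k → (i + j - i * j) * k ≤ i * k + j * k
        drop {i} {j} {k} ii ij ik = subst (_≤ i * k + j * k) (sym (lemma i j k))
          (ℤ.≤-trans (ℤ.+-monoʳ-≤ (i * k + j * k) (ℤ.neg-mono-≤ (indicator-nonNeg (indicator-* (indicator-* ii ij) ik)))) (ℤ.≤-reflexive (ℤ.+-identityʳ _)))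
          where
          lemma : ∀ i j k → (i + j - i * j) * k ≡ i * k + j * k - i * j * k
          lemma = ℤRing.solve-∀
        pointwise : ∀ w → U′ w * ν y′ w ≤ U w * ν y′ w + ν y w * ν y′ w
        pointwise w = drop (indicator w) (ν-indicator y w) (ν-indicator y′ w)

    cover : ∀ s → (∀ j → j ℕ.< s → + j * (A - + 2) < + 3 * A) → Cover s
    cover zero    _  = empty
    cover (suc s) lt with V ← cover s (λ j j<s → lt j (ℕ.m<n⇒m<1+n j<s)) with y , xy , Uy≡0 ← uncovered V (lt s ℕ.≤-refl) =
      extend V y xy Uy≡0

  -- Among the neighbours of a vertex, s pairwise non-adjacent ones can be
  -- chosen greedily, and two of them have at most c₂ - 1 common neighbours there.
  coclique-bound : ∀ s → (∀ j → j ℕ.< s → + j * (A - + 2) < + 3 * A) →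
    + s * (A - + 2) - + triangular s * (C - + 1) ≤ + 3 * A
  coclique-bound s lt = ℤ.≤-trans (Cover.large V) (ℤ.≤-trans (∑-mono (Cover.inside V)) (ℤ.≤-reflexive (valency≡ x)))
    where
    x : Fin n
    x = proj₁ geodesic
    V : Cover x s
    V = cover x s lt

-- Triple intersection numbers for the array {21, 16, 8; 1, 4, 14}

sumOver : ∀ {n} → (Fin n → ℤ) → List (Fin n) → ℤ
sumOver g []      = + 0
sumOver g (i ∷ l) = g i + sumOver g l

sumOver-suc : ∀ {n} (g : Fin (suc n) → ℤ) l → sumOver g (map suc l) ≡ sumOver (g ∘ suc) l
sumOver-suc g []      = refl
sumOver-suc g (i ∷ l) = cong (λ s → g (suc i) + s) (sumOver-suc g l)

-- Turns a sum weighted by an indicator into a sum over named elements; this is how the four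
-- vertices related to u are obtained.
support : ∀ {n} (χ : Fin n → ℤ) → (∀ i → Indicator (χ i)) →
  ∃[ l ] (∀ g → ∑ (λ i → χ i * g i) ≡ sumOver g l) × All (λ i → χ i ≡ + 1) l × Unique l
support {zero}  χ ind = [] , (λ g → ∑-empty _) , [] , []
support {suc n} χ ind with support (χ ∘ suc) (ind ∘ suc) | ind zero
... | l , eq , ones , uniq | inj₁ χ≡0 = map suc l , (λ g → trans (∑-suc _) (trans (cong₂ _+_ (cong (_* g zero) χ≡0) (eq (g ∘ suc)))
    (trans (ℤ.+-identityˡ _) (sym (sumOver-suc g l))))) , All.map⁺ ones , Unique.map⁺ Fin.suc-injective uniq
... | l , eq , ones , uniq | inj₂ χ≡1 = zero ∷ map suc l , (λ g → trans (∑-suc _) (cong₂ _+_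
    (trans (cong (_* g zero) χ≡1) (ℤ.*-identityˡ (g zero))) (trans (eq (g ∘ suc)) (sym (sumOver-suc g l))))) ,
    χ≡1 ∷ All.map⁺ ones , All.map⁺ (All.universal (λ _ ()) l) ∷ Unique.map⁺ Fin.suc-injective uniq

-- Cyclic shifts permute the triples in orbits of three, apart from the constant triples, where g
-- vanishes. In the induction, the triples with exactly one index 0 contribute r for each of its
-- three positions, and those with more vanish.
∑∑∑-multiple-of-3 : ∀ {n} (g : Fin n → Fin n → Fin n → ℤ) → (∀ i j k → g i j k ≡ g j k i) → (∀ i j → g i i j ≡ 0ℤ) →
  ∃[ q ] ∑ (λ i → ∑ (λ j → ∑ (λ k → g i j k))) ≡ + 3 * q
∑∑∑-multiple-of-3 {zero}  g cyclic irr = 0ℤ , ∑-empty _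
∑∑∑-multiple-of-3 {suc n} g cyclic irr = let q , eq = ∑∑∑-multiple-of-3 (λ i j k → g (suc i) (suc j) (suc k)) (λ i j k → cyclic _ _ _) (λ i j → irr _ _) in
  r + q , (begin
    ∑ (λ i → ∑ (λ j → ∑ (λ k → g i j k)))
      ≡⟨ trans (∑-suc _) (cong₂ _+_ (split (λ j k → g zero j k) (∑-0 (λ k → irr zero (suc k))) (∑-0 (λ j → trans (sym (cyclic zero zero (suc j))) (irr zero (suc j)))) (irr zero zero))
           (trans (∑-cong (λ i → inner i)) (trans (∑-+ _ _) (cong₂ _+_ (trans (∑-+ _ _) (cong₂ _+_
             (∑-cong (λ i → ∑-cong (λ k → trans (cyclic (suc i) zero (suc k)) refl)))
             (∑-cong (λ i → ∑-cong (λ j → trans (sym (cyclic zero (suc i) (suc j))) refl))))) eq)))) ⟩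
    r + ((∑ (λ i → ∑ (λ k → g zero (suc k) (suc i))) + r) + + 3 * q)
      ≡⟨ cong (λ s → r + ((s + r) + + 3 * q)) (∑-swap (λ i k → g zero (suc k) (suc i))) ⟩
    r + ((r + r) + + 3 * q)
      ≡⟨ lemma r q ⟩
    + 3 * (r + q) ∎)
  where
  open ≡-Reasoning
  r : ℤ
  r = ∑ (λ j → ∑ (λ k → g zero (suc j) (suc k)))
  lemma : ∀ r q → r + ((r + r) + + 3 * q) ≡ + 3 * (r + q)
  lemma = ℤRing.solve-∀
  split : (h : Fin (suc n) → Fin (suc n) → ℤ) → ∑ (λ k → h zero (suc k)) ≡ 0ℤ → ∑ (λ j → h (suc j) zero) ≡ 0ℤ → h zero zero ≡ 0ℤ →
    ∑ (λ j → ∑ (λ k → h j k)) ≡ ∑ (λ j → ∑ (λ k → h (suc j) (suc k)))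
  split h row col corner = begin
    ∑ (λ j → ∑ (λ k → h j k))
      ≡⟨ trans (∑-suc _) (cong₂ _+_ (trans (∑-suc _) (cong₂ _+_ corner row)) (trans (∑-cong (λ j → ∑-suc _)) (trans (∑-+ _ _) (cong (_+ ∑ (λ j → ∑ (λ k → h (suc j) (suc k)))) col)))) ⟩
    (0ℤ + 0ℤ) + (0ℤ + ∑ (λ j → ∑ (λ k → h (suc j) (suc k))))
      ≡⟨ trans (ℤ.+-identityˡ _) (ℤ.+-identityˡ _) ⟩
    ∑ (λ j → ∑ (λ k → h (suc j) (suc k))) ∎
  inner : ∀ i → ∑ (λ j → ∑ (λ k → g (suc i) j k)) ≡
    (∑ (λ k → g (suc i) zero (suc k)) + ∑ (λ j → g (suc i) (suc j) zero)) + ∑ (λ j → ∑ (λ k → g (suc i) (suc j) (suc k)))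
  inner i = begin
    ∑ (λ j → ∑ (λ k → g (suc i) j k))
      ≡⟨ trans (∑-suc _) (cong₂ _+_ (trans (∑-suc _) (cong (_+ ∑ (λ k → g (suc i) zero (suc k))) (trans (cyclic (suc i) zero zero) (irr zero (suc i)))))
           (trans (∑-cong (λ j → ∑-suc _)) (∑-+ _ _))) ⟩
    (0ℤ + ∑ (λ k → g (suc i) zero (suc k))) + (∑ (λ j → g (suc i) (suc j) zero) + ∑ (λ j → ∑ (λ k → g (suc i) (suc j) (suc k))))
      ≡⟨ rearrange (∑ (λ k → g (suc i) zero (suc k))) _ _ ⟩
    _ ∎
    where
    rearrange : ∀ a b c → (0ℤ + a) + (b + c) ≡ (a + b) + c
    rearrange = ℤRing.solve-∀

∑-linear : ∀ {n} k (f g : Fin n → ℤ) → ∑ (λ i → k * f i + g i) ≡ k * ∑ f + ∑ g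
∑-linear k f g = trans (∑-+ _ g) (cong (_+ ∑ g) (∑-*ˡ k f))

∑-linear₉ : ∀ {n} k₁ k₂ k₃ k₄ k₅ k₆ k₇ k₈ k₉ (f₁ f₂ f₃ f₄ f₅ f₆ f₇ f₈ f₉ : Fin n → ℤ) →
  ∑ (λ i → k₁ * f₁ i + (k₂ * f₂ i + (k₃ * f₃ i + (k₄ * f₄ i + (k₅ * f₅ i + (k₆ * f₆ i + (k₇ * f₇ i + (k₈ * f₈ i + k₉ * f₉ i)))))))) ≡
  k₁ * ∑ f₁ + (k₂ * ∑ f₂ + (k₃ * ∑ f₃ + (k₄ * ∑ f₄ + (k₅ * ∑ f₅ + (k₆ * ∑ f₆ + (k₇ * ∑ f₇ + (k₈ * ∑ f₈ + k₉ * ∑ f₉)))))))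
∑-linear₉ k₁ k₂ k₃ k₄ k₅ k₆ k₇ k₈ k₉ f₁ f₂ f₃ f₄ f₅ f₆ f₇ f₈ f₉ =
  add k₁ f₁ (add k₂ f₂ (add k₃ f₃ (add k₄ f₄ (add k₅ f₅ (add k₆ f₆ (add k₇ f₇ (add k₈ f₈ (∑-*ˡ k₉ f₉))))))))
  where
  add : ∀ k f {g s} → ∑ g ≡ s → ∑ (λ i → k * f i + g i) ≡ k * ∑ f + s
  add k f {g} eq = trans (∑-linear k f g) (cong (λ s → k * ∑ f + s) eq)

+-cancelˡ : ∀ k i j → k + i ≡ k + j → i ≡ j
+-cancelˡ k i j eq = trans (lemma k i) (trans (cong (_- k) eq) (sym (lemma k j)))
  where
  lemma : ∀ k i → i ≡ k + i - k
  lemma = ℤRing.solve-∀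

arith₁ : ∀ c m → 4 ≡ 12 ℕ.* c ℕ.+ 2 ℕ.* m → c ≡ 0 × m ≡ 2
arith₁ zero    m eq = refl , ℕ.*-cancelˡ-≡ m 2 2 (sym eq)
arith₁ (suc c) m eq = contradiction eq (ℕ.<⇒≢ (ℕ.≤-trans (ℕ.≤-trans (ℕ.m≤m+n 5 7) (ℕ.*-monoʳ-≤ 12 {1} {suc c} (s≤s z≤n))) (ℕ.m≤m+n (12 ℕ.* suc c) (2 ℕ.* m))))

arith₂ : ∀ c m → 20 ≡ 12 ℕ.* c ℕ.+ 2 ℕ.* m → (c ≡ 0 × m ≡ 10) ⊎ (c ≡ 1 × m ≡ 4)
arith₂ zero          m eq = inj₁ (refl , ℕ.*-cancelˡ-≡ m 10 2 (sym eq))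
arith₂ (suc zero)    m eq = inj₂ (refl , ℕ.*-cancelˡ-≡ m 4 2 (sym (ℕ.+-cancelˡ-≡ 12 8 (2 ℕ.* m) eq)))
arith₂ (suc (suc c)) m eq = contradiction eq (ℕ.<⇒≢ (ℕ.≤-trans (ℕ.≤-trans (ℕ.m≤m+n 21 3) (ℕ.*-monoʳ-≤ 12 {2} {2 ℕ.+ c} (s≤s (s≤s z≤n)))) (ℕ.m≤m+n (12 ℕ.* (2 ℕ.+ c)) (2 ℕ.* m))))

module Exclusion {n} (Γ : Graph n) (G : DistanceRegular Γ 3) (H : HasArray G 7 8 4) where
  open Distance Γ G
  open ArrayInteger Γ G H
  open ArrayConditions Γ G H
  open Coclique Γ G H
  open Counting ℤ-domain using (e; [_])
  open Smallest (+ 7) (ℤ.+≤+ z≤n) refl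

  private
    -- This is η / 4. The values of γω are 224 times 6, - 2, 1, - 1, so `scale` is 4 * 4 * 224.
    h : Fin 4 → ℤ
    h 0F = + 6
    h 1F = + 2
    h 2F = + 0
    h 3F = ℤ.- + 1

    -- For i, j, k the distances of w from x, u, v, this is η j * η k * γω i divided by `scale`,
    -- expanded into indicators such that the sum over w of each term depends on dist u v alone,
    -- except for `common u v` and `N₃ u v`. The expansion is valid at the triples of distances that
    -- can occur.
    E : Fin 4 → Fin 4 → Fin 4 → ℤ
    E i j k = + 20 * (e 0F i * + 1) + (ℤ.- + 12 * (e 0F j * h k) + (ℤ.- + 12 * (e 0F k * h j) + (+ 4 * (e 1F j * e 1F k) +
      (ℤ.- + 12 * (e 1F i * (e 1F j * e 1F k)) + (ℤ.- + 2 * (e 1F j * e 3F k) + (ℤ.- + 2 * (e 1F k * e 3F j) +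
      (+ 1 * (e 3F j * e 3F k) + ℤ.- + 2 * (e 3F i * (e 3F j * e 3F k)))))))))

    Near : Fin 4 → Fin 4 → Set
    Near i j = toℕ i ℕ.≤ suc (toℕ j) × toℕ j ℕ.≤ suc (toℕ i)

    -- Abstract, because unification would unfold the numeral.
    abstract
      scale : ℤ
      scale = + 3584

      scale>0 : 0ℤ < scale
      scale>0 = ℤ.+<+ (s≤s z≤n)

      expansion : ∀ i j k → Near i j × Near i k × ¬ (j ≡ 0F × k ≡ 0F) × ¬ (i ≡ 0F × j ≡ 0F) × ¬ (i ≡ 0F × k ≡ 0F) → η j * (η k * γω i) ≡ scale * E i j k
      expansion = toWitness {a? = Fin.all? λ i → Fin.all? λ j → Fin.all? λ k →
        (near? i j ×-dec near? i k ×-dec ¬? ((j Fin.≟ 0F) ×-dec (k Fin.≟ 0F)) ×-dec ¬? ((i Fin.≟ 0F) ×-dec (j Fin.≟ 0F)) ×-dec ¬? ((i Fin.≟ 0F) ×-dec (k Fin.≟ 0F))) →-dec (η j * (η k * γω i) ℤ.≟ scale * E i j k)} tt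
        where
        near? : ∀ i j → Dec (Near i j)
        near? i j = (toℕ i ℕ.≤? suc (toℕ j)) ×-dec (toℕ j ℕ.≤? suc (toℕ i))

  -- The constants of `third-sum` at α = 7, β = 8, γ = 4 are 2 α γ = 56, (2 α + 2) γ = 64 and a₂ =
  -- 9.
  τ₃₃ : ∀ {z y} i → dist z y ≡ i → + 56 * τ 3F (M (e 3F) z) y ≡
    γp₂ (Λ (e 3F)) i - + 64 * Λ (e 3F) i - + 9 * γp₂ (e 3F) i
  τ₃₃ {z} {y} i refl = trans (lemma (τ 3F (M (e 3F) z) y)) (third-sum z y (e 3F))
    where
    lemma : ∀ s → + 56 * s ≡ + 14 * (+ 4 * s)
    lemma = ℤRing.solve-∀

  module Local (x : Fin n) where
    σ : Fin n → ℤ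
    σ u = e 1F (dist x u)

    -- Blocks: the vertices z at distance 3 from x; N₃ u v counts those at
    -- distance 3 from u and v, common u v the common neighbours of x, u, v.
    χ : Fin n → Fin n → ℤ
    χ u z = e 3F (dist u z)

    N₃ common : Fin n → Fin n → ℤ
    N₃ u v = ∑ (λ z → e 3F (dist x z) * (χ u z * χ v z))
    common u v = ∑ (λ z → e 1F (dist x z) * (e 1F (dist u z) * e 1F (dist v z)))

    near : ∀ {u} → dist x u ≡ 1F → ∀ w → Near (dist x w) (dist u w)
    near {u} xu w = subst₂ (λ i j → toℕ i ℕ.≤ suc (toℕ j)) (dist-sym w x) (dist-sym w u) (dist-step w (symm (dist≡1⇒adj xu)))
                  , subst₂ (λ i j → toℕ i ℕ.≤ suc (toℕ j)) (dist-sym w u) (dist-sym w x) (dist-step w (dist≡1⇒adj xu))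

    -- Abstract for the same reason.
    abstract
      value : ℤ → ℤ → ℤ → ℤ → ℤ → ℤ → ℤ
      value p q r c t m = + 20 * + 1 + (ℤ.- + 12 * p + (ℤ.- + 12 * p + (+ 4 * q + (ℤ.- + 12 * c + (ℤ.- + 2 * r +
        (ℤ.- + 2 * r + (+ 1 * t + ℤ.- + 2 * m)))))))

      value-sums : ∀ {a b c d f g p q r} t m → a ≡ + 1 → b ≡ p → c ≡ p → d ≡ q → f ≡ r → g ≡ r → ∀ s →
        + 20 * a + (ℤ.- + 12 * b + (ℤ.- + 12 * c + (+ 4 * d + (ℤ.- + 12 * s + (ℤ.- + 2 * f + (ℤ.- + 2 * g + (+ 1 * t + ℤ.- + 2 * m))))))) ≡
        value p q r s t m
      value-sums t m refl refl refl refl refl refl s = refl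

      value₁ : ∀ c m → value (+ 2) (+ 4) (+ 0) c (+ 16) m ≡ + 4 - + 12 * c - + 2 * m
      value₁ = lemma
        where
        lemma : ∀ c m → + 20 * + 1 + (ℤ.- + 12 * + 2 + (ℤ.- + 12 * + 2 + (+ 4 * + 4 + (ℤ.- + 12 * c + (ℤ.- + 2 * + 0 +
          (ℤ.- + 2 * + 0 + (+ 1 * + 16 + ℤ.- + 2 * m))))))) ≡ + 4 - + 12 * c - + 2 * m
        lemma = ℤRing.solve-∀

      value₂ : ∀ c m → value (+ 0) (+ 4) (+ 8) c (+ 16) m ≡ + 20 - + 12 * c - + 2 * m
      value₂ = lemma
        where
        lemma : ∀ c m → + 20 * + 1 + (ℤ.- + 12 * + 0 + (ℤ.- + 12 * + 0 + (+ 4 * + 4 + (ℤ.- + 12 * c + (ℤ.- + 2 * + 8 +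
          (ℤ.- + 2 * + 8 + (+ 1 * + 16 + ℤ.- + 2 * m))))))) ≡ + 20 - + 12 * c - + 2 * m
        lemma = ℤRing.solve-∀

    -- The equality case of the Krein condition at the vertices u, v, x, with `scale` cancelled.
    triple : ∀ {u v} → dist x u ≡ 1F → dist x v ≡ 1F → u ≢ v →
      value (h (dist u v)) (Λ (e 1F) (dist u v)) (Λ (e 3F) (dist u v)) (common u v) (τ 3F (M (e 3F) v) u) (N₃ u v) ≡ 0ℤ
    triple {u} {v} xu xv u≢v = trans (sym sums) total≡0′
      where
      total≡0′ : ∑ (λ w → E (dist x w) (dist u w) (dist v w)) ≡ 0ℤ
      total≡0′ = *-cancelˡ-pos {scale} scale>0 (trans (sym (∑-*ˡ scale _)) (trans (∑-cong (λ w → sym (trans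
        (cong₂ _*_ (M-sym η w u) (cong₂ _*_ (M-sym η w v) (M-sym γω w x)))
        (expansion (dist x w) (dist u w) (dist v w) (near xu w , near xv w , distinct u≢v , distinct (x≢ xu) , distinct (x≢ xv))))))
        (trans (krein₁₁₃-tight refl u v x) (sym (ℤ.*-zeroʳ scale)))))
        where
        distinct : ∀ {p q w} → p ≢ q → ¬ (dist p w ≡ 0F × dist q w ≡ 0F)
        distinct p≢q (pw , qw) = p≢q (trans (dist≡0⇒≡ pw) (sym (dist≡0⇒≡ qw)))
        x≢ : ∀ {p} → dist x p ≡ 1F → x ≢ p
        x≢ xp refl = contradiction (trans (sym xp) (dist-refl x)) λ ()
      vu : dist v u ≡ dist u v
      vu = dist-sym v u
      sums : ∑ (λ w → E (dist x w) (dist u w) (dist v w)) ≡ value (h (dist u v)) (Λ (e 1F) (dist u v)) (Λ (e 3F) (dist u v)) (common u v) (τ 3F (M (e 3F) v) u) (N₃ u v)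
      sums = trans (∑-linear₉ (+ 20) (ℤ.- + 12) (ℤ.- + 12) (+ 4) (ℤ.- + 12) (ℤ.- + 2) (ℤ.- + 2) (+ 1) (ℤ.- + 2)
          (λ w → e 0F (dist x w) * + 1) (λ w → e 0F (dist u w) * h (dist v w)) (λ w → e 0F (dist v w) * h (dist u w))
          (λ w → e 1F (dist u w) * e 1F (dist v w)) (λ w → e 1F (dist x w) * (e 1F (dist u w) * e 1F (dist v w)))
          (λ w → e 1F (dist u w) * e 3F (dist v w)) (λ w → e 1F (dist v w) * e 3F (dist u w))
          (λ w → e 3F (dist u w) * e 3F (dist v w)) (λ w → e 3F (dist x w) * (e 3F (dist u w) * e 3F (dist v w))))
        (value-sums (τ 3F (M (e 3F) v) u) (N₃ u v) (∑-e₀ (λ _ → + 1) x) (trans (∑-e₀ (λ w → h (dist v w)) u) (cong h vu)) (∑-e₀ (λ w → h (dist u w)) v)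
          (trans (sum-over-sphere (e 1F) v u) (cong (Λ (e 1F)) vu)) (trans (sum-over-sphere (e 3F) v u) (cong (Λ (e 3F)) vu))
          (sum-over-sphere (e 3F) u v) (common u v))

    χ-indicator : ∀ u z → Indicator (χ u z)
    χ-indicator u z = e-indicator 3F (dist u z)

    N₃-nonNeg : ∀ u v → ∃[ m ] N₃ u v ≡ + m
    N₃-nonNeg u v = nonNeg⇒natural (∑-nonNeg (λ z → indicator-nonNeg (indicator-* (e-indicator 3F (dist x z)) (indicator-* (χ-indicator u z) (χ-indicator v z)))))

    common-nonNeg : ∀ u v → ∃[ m ] common u v ≡ + m
    common-nonNeg u v = nonNeg⇒natural (∑-nonNeg (λ z → indicator-nonNeg (indicator-* (e-indicator 1F (dist x z)) (indicator-* (e-indicator 1F (dist u z)) (e-indicator 1F (dist v z))))))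

    τ₃₃≡16 : ∀ {u v} → dist u v ≡ 1F ⊎ dist u v ≡ 2F → τ 3F (M (e 3F) v) u ≡ + 16
    τ₃₃≡16 {u} {v} (inj₁ uv) = ℤ.*-cancelˡ-≡ (+ 56) (τ 3F (M (e 3F) v) u) (+ 16) (τ₃₃ 1F (trans (dist-sym v u) uv))
    τ₃₃≡16 {u} {v} (inj₂ uv) = ℤ.*-cancelˡ-≡ (+ 56) (τ 3F (M (e 3F) v) u) (+ 16) (τ₃₃ 2F (trans (dist-sym v u) uv))

    private
      toℕ-eq : ∀ k c m → + k - + 12 * + c - + 2 * + m ≡ 0ℤ → k ≡ 12 ℕ.* c ℕ.+ 2 ℕ.* m
      toℕ-eq k c m eq = ℤ.+-injective (begin
        + k                                                   ≡⟨ lemma (+ k) (+ 12 * + c) (+ 2 * + m) ⟩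
        (+ k - + 12 * + c - + 2 * + m) + (+ 12 * + c + + 2 * + m) ≡⟨ cong (_+ (+ 12 * + c + + 2 * + m)) eq ⟩
        0ℤ + (+ 12 * + c + + 2 * + m)                         ≡⟨ ℤ.+-identityˡ (+ 12 * + c + + 2 * + m) ⟩
        + 12 * + c + + 2 * + m                                ≡⟨ cong₂ _+_ (sym (ℤ.pos-* 12 c)) (sym (ℤ.pos-* 2 m)) ⟩
        + (12 ℕ.* c ℕ.+ 2 ℕ.* m)                              ∎)
        where
        open ≡-Reasoning
        lemma : ∀ k p q → k ≡ (k - p - q) + (p + q)
        lemma = ℤRing.solve-∀

      dist-≢ : ∀ {u v i} → dist u v ≡ suc i → u ≢ v
      dist-≢ uv refl = contradiction (trans (sym uv) (dist-refl _)) λ ()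

    -- Here `triple` reads 4 = 12 c + 2 m. In particular Γ(x) contains no triangle.
    adjacent-N₃ : ∀ {u v} → dist x u ≡ 1F → dist x v ≡ 1F → dist u v ≡ 1F → common u v ≡ + 0 × N₃ u v ≡ + 2
    adjacent-N₃ {u} {v} xu xv uv = from (common-nonNeg u v) (N₃-nonNeg u v)
      where
      from : (∃[ c ] common u v ≡ + c) → (∃[ m ] N₃ u v ≡ + m) → common u v ≡ + 0 × N₃ u v ≡ + 2
      from (c , c≡) (m , m≡) = trans c≡ (cong +_ (proj₁ solved)) , trans m≡ (cong +_ (proj₂ solved))
        where
        eq : value (+ 2) (+ 4) (+ 0) (+ c) (+ 16) (+ m) ≡ 0ℤ
        eq = subst₂ (λ p q → value (+ 2) (+ 4) (+ 0) p (+ 16) q ≡ 0ℤ) c≡ m≡ (subst₂ (λ i t → value (h i) (Λ (e 1F) i) (Λ (e 3F) i) (common u v) t (N₃ u v) ≡ 0ℤ)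
          uv (τ₃₃≡16 (inj₁ uv)) (triple xu xv (dist-≢ uv)))
        solved : c ≡ 0 × m ≡ 2
        solved = arith₁ c m (toℕ-eq 4 c m (trans (sym (value₁ (+ c) (+ m))) eq))

    -- Here `triple` reads 20 = 12 c + 2 m; c ≥ 2 would exceed the left side.
    nonadjacent-N₃ : ∀ {u v} → dist x u ≡ 1F → dist x v ≡ 1F → dist u v ≡ 2F →
      (common u v ≡ + 0 × N₃ u v ≡ + 10) ⊎ (common u v ≡ + 1 × N₃ u v ≡ + 4)
    nonadjacent-N₃ {u} {v} xu xv uv = from (common-nonNeg u v) (N₃-nonNeg u v)
      where
      from : (∃[ c ] common u v ≡ + c) → (∃[ m ] N₃ u v ≡ + m) →
        (common u v ≡ + 0 × N₃ u v ≡ + 10) ⊎ (common u v ≡ + 1 × N₃ u v ≡ + 4)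
      from (c , c≡) (m , m≡) = cases (arith₂ c m (toℕ-eq 20 c m (trans (sym (value₂ (+ c) (+ m))) eq)))
        where
        eq : value (+ 0) (+ 4) (+ 8) (+ c) (+ 16) (+ m) ≡ 0ℤ
        eq = subst₂ (λ p q → value (+ 0) (+ 4) (+ 8) p (+ 16) q ≡ 0ℤ) c≡ m≡ (subst₂ (λ i t → value (h i) (Λ (e 1F) i) (Λ (e 3F) i) (common u v) t (N₃ u v) ≡ 0ℤ)
          uv (τ₃₃≡16 (inj₂ uv)) (triple xu xv (dist-≢ uv)))
        cases : (c ≡ 0 × m ≡ 10) ⊎ (c ≡ 1 × m ≡ 4) → (common u v ≡ + 0 × N₃ u v ≡ + 10) ⊎ (common u v ≡ + 1 × N₃ u v ≡ + 4)
        cases (inj₁ (c≡0 , m≡10)) = inj₁ (trans c≡ (cong +_ c≡0) , trans m≡ (cong +_ m≡10))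
        cases (inj₂ (c≡1 , m≡4))  = inj₂ (trans c≡ (cong +_ c≡1) , trans m≡ (cong +_ m≡4))

    indicator-idem : ∀ {i} → Indicator i → i * i ≡ i
    indicator-idem (inj₁ refl) = refl
    indicator-idem (inj₂ refl) = refl

    blocks-through : ∀ {u} → dist x u ≡ 1F → ∑ (λ z → e 3F (dist x z) * χ u z) ≡ + 16
    blocks-through {u} xu = trans (∑-cong (λ z → ℤ.*-comm (e 3F (dist x z)) (χ u z))) (τ₃₃≡16 (inj₁ (trans (dist-sym u x) xu)))

    N₃-refl : ∀ {u} → dist x u ≡ 1F → N₃ u u ≡ + 16
    N₃-refl {u} xu = trans (∑-cong (λ z → cong (e 3F (dist x z) *_) (indicator-idem (χ-indicator u z)))) (blocks-through xu)

    N₃-sym : ∀ u v → N₃ u v ≡ N₃ v u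
    N₃-sym u v = ∑-cong (λ z → cong (e 3F (dist x z) *_) (ℤ.*-comm (χ u z) (χ v z)))

    near-V : ∀ {u v} → dist x u ≡ 1F → dist x v ≡ 1F → dist u v ≢ 3F
    near-V {u} {v} xu xv uv = contradiction (subst₂ (λ i j → toℕ i ℕ.≤ suc (toℕ j)) uv (trans (dist-sym u x) xu) (dist-step u (dist≡1⇒adj xv)))
      λ { (s≤s (s≤s ())) }

    Θ : Fin n → Fin n → ℤ
    Θ u v = [ does (N₃ u v ℤ.≟ + 10) ]

    Θ-indicator : ∀ u v → Indicator (Θ u v)
    Θ-indicator u v with N₃ u v ℤ.≟ + 10
    ... | yes _ = inj₂ refl
    ... | no  _ = inj₁ refl

    Θ≡1 : ∀ {u v} → N₃ u v ≡ + 10 → Θ u v ≡ + 1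
    Θ≡1 {u} {v} eq = cong [_] (dec-true (N₃ u v ℤ.≟ + 10) eq)

    Θ≡0 : ∀ {u v m} → N₃ u v ≡ + m → m ≢ 10 → Θ u v ≡ + 0
    Θ≡0 {u} {v} eq m≢10 = cong [_] (dec-false (N₃ u v ℤ.≟ + 10) (λ eq′ → m≢10 (ℤ.+-injective (trans (sym eq) eq′))))

    Θ-sym : ∀ u v → Θ u v ≡ Θ v u
    Θ-sym u v = cong (λ m → [ does (m ℤ.≟ + 10) ]) (N₃-sym u v)

    ϑ : Fin n → Fin n → ℤ
    ϑ u v = σ v * Θ u v

    σ-indicator : ∀ v → Indicator (σ v)
    σ-indicator v = e-indicator 1F (dist x v)

    ϑ-indicator : ∀ u v → Indicator (ϑ u v)
    ϑ-indicator u v = indicator-* (σ-indicator v) (Θ-indicator u v)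

    σ≡1⇒ : ∀ {v} → σ v ≡ + 1 → dist x v ≡ 1F
    σ≡1⇒ {v} eq with dist x v Fin.≟ 1F
    ... | yes xv = xv
    ... | no  ≢1 = contradiction (trans (sym eq) (e≡0 ≢1)) λ ()

    -- ϑ u v = 1 exactly when v is at distance 2 from u and they have no common
    -- neighbour in Γ(x).
    record Far (u v : Fin n) : Set where
      field
        xv       : dist x v ≡ 1F
        uv       : dist u v ≡ 2F
        N₃≡10    : N₃ u v ≡ + 10
        common≡0 : common u v ≡ + 0

    far : ∀ {u v} → dist x u ≡ 1F → ϑ u v ≡ + 1 → Far u v
    far {u} {v} xu ϑ≡1 = record { xv = xv ; uv = proj₁ rest ; N₃≡10 = N₃≡10 ; common≡0 = proj₂ rest }
      where
      split : ∀ {i j} → Indicator i → Indicator j → i * j ≡ + 1 → i ≡ + 1 × j ≡ + 1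
      split (inj₁ refl) _ ()
      split (inj₂ refl) (inj₁ refl) ()
      split (inj₂ refl) (inj₂ refl) _ = refl , refl
      both : σ v ≡ + 1 × Θ u v ≡ + 1
      both = split (σ-indicator v) (Θ-indicator u v) ϑ≡1
      xv : dist x v ≡ 1F
      xv = σ≡1⇒ (proj₁ both)
      N₃≡10 : N₃ u v ≡ + 10
      N₃≡10 = holds (N₃ u v ℤ.≟ + 10) (proj₂ both)
        where
        holds : ∀ {P : Set} (d : Dec P) → [ does d ] ≡ + 1 → P
        holds (yes p) _ = p
        holds (no _)  ()
      rest : dist u v ≡ 2F × common u v ≡ + 0
      rest = by (dist u v) refl
        where
        by : ∀ i → dist u v ≡ i → dist u v ≡ 2F × common u v ≡ + 0
        by 0F eq = contradiction (trans (sym N₃≡10) (trans (cong (N₃ u) (sym (dist≡0⇒≡ eq))) (N₃-refl xu))) λ ()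
        by 1F eq = contradiction (trans (sym N₃≡10) (proj₂ (adjacent-N₃ xu xv eq))) λ ()
        by 2F eq = cases (nonadjacent-N₃ xu xv eq)
          where
          cases : (common u v ≡ + 0 × N₃ u v ≡ + 10) ⊎ (common u v ≡ + 1 × N₃ u v ≡ + 4) → dist u v ≡ 2F × common u v ≡ + 0
          cases (inj₁ (c≡0 , _)) = eq , c≡0
          cases (inj₂ (_ , m≡4)) = contradiction (trans (sym N₃≡10) m≡4) λ ()
        by 3F eq = contradiction eq (near-V xu xv)

    -- Each of the 16 blocks through u has a₃ = 7 points.
    ∑-σ-N₃ : ∀ {u} → dist x u ≡ 1F → ∑ (λ v → σ v * N₃ u v) ≡ + 112
    ∑-σ-N₃ {u} xu = begin
      ∑ (λ v → σ v * N₃ u v)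
        ≡⟨ ∑-cong (λ v → trans (sym (∑-*ˡ (σ v) _)) (∑-cong (λ z → lemma (σ v) (e 3F (dist x z)) (χ u z) (χ v z)))) ⟩
      ∑ (λ v → ∑ (λ z → (e 3F (dist x z) * χ u z) * (σ v * χ v z)))
        ≡⟨ ∑-swap _ ⟩
      ∑ (λ z → ∑ (λ v → (e 3F (dist x z) * χ u z) * (σ v * χ v z)))
        ≡⟨ ∑-cong (λ z → trans (∑-*ˡ (e 3F (dist x z) * χ u z) _) (trans (cong (e 3F (dist x z) * χ u z *_) (block-sum z)) (at (dist x z) (χ u z)))) ⟩
      ∑ (λ z → (e 3F (dist x z) * χ u z) * + 7)
        ≡⟨ ∑-*ʳ (+ 7) _ ⟩
      ∑ (λ z → e 3F (dist x z) * χ u z) * + 7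
        ≡⟨ cong (_* + 7) (blocks-through xu) ⟩
      + 112 ∎
      where
      open ≡-Reasoning
      lemma : ∀ s w p q → s * (w * (p * q)) ≡ (w * p) * (s * q)
      lemma = ℤRing.solve-∀
      block-sum : ∀ z → ∑ (λ v → σ v * χ v z) ≡ Λ (e 3F) (dist x z)
      block-sum z = trans (∑-cong (λ v → cong (λ i → σ v * e 3F i) (dist-sym v z))) (trans (sum-over-sphere (e 3F) z x) (cong (Λ (e 3F)) (dist-sym z x)))
      at : ∀ i c → e 3F i * c * Λ (e 3F) i ≡ e 3F i * c * + 7
      at 0F c = trans (cong (_* Λ (e 3F) 0F) (ℤ.*-zeroˡ c)) (sym (cong (_* + 7) (ℤ.*-zeroˡ c)))
      at 1F c = trans (cong (_* Λ (e 3F) 1F) (ℤ.*-zeroˡ c)) (sym (cong (_* + 7) (ℤ.*-zeroˡ c)))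
      at 2F c = trans (cong (_* Λ (e 3F) 2F) (ℤ.*-zeroˡ c)) (sym (cong (_* + 7) (ℤ.*-zeroˡ c)))
      at 3F c = refl

    -- The total 112 consists of 16 for v = u, 2 for each of the 4 neighbours of u in Γ(x), 4 for
    -- each of the other 16 vertices, and 6 more for each related v. So 112 = 88 + 6 * 4.
    ∑-ϑ : ∀ {u} → dist x u ≡ 1F → ∑ (ϑ u) ≡ + 4
    ∑-ϑ {u} xu = ℤ.*-cancelˡ-≡ (+ 6) (∑ (ϑ u)) (+ 4) (+-cancelˡ (+ 88) (+ 6 * ∑ (ϑ u)) (+ 24) (begin
      + 88 + + 6 * ∑ (ϑ u)
        ≡⟨ cong₂ _+_ (sym (trans (sum-over-sphere f u x) (cong (Λ f) (trans (dist-sym u x) xu)))) (sym (∑-*ˡ (+ 6) (ϑ u))) ⟩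
      ∑ (λ v → σ v * f (dist u v)) + ∑ (λ v → + 6 * ϑ u v)
        ≡⟨ ∑-+ _ _ ⟨
      ∑ (λ v → σ v * f (dist u v) + + 6 * ϑ u v)
        ≡⟨ ∑-cong (λ v → by v (σ-indicator v)) ⟨
      ∑ (λ v → σ v * N₃ u v)
        ≡⟨ ∑-σ-N₃ xu ⟩
      + 112 ∎))
      where
      open ≡-Reasoning
      f : Fin 4 → ℤ
      f 0F = + 16
      f 1F = + 2
      f 2F = + 4
      f 3F = + 0
      by : ∀ v → Indicator (σ v) → σ v * N₃ u v ≡ σ v * f (dist u v) + + 6 * ϑ u v
      by v (inj₁ σ≡0) = subst (λ s → s * N₃ u v ≡ s * f (dist u v) + + 6 * (s * Θ u v)) (sym σ≡0)
        (trans (ℤ.*-zeroˡ (N₃ u v)) (sym (cong₂ (λ p q → p + + 6 * q) (ℤ.*-zeroˡ (f (dist u v))) (ℤ.*-zeroˡ (Θ u v)))))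
      by v (inj₂ σ≡1) = subst (λ s → s * N₃ u v ≡ s * f (dist u v) + + 6 * (s * Θ u v)) (sym σ≡1)
        (at (dist u v) refl)
        where
        xv : dist x v ≡ 1F
        xv = σ≡1⇒ σ≡1
        close : ∀ {i m t} → dist u v ≡ i → N₃ u v ≡ m → Θ u v ≡ t → + 1 * m ≡ + 1 * f i + + 6 * (+ 1 * t) →
          + 1 * N₃ u v ≡ + 1 * f (dist u v) + + 6 * (+ 1 * Θ u v)
        close refl refl refl eq = eq
        at : ∀ i → dist u v ≡ i → + 1 * N₃ u v ≡ + 1 * f (dist u v) + + 6 * (+ 1 * Θ u v)
        at 0F eq = close eq N₃≡16 (Θ≡0 N₃≡16 λ ()) refl
          where
          N₃≡16 : N₃ u v ≡ + 16
          N₃≡16 = trans (cong (N₃ u) (sym (dist≡0⇒≡ eq))) (N₃-refl xu)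
        at 1F eq = let N₃≡2 = proj₂ (adjacent-N₃ xu xv eq) in close eq N₃≡2 (Θ≡0 N₃≡2 λ ()) refl
        at 2F eq = cases (nonadjacent-N₃ xu xv eq)
          where
          cases : (common u v ≡ + 0 × N₃ u v ≡ + 10) ⊎ (common u v ≡ + 1 × N₃ u v ≡ + 4) → _
          cases (inj₁ (_ , m≡)) = close eq m≡ (Θ≡1 m≡) refl
          cases (inj₂ (_ , m≡)) = close eq m≡ (Θ≡0 m≡ λ ()) refl
        at 3F eq = contradiction eq (near-V xu xv)

-- The four vertices related to a given one

bit : ∀ {i} → Indicator i → ∃[ b ] i ≡ + toℕ {2} b
bit (inj₁ refl) = 0F , refl
bit (inj₂ refl) = 1F , refl

private
  four-bits : ∀ (a b c d : Fin 2) → toℕ a ℕ.+ toℕ b ℕ.+ toℕ c ℕ.+ toℕ d ℕ.≤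
    toℕ a ℕ.* toℕ b ℕ.+ toℕ a ℕ.* toℕ c ℕ.+ toℕ a ℕ.* toℕ d ℕ.+ toℕ b ℕ.* toℕ c ℕ.+ toℕ b ℕ.* toℕ d ℕ.+ toℕ c ℕ.* toℕ d ℕ.+ 1
  four-bits = toWitness {a? = Fin.all? λ a → Fin.all? λ b → Fin.all? λ c → Fin.all? λ d → _ ℕ.≤? _} tt

-- If j of the four are 1, the claim is j ≤ j (j - 1) / 2 + 1.
indicators-≤-pairs+1 : ∀ {a b c d} → Indicator a → Indicator b → Indicator c → Indicator d →
  a + b + c + d ≤ a * b + a * c + a * d + b * c + b * d + c * d + + 1
indicators-≤-pairs+1 ia ib ic id with bit ia | bit ib | bit ic | bit id
... | a , refl | b , refl | c , refl | d , refl = ℤ.≤-trans (ℤ.+≤+ (four-bits a b c d))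
  (ℤ.≤-reflexive (cong (_+ + 1) (cong₂ _+_ (cong₂ _+_ (cong₂ _+_ (cong₂ _+_ (cong₂ _+_
    (ℤ.pos-* (toℕ a) (toℕ b)) (ℤ.pos-* (toℕ a) (toℕ c))) (ℤ.pos-* (toℕ a) (toℕ d))) (ℤ.pos-* (toℕ b) (toℕ c)))
    (ℤ.pos-* (toℕ b) (toℕ d))) (ℤ.pos-* (toℕ c) (toℕ d)))))

three-indicators : ∀ {a b c} → Indicator a → Indicator b → Indicator c → a + b + c ≤ + 1 + (a * b + a * c + b * c)
three-indicators (inj₁ refl) (inj₁ refl) (inj₁ refl) = ℤ.+≤+ z≤n
three-indicators (inj₁ refl) (inj₁ refl) (inj₂ refl) = ℤ.≤-refl
three-indicators (inj₁ refl) (inj₂ refl) (inj₁ refl) = ℤ.≤-refl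
three-indicators (inj₁ refl) (inj₂ refl) (inj₂ refl) = ℤ.≤-refl
three-indicators (inj₂ refl) (inj₁ refl) (inj₁ refl) = ℤ.≤-refl
three-indicators (inj₂ refl) (inj₁ refl) (inj₂ refl) = ℤ.≤-refl
three-indicators (inj₂ refl) (inj₂ refl) (inj₁ refl) = ℤ.≤-refl
three-indicators (inj₂ refl) (inj₂ refl) (inj₂ refl) = ℤ.+≤+ (s≤s (s≤s (s≤s z≤n)))

Matching : (ab ac ad bc bd cd : Fin 2) → Set
Matching ab ac ad bc bd cd =
  (ab ≡ 0F × cd ≡ 0F × ac ≡ 1F × ad ≡ 1F × bc ≡ 1F × bd ≡ 1F) ⊎
  (ac ≡ 0F × bd ≡ 0F × ab ≡ 1F × ad ≡ 1F × bc ≡ 1F × cd ≡ 1F) ⊎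
  (ad ≡ 0F × bc ≡ 0F × ab ≡ 1F × ac ≡ 1F × bd ≡ 1F × cd ≡ 1F)

-- Pairs of a four-element set, labelled by 0 and 1 with at least four ones and
-- no triangle of ones: the zeros form a perfect matching.
matching : ∀ (ab ac ad bc bd cd : Fin 2) →
  ¬ (ab ≡ 1F × ac ≡ 1F × bc ≡ 1F) × ¬ (ab ≡ 1F × ad ≡ 1F × bd ≡ 1F) × ¬ (ac ≡ 1F × ad ≡ 1F × cd ≡ 1F) × ¬ (bc ≡ 1F × bd ≡ 1F × cd ≡ 1F) ×
  4 ℕ.≤ toℕ ab ℕ.+ toℕ ac ℕ.+ toℕ ad ℕ.+ toℕ bc ℕ.+ toℕ bd ℕ.+ toℕ cd →
  Matching ab ac ad bc bd cd
matching = toWitness {a? = Fin.all? λ ab → Fin.all? λ ac → Fin.all? λ ad → Fin.all? λ bc → Fin.all? λ bd → Fin.all? λ cd →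
  ((¬? (is1 ab ×-dec is1 ac ×-dec is1 bc)) ×-dec (¬? (is1 ab ×-dec is1 ad ×-dec is1 bd)) ×-dec (¬? (is1 ac ×-dec is1 ad ×-dec is1 cd)) ×-dec
   (¬? (is1 bc ×-dec is1 bd ×-dec is1 cd)) ×-dec (4 ℕ.≤? (toℕ ab ℕ.+ toℕ ac ℕ.+ toℕ ad ℕ.+ toℕ bc ℕ.+ toℕ bd ℕ.+ toℕ cd)))
  →-dec ((is0 ab ×-dec is0 cd ×-dec is1 ac ×-dec is1 ad ×-dec is1 bc ×-dec is1 bd) ⊎-dec
         (is0 ac ×-dec is0 bd ×-dec is1 ab ×-dec is1 ad ×-dec is1 bc ×-dec is1 cd) ⊎-dec
         (is0 ad ×-dec is0 bc ×-dec is1 ab ×-dec is1 ac ×-dec is1 bd ×-dec is1 cd))} tt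
  where
  is0 : ∀ (i : Fin 2) → Dec (i ≡ 0F)
  is0 i = i Fin.≟ 0F
  is1 : ∀ (i : Fin 2) → Dec (i ≡ 1F)
  is1 i = i Fin.≟ 1F

∑-+₃ : ∀ {n} (f g h : Fin n → ℤ) → ∑ (λ i → f i + g i + h i) ≡ ∑ f + ∑ g + ∑ h
∑-+₃ f g h = trans (∑-+ _ h) (cong (_+ ∑ h) (∑-+ f g))

∑-+₄ : ∀ {n} (f g h k : Fin n → ℤ) → ∑ (λ i → f i + g i + h i + k i) ≡ ∑ f + ∑ g + ∑ h + ∑ k
∑-+₄ f g h k = trans (∑-+ _ k) (cong (_+ ∑ k) (∑-+₃ f g h))

module Configuration {n} (Γ : Graph n) (G : DistanceRegular Γ 3) (H : HasArray G 7 8 4) where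
  open Distance Γ G
  open ArrayInteger Γ G H
  open Coclique Γ G H
  open Counting ℤ-domain using (e)
  open Exclusion Γ G H

  module AtVertex (x : Fin n) where
    open Local x

    w : Fin n → Fin n → ℤ
    w u z = e 3F (dist x z) * χ u z

    w-indicator : ∀ u z → Indicator (w u z)
    w-indicator u z = indicator-* (e-indicator 3F (dist x z)) (χ-indicator u z)

    N₄ : Fin n → Fin n → Fin n → ℤ
    N₄ u v v′ = ∑ (λ z → w u z * (χ v z * χ v′ z))

    N₃≡∑w : ∀ u v → N₃ u v ≡ ∑ (λ z → w u z * χ v z)
    N₃≡∑w u v = ∑-cong (λ z → sym (ℤ.*-assoc (e 3F (dist x z)) (χ u z) (χ v z)))

    N₄≤N₃ : ∀ u v v′ → N₄ u v v′ ≤ N₃ v v′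
    N₄≤N₃ u v v′ = ∑-mono (λ z → drop (e-indicator 3F (dist x z)) (χ-indicator u z) (indicator-* (χ-indicator v z) (χ-indicator v′ z)))
      where
      drop : ∀ {i j k} → Indicator i → Indicator j → Indicator k → i * j * k ≤ i * k
      drop (inj₁ refl) _           _           = ℤ.≤-refl
      drop (inj₂ refl) (inj₁ refl) ik          = subst (0ℤ ≤_) (sym (ℤ.*-identityˡ _)) (indicator-nonNeg ik)
      drop (inj₂ refl) (inj₂ refl) _           = ℤ.≤-refl

    miss : Fin n → Fin n → Fin n → Fin n → ℤ
    miss u v v′ z = w u z * ((+ 1 - χ v z) * (+ 1 - χ v′ z))

    miss-nonNeg : ∀ u v v′ z → 0ℤ ≤ miss u v v′ z
    miss-nonNeg u v v′ z = indicator-nonNeg (indicator-* (w-indicator u z) (indicator-* (flip (χ-indicator v z)) (flip (χ-indicator v′ z))))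
      where
      flip : ∀ {i} → Indicator i → Indicator (+ 1 - i)
      flip (inj₁ refl) = inj₂ refl
      flip (inj₂ refl) = inj₁ refl

    module _ {u} (xu : dist x u ≡ 1F) where
      ∑w : ∑ (w u) ≡ + 16
      ∑w = blocks-through xu

      ∑w·χ : ∀ {v} → Far u v → ∑ (λ z → w u z * χ v z) ≡ + 10
      ∑w·χ {v} uv = trans (sym (N₃≡∑w u v)) (Far.N₃≡10 uv)

      -- Inclusion and exclusion over the 16 blocks through u, of which 10 contain v and 10 contain
      -- v′: exactly 16 - 10 - 10 + `N₄ u v v′` contain neither.
      ∑-miss : ∀ {v v′} → Far u v → Far u v′ → ∑ (miss u v v′) + + 4 ≡ N₄ u v v′
      ∑-miss {v} {v′} uv uv′ = begin
        ∑ (miss u v v′) + + 4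
          ≡⟨ cong (_+ + 4) (trans (∑-cong (λ z → lemma (w u z) (χ v z) (χ v′ z)))
               (trans (∑-- (λ z → w u z + w u z * (χ v z * χ v′ z)) (λ z → w u z * χ v z + w u z * χ v′ z)) (cong₂ _-_ (∑-+ _ _) (∑-+ _ _)))) ⟩
        (∑ (w u) + N₄ u v v′) - (∑ (λ z → w u z * χ v z) + ∑ (λ z → w u z * χ v′ z)) + + 4
          ≡⟨ cong₂ (λ p q → p - q + + 4) (cong (_+ N₄ u v v′) ∑w) (cong₂ _+_ (∑w·χ uv) (∑w·χ uv′)) ⟩
        (+ 16 + N₄ u v v′) - + 20 + + 4
          ≡⟨ lemma′ (N₄ u v v′) ⟩
        N₄ u v v′ ∎
        where
        open ≡-Reasoning
        lemma : ∀ w p q → w * ((+ 1 - p) * (+ 1 - q)) ≡ (w + w * (p * q)) - (w * p + w * q)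
        lemma = ℤRing.solve-∀
        lemma′ : ∀ s → (+ 16 + s) - + 20 + + 4 ≡ s
        lemma′ = ℤRing.solve-∀

      -- Since adjacent vertices have N₃ = 2, this shows that two vertices related to u are never
      -- adjacent.
      4≤N₃ : ∀ {v v′} → Far u v → Far u v′ → + 4 ≤ N₃ v v′
      4≤N₃ {v} {v′} uv uv′ = ℤ.≤-trans (subst (+ 4 ≤_) (∑-miss uv uv′) (ℤ.+-monoˡ-≤ (+ 4) (∑-nonNeg (miss-nonNeg u v v′)))) (N₄≤N₃ u v v′)

      -- At most four blocks contain u, v and v′, so by `∑-miss` no block through u avoids both v
      -- and v′.
      miss≡0 : ∀ {v v′} → Far u v → Far u v′ → N₃ v v′ ≡ + 4 → ∀ z → miss u v v′ z ≡ 0ℤ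
      miss≡0 {v} {v′} uv uv′ N≡4 = ∑-nonNeg≡0 (miss-nonNeg u v v′) (ℤ.≤-antisym
        (+-cancelʳ-≤ (∑ (miss u v v′)) (subst₂ _≤_ (sym (∑-miss uv uv′)) N≡4 (N₄≤N₃ u v v′))) (∑-nonNeg (miss-nonNeg u v v′)))
        where
        +-cancelʳ-≤ : ∀ i → i + + 4 ≤ + 4 → i ≤ 0ℤ
        +-cancelʳ-≤ i i+4≤4 = subst (_≤ 0ℤ) (lemma i) (ℤ.+-monoˡ-≤ (ℤ.- + 4) i+4≤4)
          where
          lemma : ∀ i → i + + 4 + ℤ.- + 4 ≡ i
          lemma = ℤRing.solve-∀

      size : Fin 2 → ℤ
      size 0F = + 10
      size 1F = + 4

      record Pair (v v′ : Fin n) (k : Fin 2) : Set where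
        field
          common≡ : common v v′ ≡ + toℕ k
          N₃≡     : N₃ v v′ ≡ size k
          vv′     : dist v v′ ≡ 2F

      classify : ∀ {v v′} → Far u v → Far u v′ → v ≢ v′ → ∃[ k ] Pair v v′ k
      classify {v} {v′} uv uv′ v≢v′ = by (dist v v′) refl
        where
        by : ∀ i → dist v v′ ≡ i → ∃[ k ] Pair v v′ k
        by 0F eq = contradiction (dist≡0⇒≡ eq) v≢v′
        by 1F eq = contradiction (subst (+ 4 ≤_) (proj₂ (adjacent-N₃ (Far.xv uv) (Far.xv uv′) eq)) (4≤N₃ uv uv′))
          λ { (ℤ.+≤+ (s≤s (s≤s ()))) }
        by 2F eq = cases (nonadjacent-N₃ (Far.xv uv) (Far.xv uv′) eq)
          where
          cases : (common v v′ ≡ + 0 × N₃ v v′ ≡ + 10) ⊎ (common v v′ ≡ + 1 × N₃ v v′ ≡ + 4) → ∃[ k ] Pair v v′ k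
          cases (inj₁ (c , m)) = 0F , record { common≡ = c ; N₃≡ = m ; vv′ = eq }
          cases (inj₂ (c , m)) = 1F , record { common≡ = c ; N₃≡ = m ; vv′ = eq }
        by 3F eq = contradiction eq (near-V (Far.xv uv) (Far.xv uv′))

      -- There are 30 incidences of a, b, c with the 16 blocks through u. A block with j of them
      -- contains at least j - 1 pairs, and each pair lies in at most 4 of these blocks, so there
      -- are at most 16 + 12 = 28 incidences.
      no-triangle : ∀ {a b c} → Far u a → Far u b → Far u c → N₃ a b ≡ + 4 → N₃ a c ≡ + 4 → N₃ b c ≡ + 4 → ⊥
      no-triangle {a} {b} {c} ua ub uc ab ac bc = 30≰28 (ℤ.≤-trans (subst₂ _≤_ left right (∑-mono pointwise))
        (ℤ.+-monoʳ-≤ (+ 16) (ℤ.+-mono-≤ (ℤ.+-mono-≤ (bound ab) (bound ac)) (bound bc))))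
        where
        30≰28 : ¬ (+ 30 ≤ + 28)
        30≰28 (ℤ.+≤+ le) = ℕ.<⇒≱ (ℕ.n<1+n 28) (ℕ.≤-trans (ℕ.n≤1+n 29) le)
        bound : ∀ {v v′} → N₃ v v′ ≡ + 4 → N₄ u v v′ ≤ + 4
        bound {v} {v′} N≡4 = subst (N₄ u v v′ ≤_) N≡4 (N₄≤N₃ u v v′)
        pointwise : ∀ z → w u z * χ a z + w u z * χ b z + w u z * χ c z ≤
          w u z + (w u z * (χ a z * χ b z) + w u z * (χ a z * χ c z) + w u z * (χ b z * χ c z))
        pointwise z = subst₂ _≤_ (lemma (w u z) (χ a z) (χ b z) (χ c z)) (lemma′ (w u z) (χ a z) (χ b z) (χ c z))
          (scaled (w-indicator u z) (three-indicators (χ-indicator a z) (χ-indicator b z) (χ-indicator c z)))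
          where
          scaled : ∀ {i j k} → Indicator i → j ≤ k → i * j ≤ i * k
          scaled (inj₁ refl) _  = ℤ.≤-refl
          scaled {j = j} {k} (inj₂ refl) le = subst₂ _≤_ (sym (ℤ.*-identityˡ j)) (sym (ℤ.*-identityˡ k)) le
          lemma : ∀ w a b c → w * (a + b + c) ≡ w * a + w * b + w * c
          lemma = ℤRing.solve-∀
          lemma′ : ∀ w a b c → w * (+ 1 + (a * b + a * c + b * c)) ≡ w + (w * (a * b) + w * (a * c) + w * (b * c))
          lemma′ = ℤRing.solve-∀
        left : ∑ (λ z → w u z * χ a z + w u z * χ b z + w u z * χ c z) ≡ + 30
        left = trans (∑-+₃ _ _ _) (cong₂ _+_ (cong₂ _+_ (∑w·χ ua) (∑w·χ ub)) (∑w·χ uc))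
        right : ∑ (λ z → w u z + (w u z * (χ a z * χ b z) + w u z * (χ a z * χ c z) + w u z * (χ b z * χ c z))) ≡ + 16 + (N₄ u a b + N₄ u a c + N₄ u b c)
        right = trans (∑-+ _ _) (cong₂ _+_ ∑w (∑-+₃ _ _ _))

      -- Each of a, b, c, d has four neighbours in Γ(x), all among the twelve
      -- vertices of Γ(x) having exactly one common neighbour with u there.
      many-common : ∀ {a b c d} → Far u a → Far u b → Far u c → Far u d →
        + 16 ≤ (common a b + common a c + common a d) + (common b c + common b d + common c d) + + 12
      many-common {a} {b} {c} {d} ua ub uc ud = subst₂ _≤_ left right (∑-mono pointwise)
        where
        ε : Fin n → Fin n → ℤ
        ε v p = e 1F (dist v p)
        -- The 16 - 4 = 12 vertices of Γ(x) at distance 2 from u that are not related to u.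
        κ : Fin n → ℤ
        κ p = σ p * e 2F (dist u p) - ϑ u p * + 1
        degree-in : ∀ {v} → Far u v → ∑ (λ p → σ p * ε v p) ≡ + 4
        degree-in {v} uv = trans (sum-over-sphere (e 1F) v x) (cong (Λ (e 1F)) (trans (dist-sym v x) (Far.xv uv)))
        left : ∑ (λ p → σ p * ε a p + σ p * ε b p + σ p * ε c p + σ p * ε d p) ≡ + 16
        left = trans (∑-+₄ _ _ _ _) (cong₂ _+_ (cong₂ _+_ (cong₂ _+_ (degree-in ua) (degree-in ub)) (degree-in uc)) (degree-in ud))
        ∑κ : ∑ κ ≡ + 12
        ∑κ = trans (∑-- _ _) (cong₂ _-_ (trans (sum-over-sphere (e 2F) u x) (cong (Λ (e 2F)) (trans (dist-sym u x) xu)))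
          (trans (∑-cong (λ p → ℤ.*-identityʳ (ϑ u p))) (∑-ϑ xu)))
        right : ∑ (λ p → (σ p * (ε a p * ε b p) + σ p * (ε a p * ε c p) + σ p * (ε a p * ε d p)) +
          (σ p * (ε b p * ε c p) + σ p * (ε b p * ε d p) + σ p * (ε c p * ε d p)) + κ p) ≡
          (common a b + common a c + common a d) + (common b c + common b d + common c d) + + 12
        right = trans (∑-+₃ _ _ _) (cong₂ _+_ (cong₂ _+_ (∑-+₃ _ _ _) (∑-+₃ _ _ _)) ∑κ)
        pointwise : ∀ p → σ p * ε a p + σ p * ε b p + σ p * ε c p + σ p * ε d p ≤
          (σ p * (ε a p * ε b p) + σ p * (ε a p * ε c p) + σ p * (ε a p * ε d p)) +
          (σ p * (ε b p * ε c p) + σ p * (ε b p * ε d p) + σ p * (ε c p * ε d p)) + κ p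
        pointwise p = by-σ (σ-indicator p)
          where
          Goal : ℤ → ℤ → Set
          Goal s k = s * ε a p + s * ε b p + s * ε c p + s * ε d p ≤
            (s * (ε a p * ε b p) + s * (ε a p * ε c p) + s * (ε a p * ε d p)) +
            (s * (ε b p * ε c p) + s * (ε b p * ε d p) + s * (ε c p * ε d p)) + k
          inside : ∀ s → s ≡ + 1 → ∀ k → k ≡ + 1 → Goal s k
          inside s refl k refl = subst₂ _≤_ (lemma (ε a p) (ε b p) (ε c p) (ε d p)) (lemma′ (ε a p) (ε b p) (ε c p) (ε d p))
            (indicators-≤-pairs+1 (e-indicator 1F (dist a p)) (e-indicator 1F (dist b p)) (e-indicator 1F (dist c p)) (e-indicator 1F (dist d p)))
            where
            lemma : ∀ a b c d → a + b + c + d ≡ + 1 * a + + 1 * b + + 1 * c + + 1 * d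
            lemma = ℤRing.solve-∀
            lemma′ : ∀ a b c d → a * b + a * c + a * d + b * c + b * d + c * d + + 1 ≡
              (+ 1 * (a * b) + + 1 * (a * c) + + 1 * (a * d)) + (+ 1 * (b * c) + + 1 * (b * d) + + 1 * (c * d)) + + 1
            lemma′ = ℤRing.solve-∀
          vanish : ∀ s k → k ≡ + 0 → s * ε a p ≡ 0ℤ → s * ε b p ≡ 0ℤ → s * ε c p ≡ 0ℤ → s * ε d p ≡ 0ℤ → Goal s k
          vanish s k refl za zb zc zd = ℤ.≤-reflexive (trans
            (cong₂ _+_ (cong₂ _+_ (cong₂ _+_ za zb) zc) zd)
            (sym (cong (_+ + 0) (cong₂ _+_
              (cong₂ _+_ (cong₂ _+_ (pull (ε a p) (ε b p) za) (pull (ε a p) (ε c p) za)) (pull (ε a p) (ε d p) za))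
              (cong₂ _+_ (cong₂ _+_ (pull (ε b p) (ε c p) zb) (pull (ε b p) (ε d p) zb)) (pull (ε c p) (ε d p) zc))))))
            where
            pull : ∀ i j → s * i ≡ 0ℤ → s * (i * j) ≡ 0ℤ
            pull i j si≡0 = trans (sym (ℤ.*-assoc s i j)) (trans (cong (_* j) si≡0) (ℤ.*-zeroˡ j))
          by-σ : Indicator (σ p) → Goal (σ p) (κ p)
          by-σ (inj₁ σ≡0) = vanish (σ p) (κ p)
            (cong₂ _-_ (trans (cong (_* e 2F (dist u p)) σ≡0) (ℤ.*-zeroˡ (e 2F (dist u p))))
              (trans (cong (λ s → s * Θ u p * + 1) σ≡0) (trans (cong (_* + 1) (ℤ.*-zeroˡ (Θ u p))) refl)))
            (z (ε a p)) (z (ε b p)) (z (ε c p)) (z (ε d p))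
            where
            z : ∀ i → σ p * i ≡ 0ℤ
            z i = trans (cong (_* i) σ≡0) (ℤ.*-zeroˡ i)
          by-σ (inj₂ σ≡1) = by-dist (dist u p) refl
            where
            xp : dist x p ≡ 1F
            xp = σ≡1⇒ σ≡1
            kappa : ∀ {i t} → dist u p ≡ i → Θ u p ≡ t → κ p ≡ + 1 * e 2F i - + 1 * t * + 1
            kappa refl refl = cong (λ s → s * e 2F (dist u p) - s * Θ u p * + 1) σ≡1
            none : κ p ≡ + 0 → (∀ {v} → Far u v → dist v p ≢ 1F) → Goal (σ p) (κ p)
            none κ≡0 apart = vanish (σ p) (κ p) κ≡0 (z ua) (z ub) (z uc) (z ud)
              where
              z : ∀ {v} → Far u v → σ p * ε v p ≡ 0ℤ
              z {v} uv = trans (cong (σ p *_) (e≡0 (apart uv))) (ℤ.*-zeroʳ (σ p))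
            -- A vertex of Γ(x) where κ vanishes is u, a neighbour of u, or related to u. In each
            -- case it is adjacent to none of a, b, c, d.
            by-dist : ∀ i → dist u p ≡ i → Goal (σ p) (κ p)
            by-dist 0F up = none (kappa up (Θ≡0 (trans (cong (N₃ u) (sym (dist≡0⇒≡ up))) (N₃-refl xu)) λ ()))
              λ {v} uv vp → contradiction (trans (sym (Far.uv uv)) (trans (cong (λ q → dist q v) (dist≡0⇒≡ up)) (trans (dist-sym p v) vp))) λ ()
            by-dist 1F up = none (kappa up (Θ≡0 (proj₂ (adjacent-N₃ xu xp up)) λ ()))
              λ {v} uv vp → contradiction
                (trans (sym (∑-nonNeg≡0 (λ q → indicator-nonNeg (indicator-* (e-indicator 1F (dist x q)) (indicator-* (e-indicator 1F (dist u q)) (e-indicator 1F (dist v q))))) (Far.common≡0 uv) p))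
                  (cong₂ _*_ (e≡1 xp) (cong₂ _*_ (e≡1 up) (e≡1 vp)))) λ ()
            by-dist 2F up = cases (nonadjacent-N₃ xu xp up)
              where
              cases : (common u p ≡ + 0 × N₃ u p ≡ + 10) ⊎ (common u p ≡ + 1 × N₃ u p ≡ + 4) → Goal (σ p) (κ p)
              cases (inj₂ (_ , m)) = inside (σ p) σ≡1 (κ p) (kappa up (Θ≡0 m λ ()))
              cases (inj₁ (c , m)) = none (kappa up (Θ≡1 m)) apart
                where
                u-p : Far u p
                u-p = record { xv = xp ; uv = up ; N₃≡10 = m ; common≡0 = c }
                apart : ∀ {v} → Far u v → dist v p ≢ 1F
                apart {v} uv vp = contradiction (trans (sym (Pair.vv′ (proj₂ (classify uv u-p (λ { refl → contradiction (trans (sym vp) (dist-refl v)) λ () }))))) vp) λ ()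
            by-dist 3F up = contradiction up (near-V xu xp)

      -- The pairs p, p′ and q, q′ are those that form triangles of related vertices with u; `∑-ϑ·`
      -- says that the four are all the vertices related to u.
      record Quad : Set where
        field
          {p p′ q q′} : Fin n
          far-p  : Far u p
          far-p′ : Far u p′
          far-q  : Far u q
          far-q′ : Far u q′
          ∑-ϑ·   : ∀ (g : Fin n → ℤ) → ∑ (λ v → ϑ u v * g v) ≡ g p + g p′ + (g q + g q′)
          pp′    : N₃ p p′ ≡ + 10
          qq′    : N₃ q q′ ≡ + 10
          pq     : N₃ p q ≡ + 4
          pq′    : N₃ p q′ ≡ + 4
          p′q    : N₃ p′ q ≡ + 4
          p′q′   : N₃ p′ q′ ≡ + 4

      quad : Quad
      quad = from (support (ϑ u) (ϑ-indicator u))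
        where
        4≡length : ∀ l → (∀ g → ∑ (λ v → ϑ u v * g v) ≡ sumOver g l) → length l ≡ 4
        4≡length l eq = ℤ.+-injective (trans (sym (ones-length l)) (trans (sym (eq (λ _ → + 1))) (trans (∑-cong (λ v → ℤ.*-identityʳ (ϑ u v))) (∑-ϑ xu))))
          where
          ones-length : ∀ l → sumOver {n} (λ _ → + 1) l ≡ + length l
          ones-length []      = refl
          ones-length (_ ∷ l) = cong (λ s → + 1 + s) (ones-length l)
        from : ∃[ l ] (∀ g → ∑ (λ v → ϑ u v * g v) ≡ sumOver g l) × All (λ v → ϑ u v ≡ + 1) l × Unique l → Quad
        from (l , eq , ones , uniq) = at l (4≡length l eq) eq ones uniq
          where
          at : ∀ l → length l ≡ 4 → (∀ g → ∑ (λ v → ϑ u v * g v) ≡ sumOver g l) → All (λ v → ϑ u v ≡ + 1) l → Unique l → Quad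
          at (a ∷ b ∷ c ∷ d ∷ []) refl eq (ϑa ∷ ϑb ∷ ϑc ∷ ϑd ∷ []) ((a≢b ∷ a≢c ∷ a≢d ∷ []) ∷ (b≢c ∷ b≢d ∷ []) ∷ (c≢d ∷ []) ∷ [] ∷ []) =
            arrange (classify ua ub a≢b) (classify ua uc a≢c) (classify ua ud a≢d) (classify ub uc b≢c) (classify ub ud b≢d) (classify uc ud c≢d)
            where
            ua : Far u a
            ua = far xu ϑa
            ub : Far u b
            ub = far xu ϑb
            uc : Far u c
            uc = far xu ϑc
            ud : Far u d
            ud = far xu ϑd
            ten : ∀ {v v′ k} → k ≡ 0F → Pair v v′ k → N₃ v v′ ≡ + 10
            ten refl = Pair.N₃≡
            four′ : ∀ {v v′ k} → k ≡ 1F → Pair v v′ k → N₃ v v′ ≡ + 4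
            four′ refl = Pair.N₃≡
            arrange : ∃[ k ] Pair a b k → ∃[ k ] Pair a c k → ∃[ k ] Pair a d k → ∃[ k ] Pair b c k → ∃[ k ] Pair b d k → ∃[ k ] Pair c d k → Quad
            arrange (ab , Pab) (ac , Pac) (ad , Pad) (bc , Pbc) (bd , Pbd) (cd , Pcd) = build (matching ab ac ad bc bd cd
                ( (λ (x , y , z) → no-triangle ua ub uc (four′ x Pab) (four′ y Pac) (four′ z Pbc))
                , (λ (x , y , z) → no-triangle ua ub ud (four′ x Pab) (four′ y Pad) (four′ z Pbd))
                , (λ (x , y , z) → no-triangle ua uc ud (four′ x Pac) (four′ y Pad) (four′ z Pcd))
                , (λ (x , y , z) → no-triangle ub uc ud (four′ x Pbc) (four′ y Pbd) (four′ z Pcd))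
                , enough))
              where
              total : ℕ
              total = toℕ ab ℕ.+ toℕ ac ℕ.+ toℕ ad ℕ.+ toℕ bc ℕ.+ toℕ bd ℕ.+ toℕ cd
              -- `many-common` leaves at least 16 - 12 = 4 for the sum of the labels, a label being
              -- the number of common neighbours of its pair.
              enough : 4 ℕ.≤ total
              enough = ℕ.+-cancelʳ-≤ 12 4 total (ℤ.drop‿+≤+ (subst (+ 16 ≤_)
                (trans (cong (_+ + 12) (cong₂ _+_ (cong₂ _+_ (cong₂ _+_ (Pair.common≡ Pab) (Pair.common≡ Pac)) (Pair.common≡ Pad))
                  (cong₂ _+_ (cong₂ _+_ (Pair.common≡ Pbc) (Pair.common≡ Pbd)) (Pair.common≡ Pcd))))
                  (cong (λ m → + (m ℕ.+ 12)) (reassoc (toℕ ab ℕ.+ toℕ ac ℕ.+ toℕ ad) (toℕ bc) (toℕ bd) (toℕ cd))))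
                (many-common ua ub uc ud)))
                where
                reassoc : ∀ s i j k → s ℕ.+ (i ℕ.+ j ℕ.+ k) ≡ s ℕ.+ i ℕ.+ j ℕ.+ k
                reassoc s i j k = trans (sym (ℕ.+-assoc s (i ℕ.+ j) k)) (cong (ℕ._+ k) (sym (ℕ.+-assoc s i j)))
              build : Matching ab ac ad bc bd cd → Quad
              build (inj₁ (x , y , s , t , r , z)) = record
                { far-p = ua ; far-p′ = ub ; far-q = uc ; far-q′ = ud
                ; ∑-ϑ· = λ g → trans (eq g) (lemma (g a) (g b) (g c) (g d))
                ; pp′ = ten x Pab ; qq′ = ten y Pcd ; pq = four′ s Pac ; pq′ = four′ t Pad ; p′q = four′ r Pbc ; p′q′ = four′ z Pbd }
                where
                lemma : ∀ a b c d → a + (b + (c + (d + + 0))) ≡ a + b + (c + d)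
                lemma = ℤRing.solve-∀
              build (inj₂ (inj₁ (x , y , s , t , r , z))) = record
                { far-p = ua ; far-p′ = uc ; far-q = ub ; far-q′ = ud
                ; ∑-ϑ· = λ g → trans (eq g) (lemma (g a) (g b) (g c) (g d))
                ; pp′ = ten x Pac ; qq′ = ten y Pbd ; pq = four′ s Pab ; pq′ = four′ t Pad
                ; p′q = trans (N₃-sym c b) (four′ r Pbc) ; p′q′ = four′ z Pcd }
                where
                lemma : ∀ a b c d → a + (b + (c + (d + + 0))) ≡ a + c + (b + d)
                lemma = ℤRing.solve-∀
              build (inj₂ (inj₂ (x , y , s , t , r , z))) = record
                { far-p = ua ; far-p′ = ud ; far-q = ub ; far-q′ = uc
                ; ∑-ϑ· = λ g → trans (eq g) (lemma (g a) (g b) (g c) (g d))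
                ; pp′ = ten x Pad ; qq′ = ten y Pbc ; pq = four′ s Pab ; pq′ = four′ t Pac
                ; p′q = trans (N₃-sym d b) (four′ r Pbd) ; p′q′ = trans (N₃-sym d c) (four′ z Pcd) }
                where
                lemma : ∀ a b c d → a + (b + (c + (d + + 0))) ≡ a + d + (b + c)
                lemma = ℤRing.solve-∀

-- Double counting of triangles and blocks

∑-even : ∀ {n} (f : Fin n → ℤ) → (∀ i → ∃[ k ] f i ≡ + 2 * k) → ∃[ k ] ∑ f ≡ + 2 * k
∑-even f ev = ∑ (λ i → proj₁ (ev i)) , trans (∑-cong (λ i → proj₂ (ev i))) (∑-*ˡ (+ 2) (λ i → proj₁ (ev i)))

multiple-of-6-above-14 : ∀ {i} → (∃[ k ] i ≡ + 2 * k) → (∃[ q ] i ≡ + 3 * q) → + 14 ≤ i → + 18 ≤ i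
multiple-of-6-above-14 {i} (k , i≡2k) (q , i≡3q) 14≤i = subst (+ 18 ≤_) (sym i≡6j) (ℤ.*-monoˡ-≤-nonNeg (+ 6) 3≤j)
  where
  j : ℤ
  j = k - q
  i≡6j : i ≡ + 6 * j
  i≡6j = begin
    i                           ≡⟨ lemma i ⟩
    + 3 * i - + 2 * i           ≡⟨ cong₂ (λ p r → + 3 * p - + 2 * r) i≡2k i≡3q ⟩
    + 3 * (+ 2 * k) - + 2 * (+ 3 * q) ≡⟨ lemma′ k q ⟩
    + 6 * j                     ∎
    where
    open ≡-Reasoning
    lemma : ∀ i → i ≡ + 3 * i - + 2 * i
    lemma = ℤRing.solve-∀
    lemma′ : ∀ k q → + 3 * (+ 2 * k) - + 2 * (+ 3 * q) ≡ + 6 * (k - q)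
    lemma′ = ℤRing.solve-∀
  3≤j : + 3 ≤ j
  3≤j = ℤ.≮⇒≥ λ j<3 → ℤ.<⇒≱ {+ 12} {+ 14} (ℤ.+<+ (ℕ.m<m+n 12 (s≤s z≤n))) (ℤ.≤-trans 14≤i
    (subst (_≤ + 12) (sym i≡6j) (ℤ.*-monoˡ-≤-nonNeg (+ 6) {j} {+ 2} (ℤ.<-≤-trans j<3 ℤ.≤-refl |>pred))))
    where
    _|>pred : j < + 3 → j ≤ + 2
    j<3 |>pred = ℤ.i<j⇒i≤pred[j] j<3

module FinalCount {n} (Γ : Graph n) (G : DistanceRegular Γ 3) (H : HasArray G 7 8 4) where
  open Distance Γ G
  open Parameters Γ G using (geodesic)
  open ArrayInteger Γ G H
  open Coclique Γ G H
  open Counting ℤ-domain using (e)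
  open Exclusion Γ G H
  open Configuration Γ G H

  private
    x : Fin n
    x = proj₁ geodesic

  open Local x
  open AtVertex x

  -- R u z is twice the number of Θ-triangles at u inside the block z.
  R : Fin n → Fin n → ℤ
  R u z = ∑ (λ v → ϑ u v * (χ v z * ∑ (λ v′ → ϑ u v′ * (χ v′ z * Θ v v′))))

  S : Fin n → Fin n → ℤ
  S u z = σ u * χ u z

  module _ {u} (xu : dist x u ≡ 1F) where
    open Quad (quad xu)

    pairs : Fin n → ℤ
    pairs z = χ p z * χ p′ z + χ q z * χ q′ z

    R≡2pairs : ∀ z → R u z ≡ + 2 * pairs z
    R≡2pairs z = begin
      R u z
        ≡⟨ ∑-ϑ· (λ v → χ v z * ∑ (λ v′ → ϑ u v′ * (χ v′ z * Θ v v′))) ⟩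
      χ p z * I p + χ p′ z * I p′ + (χ q z * I q + χ q′ z * I q′)
        ≡⟨ cong₂ _+_ (cong₂ _+_
             (cong (χ p z *_) (inner p (Θ≡0 (N₃-refl (Far.xv far-p)) λ ()) (Θ≡1 pp′) (Θ≡0 pq λ ()) (Θ≡0 pq′ λ ())))
             (cong (χ p′ z *_) (inner p′ (Θ≡1 (trans (N₃-sym p′ p) pp′)) (Θ≡0 (N₃-refl (Far.xv far-p′)) λ ()) (Θ≡0 p′q λ ()) (Θ≡0 p′q′ λ ()))))
             (cong₂ _+_
             (cong (χ q z *_) (inner q (Θ≡0 (trans (N₃-sym q p) pq) λ ()) (Θ≡0 (trans (N₃-sym q p′) p′q) λ ()) (Θ≡0 (N₃-refl (Far.xv far-q)) λ ()) (Θ≡1 qq′)))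
             (cong (χ q′ z *_) (inner q′ (Θ≡0 (trans (N₃-sym q′ p) pq′) λ ()) (Θ≡0 (trans (N₃-sym q′ p′) p′q′) λ ()) (Θ≡1 (trans (N₃-sym q′ q) qq′)) (Θ≡0 (N₃-refl (Far.xv far-q′)) λ ())))) ⟩
      χ p z * combo (+ 0) (+ 1) (+ 0) (+ 0) + χ p′ z * combo (+ 1) (+ 0) (+ 0) (+ 0) +
        (χ q z * combo (+ 0) (+ 0) (+ 0) (+ 1) + χ q′ z * combo (+ 0) (+ 0) (+ 1) (+ 0))
        ≡⟨ lemma (χ p z) (χ p′ z) (χ q z) (χ q′ z) ⟩
      + 2 * pairs z ∎
      where
      open ≡-Reasoning
      I : Fin n → ℤ
      I v = ∑ (λ v′ → ϑ u v′ * (χ v′ z * Θ v v′))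
      combo : ℤ → ℤ → ℤ → ℤ → ℤ
      combo a b c d = χ p z * a + χ p′ z * b + (χ q z * c + χ q′ z * d)
      inner : ∀ v {a b c d} → Θ v p ≡ a → Θ v p′ ≡ b → Θ v q ≡ c → Θ v q′ ≡ d → I v ≡ combo a b c d
      inner v refl refl refl refl = ∑-ϑ· (λ v′ → χ v′ z * Θ v v′)
      lemma : ∀ p p′ q q′ → p * (p * + 0 + p′ * + 1 + (q * + 0 + q′ * + 0)) + p′ * (p * + 1 + p′ * + 0 + (q * + 0 + q′ * + 0)) +
        (q * (p * + 0 + p′ * + 0 + (q * + 0 + q′ * + 1)) + q′ * (p * + 0 + p′ * + 0 + (q * + 1 + q′ * + 0))) ≡ + 2 * (p * p′ + q * q′)
      lemma = ℤRing.solve-∀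

    -- A block through u contains p or q, p or q′, p′ or q, p′ or q′, hence one
    -- of the Θ-triangles u p p′ and u q q′.
    triangle-in-block : ∀ z → w u z ≡ + 1 → + 1 ≤ pairs z
    triangle-in-block z w≡1 = finite (χ-indicator p z) (χ-indicator p′ z) (χ-indicator q z) (χ-indicator q′ z)
      (hit (miss≡0 xu far-p far-q pq z)) (hit (miss≡0 xu far-p far-q′ pq′ z)) (hit (miss≡0 xu far-p′ far-q p′q z)) (hit (miss≡0 xu far-p′ far-q′ p′q′ z))
      where
      hit : ∀ {i} → w u z * i ≡ 0ℤ → i ≡ 0ℤ
      hit {i} eq = trans (sym (ℤ.*-identityˡ i)) (trans (cong (_* i) (sym w≡1)) eq)
      finite : ∀ {a b c d} → Indicator a → Indicator b → Indicator c → Indicator d →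
        (+ 1 - a) * (+ 1 - c) ≡ 0ℤ → (+ 1 - a) * (+ 1 - d) ≡ 0ℤ → (+ 1 - b) * (+ 1 - c) ≡ 0ℤ → (+ 1 - b) * (+ 1 - d) ≡ 0ℤ →
        + 1 ≤ a * b + c * d
      finite (inj₂ refl) (inj₂ refl) ic id _ _ _ _ = ℤ.+-monoʳ-≤ (+ 1) (indicator-nonNeg (indicator-* ic id))
      finite (inj₁ refl) ib (inj₂ refl) (inj₂ refl) _ _ _ _ = ℤ.≤-refl
      finite (inj₁ refl) ib (inj₁ refl) _ () _ _ _
      finite (inj₁ refl) ib (inj₂ refl) (inj₁ refl) _ () _ _
      finite (inj₂ refl) (inj₁ refl) (inj₂ refl) (inj₂ refl) _ _ _ _ = ℤ.≤-refl
      finite (inj₂ refl) (inj₁ refl) (inj₁ refl) _ _ _ () _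
      finite (inj₂ refl) (inj₁ refl) (inj₂ refl) (inj₁ refl) _ _ _ ()

    -- A block through u that contains both triangles contains p and q. So its number of triangles
    -- is at most 1, plus 1 if p and q lie in it, and the sum is at most 16 + 4.
    ∑-w-pairs : ∑ (λ z → w u z * pairs z) ≤ + 20
    ∑-w-pairs = ℤ.≤-trans (∑-mono pointwise) (subst (_≤ + 20) (sym (trans (∑-+ _ _) (cong (_+ N₄ u p q) (∑w xu))))
      (ℤ.+-monoʳ-≤ (+ 16) (subst (N₄ u p q ≤_) pq (N₄≤N₃ u p q))))
      where
      pointwise : ∀ z → w u z * pairs z ≤ w u z + w u z * (χ p z * χ q z)
      pointwise z = finite (w-indicator u z) (χ-indicator p z) (χ-indicator p′ z) (χ-indicator q z) (χ-indicator q′ z)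
        where
        finite : ∀ {w a b c d} → Indicator w → Indicator a → Indicator b → Indicator c → Indicator d → w * (a * b + c * d) ≤ w + w * (a * c)
        finite (inj₁ refl) _ _ _ _ = ℤ.≤-refl
        finite {a = a} {c = c} (inj₂ refl) (inj₁ refl) _ ic id = subst₂ _≤_ (sym (trans (ℤ.*-identityˡ _) (ℤ.+-identityˡ _))) refl (le (indicator-* ic id))
          where
          le : ∀ {i} → Indicator i → i ≤ + 1
          le (inj₁ refl) = ℤ.+≤+ z≤n
          le (inj₂ refl) = ℤ.≤-refl
        finite (inj₂ refl) (inj₂ refl) (inj₁ refl) (inj₁ refl) _           = ℤ.+≤+ z≤n
        finite (inj₂ refl) (inj₂ refl) (inj₁ refl) (inj₂ refl) (inj₁ refl) = ℤ.+≤+ z≤n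
        finite (inj₂ refl) (inj₂ refl) (inj₁ refl) (inj₂ refl) (inj₂ refl) = ℤ.+≤+ (s≤s z≤n)
        finite (inj₂ refl) (inj₂ refl) (inj₂ refl) (inj₁ refl) _           = ℤ.≤-refl
        finite (inj₂ refl) (inj₂ refl) (inj₂ refl) (inj₂ refl) (inj₁ refl) = ℤ.+≤+ (s≤s z≤n)
        finite (inj₂ refl) (inj₂ refl) (inj₂ refl) (inj₂ refl) (inj₂ refl) = ℤ.≤-refl

    ∑-w-R : ∑ (λ z → w u z * R u z) ≤ + 40
    ∑-w-R = subst (_≤ + 40) (sym (trans (∑-cong (λ z → trans (cong (w u z *_) (R≡2pairs z)) (lemma (w u z) (pairs z)))) (∑-*ˡ (+ 2) _)))
      (ℤ.*-monoˡ-≤-nonNeg (+ 2) ∑-w-pairs)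
      where
      lemma : ∀ w s → w * (+ 2 * s) ≡ + 2 * (w * s)
      lemma = ℤRing.solve-∀

  -- Six times the number of triangles inside the block z: each is counted at each of its vertices u
  -- and for both orders of the other two.
  T′ : Fin n → ℤ
  T′ z = ∑ (λ u → S u z * R u z)

  T′-even : ∀ z → ∃[ k ] T′ z ≡ + 2 * k
  T′-even z = ∑-even (λ u → S u z * R u z) (λ u → by u (σ-indicator u))
    where
    by : ∀ u → Indicator (σ u) → ∃[ k ] S u z * R u z ≡ + 2 * k
    by u (inj₁ σ≡0) = 0ℤ , trans (cong (λ s → s * χ u z * R u z) σ≡0) (trans (cong (_* R u z) (ℤ.*-zeroˡ (χ u z))) (ℤ.*-zeroˡ (R u z)))
    by u (inj₂ σ≡1) = S u z * pairs (σ≡1⇒ σ≡1) z , trans (cong (S u z *_) (R≡2pairs (σ≡1⇒ σ≡1) z)) (lemma (S u z) (pairs (σ≡1⇒ σ≡1) z))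
      where
      lemma : ∀ w s → w * (+ 2 * s) ≡ + 2 * (w * s)
      lemma = ℤRing.solve-∀

  -- As a sum over ordered triples, the summand is invariant under cyclic shifts and vanishes on
  -- repetitions, because no vertex of Γ(x) is related to itself.
  T′-multiple-of-3 : ∀ z → ∃[ q ] T′ z ≡ + 3 * q
  T′-multiple-of-3 z = let q , eq = ∑∑∑-multiple-of-3 g cyclic irr in q , trans (∑-cong unfold) eq
    where
    g : Fin n → Fin n → Fin n → ℤ
    g u v v′ = S u z * S v z * S v′ z * (Θ u v * Θ v v′ * Θ v′ u)
    cyclic : ∀ i j k → g i j k ≡ g j k i
    cyclic i j k = lemma (S i z) (S j z) (S k z) (Θ i j) (Θ j k) (Θ k i)
      where
      lemma : ∀ a b c p q r → a * b * c * (p * q * r) ≡ b * c * a * (q * r * p)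
      lemma = ℤRing.solve-∀
    irr : ∀ i j → g i i j ≡ 0ℤ
    irr i j = by (σ-indicator i)
      where
      by : Indicator (σ i) → g i i j ≡ 0ℤ
      by (inj₁ σ≡0) = trans (cong (λ s → s * S i z * S j z * (Θ i i * Θ i j * Θ j i)) (trans (cong (_* χ i z) σ≡0) (ℤ.*-zeroˡ (χ i z))))
        (lemma (S i z) (S j z) (Θ i i * Θ i j * Θ j i))
        where
        lemma : ∀ a b c → + 0 * a * b * c ≡ 0ℤ
        lemma = ℤRing.solve-∀
      by (inj₂ σ≡1) = trans (cong (λ s → S i z * S i z * S j z * (s * Θ i j * Θ j i)) (Θ≡0 (N₃-refl (σ≡1⇒ σ≡1)) λ ()))
        (lemma (S i z * S i z * S j z) (Θ i j) (Θ j i))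
        where
        lemma : ∀ a b c → a * (+ 0 * b * c) ≡ 0ℤ
        lemma = ℤRing.solve-∀
    unfold : ∀ u → S u z * R u z ≡ ∑ (λ v → ∑ (λ v′ → g u v v′))
    unfold u = trans (sym (∑-*ˡ (S u z) _)) (∑-cong (λ v → begin
      S u z * (ϑ u v * (χ v z * ∑ (λ v′ → ϑ u v′ * (χ v′ z * Θ v v′))))
        ≡⟨ lemma (S u z) (σ v) (Θ u v) (χ v z) _ ⟩
      S u z * S v z * Θ u v * ∑ (λ v′ → ϑ u v′ * (χ v′ z * Θ v v′))
        ≡⟨ ∑-*ˡ (S u z * S v z * Θ u v) _ ⟨
      ∑ (λ v′ → S u z * S v z * Θ u v * (ϑ u v′ * (χ v′ z * Θ v v′)))
        ≡⟨ ∑-cong (λ v′ → trans (cong (λ t → S u z * S v z * Θ u v * (σ v′ * t * (χ v′ z * Θ v v′))) (Θ-sym u v′))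
             (lemma′ (S u z) (S v z) (Θ u v) (σ v′) (Θ v′ u) (χ v′ z) (Θ v v′))) ⟩
      ∑ (λ v′ → g u v v′) ∎))
      where
      open ≡-Reasoning
      lemma : ∀ a s t c i → a * (s * t * (c * i)) ≡ a * (s * c) * t * i
      lemma = ℤRing.solve-∀
      lemma′ : ∀ a b t s r c m → a * b * t * (s * r * (c * m)) ≡ a * b * (s * c) * (t * m * r)
      lemma′ = ℤRing.solve-∀

  -- The block has a₃ = 7 points, and each of them lies in a triangle inside the block. As `T′ z` is
  -- a multiple of 6, the bound then improves to 18.
  14≤T′ : ∀ z → dist x z ≡ 3F → + 14 ≤ T′ z
  14≤T′ z xz = subst (_≤ T′ z) (trans (∑-*ʳ (+ 2) (λ u → S u z)) (cong (_* + 2) size-of-block)) (∑-mono (λ u → by u (σ-indicator u) (χ-indicator u z)))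
    where
    size-of-block : ∑ (λ u → S u z) ≡ + 7
    size-of-block = trans (∑-cong (λ u → cong (λ i → σ u * e 3F i) (dist-sym u z)))
      (trans (sum-over-sphere (e 3F) z x) (cong (Λ (e 3F)) (trans (dist-sym z x) xz)))
    by : ∀ u → Indicator (σ u) → Indicator (χ u z) → S u z * + 2 ≤ S u z * R u z
    by u (inj₁ σ≡0) _ = ℤ.≤-reflexive (trans (z0 (+ 2)) (sym (z0 (R u z))))
      where
      z0 : ∀ i → S u z * i ≡ 0ℤ
      z0 i = trans (cong (λ s → s * χ u z * i) σ≡0) (trans (cong (_* i) (ℤ.*-zeroˡ (χ u z))) (ℤ.*-zeroˡ i))
    by u (inj₂ σ≡1) (inj₁ χ≡0) = ℤ.≤-reflexive (trans (z0 (+ 2)) (sym (z0 (R u z))))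
      where
      z0 : ∀ i → S u z * i ≡ 0ℤ
      z0 i = trans (cong (λ s → σ u * s * i) χ≡0) (trans (cong (_* i) (ℤ.*-zeroʳ (σ u))) (ℤ.*-zeroˡ i))
    by u (inj₂ σ≡1) (inj₂ χ≡1) = subst₂ _≤_ (sym (one (+ 2))) (sym (trans (one (R u z)) (R≡2pairs xu z)))
      (ℤ.*-monoˡ-≤-nonNeg (+ 2) (triangle-in-block xu z (cong₂ _*_ (e≡1 xz) χ≡1)))
      where
      xu : dist x u ≡ 1F
      xu = σ≡1⇒ σ≡1
      one : ∀ i → S u z * i ≡ i
      one i = trans (cong (_* i) (cong₂ _*_ σ≡1 χ≡1)) (ℤ.*-identityˡ i)

  18≤T′ : ∀ z → dist x z ≡ 3F → + 18 ≤ T′ z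
  18≤T′ z xz = multiple-of-6-above-14 (T′-even z) (T′-multiple-of-3 z) (14≤T′ z xz)

  lower : + 864 ≤ ∑ (λ z → e 3F (dist x z) * T′ z)
  lower = subst (_≤ ∑ (λ z → e 3F (dist x z) * T′ z)) (trans (∑-*ʳ (+ 18) (λ z → e 3F (dist x z))) (cong (_* + 18) 48-blocks)) (∑-mono (λ z → by z (dist x z Fin.≟ 3F)))
    where
    48-blocks : ∑ (λ z → e 3F (dist x z)) ≡ + 48
    48-blocks = ℤ.*-cancelˡ-≡ (+ 4) (∑ (λ z → e 3F (dist x z))) (+ 48) (Sizes.γ-weighted-size x (e 3F))
    by : ∀ z → Dec (dist x z ≡ 3F) → e 3F (dist x z) * + 18 ≤ e 3F (dist x z) * T′ z
    by z (yes xz) = subst₂ _≤_ (sym (one (+ 18))) (sym (one (T′ z))) (18≤T′ z xz)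
      where
      one : ∀ i → e 3F (dist x z) * i ≡ i
      one i = trans (cong (_* i) (e≡1 xz)) (ℤ.*-identityˡ i)
    by z (no ≢3) = ℤ.≤-reflexive (trans (z0 (+ 18)) (sym (z0 (T′ z))))
      where
      z0 : ∀ i → e 3F (dist x z) * i ≡ 0ℤ
      z0 i = trans (cong (_* i) (e≡0 ≢3)) (ℤ.*-zeroˡ i)

  upper : ∑ (λ z → e 3F (dist x z) * T′ z) ≤ + 840
  upper = subst₂ _≤_ (sym swapped) (trans (∑-*ʳ (+ 40) σ) (cong (_* + 40) (valency≡ x))) (∑-mono (λ u → by u (σ-indicator u)))
    where
    swapped : ∑ (λ z → e 3F (dist x z) * T′ z) ≡ ∑ (λ u → σ u * ∑ (λ z → w u z * R u z))
    swapped = trans (∑-cong (λ z → sym (∑-*ˡ (e 3F (dist x z)) _))) (trans (∑-swap _) (∑-cong (λ u →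
      trans (∑-cong (λ z → lemma (e 3F (dist x z)) (σ u) (χ u z) (R u z))) (∑-*ˡ (σ u) _))))
      where
      lemma : ∀ a s c r → a * (s * c * r) ≡ s * (a * c * r)
      lemma = ℤRing.solve-∀
    by : ∀ u → Indicator (σ u) → σ u * ∑ (λ z → w u z * R u z) ≤ σ u * + 40
    by u (inj₁ σ≡0) = ℤ.≤-reflexive (trans (z0 _) (sym (z0 (+ 40))))
      where
      z0 : ∀ i → σ u * i ≡ 0ℤ
      z0 i = trans (cong (_* i) σ≡0) (ℤ.*-zeroˡ i)
    by u (inj₂ σ≡1) = subst₂ _≤_ (sym (one _)) (sym (one (+ 40))) (∑-w-R (σ≡1⇒ σ≡1))
      where
      one : ∀ i → σ u * i ≡ i
      one i = trans (cong (_* i) σ≡1) (ℤ.*-identityˡ i)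

  impossible : ⊥
  impossible = ℤ.<⇒≱ {+ 840} {+ 864} (ℤ.+<+ (ℕ.m<m+n 840 (s≤s z≤n))) (ℤ.≤-trans lower upper)

-- Finite search for arrays with integral t

allBelow : ℕ → (ℕ → Bool) → Bool
allBelow zero    p = true
allBelow (suc n) p = p n ∧ allBelow n p

divides? : ℕ → ℕ → Bool
-- Modulus 0 is accepted: the test may err only towards keeping an array.
divides? zero    n = true
divides? (suc d) n = n % suc d ≡ᵇ 0

Triple : Set
Triple = ℕ × ℕ × ℕ

arrays : List Triple
arrays =
  (4 , 5 , 1) ∷ (4 , 2 , 2) ∷ (4 , 3 , 3) ∷ (5 , 6 , 2) ∷ (8 , 9 , 1) ∷ (9 , 10 , 2) ∷ (10 , 9 , 3) ∷
  (14 , 12 , 6) ∷ (20 , 18 , 6) ∷ (23 , 24 , 4) ∷ (31 , 24 , 6) ∷ (35 , 24 , 12) ∷ []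

candidates : List Triple
candidates = (7 , 8 , 4) ∷ arrays

sameTriple : Triple → Triple → Bool
sameTriple (a , b , c) (a′ , b′ , c′) = (a ≡ᵇ a′) ∧ (b ≡ᵇ b′) ∧ (c ≡ᵇ c′)

listed : Triple → List Triple → Bool
listed t []      = false
listed t (u ∷ l) = sameTriple t u ∨ listed t l

module _ (A B C : ℤ) where
  second : ℤ
  second = + 3 * A - B - C

  γ-order-value : ℤ
  γ-order-value = C + + 3 * A * C + + 6 * A * (A + + 1) + + 3 * (A + + 1) * B

  η-norm : ℤ
  η-norm = (A + + 3) * B + C * (A + + 1)

  ω-norm : ℤ → ℤ
  ω-norm t = + 6 * A * (A + + 1) * C + + 2 * t * t * (A + + 1) * C +
    ((t - + 3) * (A + t)) * ((t - + 3) * (A + t)) + + 2 * A * B * ((t - + 3) * (t - + 3))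

  p²₂₂-value : ℤ
  p²₂₂-value = C * (+ 2 * A + + 2) + second * second + B * (+ 2 * A) - (A - + 3) * second - + 3 * A

  -- In order: a₁ ≥ 0; a₂ ≥ 0; the bounds from four and, at α = 7 and γ = 1, from five non-adjacent
  -- neighbours; q₁₁³ ≥ 0; q₁₁¹ ≥ 0; integral multiplicities of a₃ and of - t; k₂ a₂ even; p²₂₂
  -- integral. Factors c₂ clear the denominators of n and k₂.
  feasible : ℤ → Bool
  feasible t =
    does (+ 3 ℤ.≤? A) ∧ does (0ℤ ℤ.≤? second) ∧ does (+ 4 * (A - + 2) - + 6 * (C - + 1) ℤ.≤? + 3 * A) ∧
    (not (does (A ℤ.≟ + 7)) ∨ not (does (C ℤ.≟ + 1))) ∧
    does ((t - + 3) * C ℤ.≤? (+ 9 - t) * B) ∧ does ((A + + 1) * (C * C) ℤ.≤? (A + + 9) * (B * B)) ∧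
    divides? (abs (C * η-norm)) (abs (γ-order-value * (+ 3 * B))) ∧
    divides? (abs (ω-norm t)) (abs (γ-order-value * (+ 6 * A * (A + + 1)))) ∧
    divides? (abs (+ 2 * C)) (abs (+ 6 * A * (A + + 1) * second)) ∧
    divides? (abs (C)) (abs (p²₂₂-value))

-- The smallest eigenvalue is - (s + 4). The equations
-- 2 (s + 1) (α + s + 4) = γ ((s + 1) r + 2 (s + 3)) and 2 β = r γ determine α and β.
α-from : ℕ → ℕ → ℕ → ℕ
α-from s γ r = (γ ℕ.* ((s ℕ.+ 1) ℕ.* r ℕ.+ 2 ℕ.* (s ℕ.+ 3))) / suc (suc (2 ℕ.* s)) ∸ (s ℕ.+ 4)

acceptable : ℕ → ℕ → ℕ → ℕ → Bool
acceptable s γ α β = not (feasible (+ α) (+ β) (+ γ) (+ (s ℕ.+ 4))) ∨ listed (α , β , γ) candidates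

bound : ℕ → ℕ
bound s = 24 ℕ.* ((s ℕ.+ 1) ℕ.* (s ℕ.+ 1)) ℕ.* ((s ℕ.+ 4) ℕ.* (s ℕ.+ 3))

-- The limit 33 for r = 2 β / γ comes from the coclique bound; the limit 5 for s in `search`
-- expresses t ≤ 8.
row : ℕ → ℕ → Bool
row s γ = not (divides? γ (bound s)) ∨ allBelow 33 (λ r → acceptable s γ (α-from s γ r) ((r ℕ.* γ) / 2))

search : allBelow 5 (λ s → allBelow (suc (bound s)) (row s)) ≡ true
search = refl

∧-true : ∀ {p q} → p ≡ true → q ≡ true → p ∧ q ≡ true
∧-true refl refl = refl

∧-split : ∀ p {q} → p ∧ q ≡ true → p ≡ true × q ≡ true
∧-split true eq = refl , eq

allBelow-sound : ∀ n p → allBelow n p ≡ true → ∀ {m} → m ℕ.< n → p m ≡ true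
allBelow-sound (suc n) p eq {m} m<1+n with ∧-split (p n) eq | m ℕ.≟ n
... | pn , _    | yes refl = pn
... | _  , rest | no  m≢n  = allBelow-sound n p rest (ℕ.≤∧≢⇒< (ℕ.≤-pred m<1+n) m≢n)

divides?-true : ∀ {d n} → d ∣ n → divides? d n ≡ true
divides?-true {zero}      _   = refl
divides?-true {suc d} {n} d∣n = cong (_≡ᵇ 0) (n∣m⇒m%n≡0 n (suc d) d∣n)

abs-∣ : ∀ {i j k} → i ≡ j * k → abs j ∣ abs i
abs-∣ {j = j} {k} refl = divides (abs k) (trans (ℤ.abs-* j k) (ℕ.*-comm (abs j) (abs k)))

≡ᵇ-sound : ∀ m n → (m ≡ᵇ n) ≡ true → m ≡ n
≡ᵇ-sound m n eq = ℕ.≡ᵇ⇒≡ m n (Equivalence.from T-≡ eq)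

listed-sound : ∀ t l → listed t l ≡ true → t ∈ l
listed-sound t@(a , b , c) (u@(a′ , b′ , c′) ∷ l) eq with sameTriple t u in same
... | false = there (listed-sound t l eq)
... | true  with ∧-split (a ≡ᵇ a′) same
...   | a≡ , rest with ∧-split (b ≡ᵇ b′) rest
...     | b≡ , c≡ = here (cong₂ _,_ (≡ᵇ-sound a a′ a≡) (cong₂ _,_ (≡ᵇ-sound b b′ b≡) (≡ᵇ-sound c c′ c≡)))

private
  ∨-resolve : ∀ {p q} → p ≡ true → not p ∨ q ≡ true → q ≡ true
  ∨-resolve refl eq = eq

search-sound : ∀ s α β γ r → s ℕ.< 5 → 1 ℕ.≤ γ → γ ∣ bound s → r ℕ.< 33 →
  2 ℕ.* β ≡ r ℕ.* γ → suc (suc (2 ℕ.* s)) ℕ.* (α ℕ.+ (s ℕ.+ 4)) ≡ γ ℕ.* ((s ℕ.+ 1) ℕ.* r ℕ.+ 2 ℕ.* (s ℕ.+ 3)) →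
  feasible (+ α) (+ β) (+ γ) (+ (s ℕ.+ 4)) ≡ true → (α , β , γ) ∈ candidates
search-sound s α β γ r s<5 γ≥1 γ∣bound r<33 2β≡rγ α-eq feas = listed-sound (α , β , γ) candidates (∨-resolve feas checked)
  where
  γ< : γ ℕ.< suc (bound s)
  γ< = s≤s (ℕ.∣⇒≤ {{bound≢0}} γ∣bound)
    where
    bound≢0 : ℕ.NonZero (bound s)
    bound≢0 = ℕ.>-nonZero (subst (0 ℕ.<_) (cong₂ (λ p q → 24 ℕ.* (p ℕ.* p) ℕ.* (q ℕ.* (s ℕ.+ 3))) (ℕ.+-comm 1 s) (ℕ.+-comm 4 s))
      (subst (λ p → 0 ℕ.< 24 ℕ.* (suc s ℕ.* suc s) ℕ.* ((4 ℕ.+ s) ℕ.* p)) (ℕ.+-comm 3 s) (s≤s z≤n)))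
  row-true : row s γ ≡ true
  row-true = allBelow-sound (suc (bound s)) (row s) (allBelow-sound 5 (λ s → allBelow (suc (bound s)) (row s)) search s<5) γ<
  α≡ : α-from s γ r ≡ α
  α≡ = trans (cong (λ m → m / suc (suc (2 ℕ.* s)) ∸ (s ℕ.+ 4)) (trans (sym α-eq) (ℕ.*-comm (suc (suc (2 ℕ.* s))) (α ℕ.+ (s ℕ.+ 4)))))
    (trans (cong (_∸ (s ℕ.+ 4)) (m*n/n≡m (α ℕ.+ (s ℕ.+ 4)) (suc (suc (2 ℕ.* s))))) (ℕ.m+n∸n≡m α (s ℕ.+ 4)))
  β≡ : (r ℕ.* γ) / 2 ≡ β
  β≡ = trans (cong (_/ 2) (trans (sym 2β≡rγ) (ℕ.*-comm 2 β))) (m*n/n≡m β 2)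
  checked : acceptable s γ α β ≡ true
  checked = subst₂ (λ a b → acceptable s γ a b ≡ true) α≡ β≡
    (allBelow-sound 33 (λ r → acceptable s γ (α-from s γ r) ((r ℕ.* γ) / 2)) (∨-resolve (divides?-true γ∣bound) row-true) r<33)

module Rational (s α β γ : ℕ) (s<5 : s ℕ.< 5) (γ≥1 : 1 ℕ.≤ γ) where
  private
    A B C t : ℤ
    A = + α
    B = + β
    C = + γ
    t = + (s ℕ.+ 4)

  private
    C>0 : 0ℤ < C
    C>0 = ℤ.+<+ γ≥1

    constants : ∀ s → s ℕ.< 5 → let t = + (s ℕ.+ 4) in
      + bound s ≡ + 24 * ((t - + 3) * (t - + 3)) * (t * (t - + 1)) × + 2 * (t - + 3) * (+ 2 + t) < + 21 * (t - + 3) + + 2 * (t - + 1) ×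
      0ℤ ≤ t - + 3
    constants 0 _ = refl , ℤ.+<+ (ℕ.m<m+n 12 (s≤s z≤n)) , ℤ.+≤+ z≤n
    constants 1 _ = refl , ℤ.+<+ (ℕ.m<m+n 28 (s≤s z≤n)) , ℤ.+≤+ z≤n
    constants 2 _ = refl , ℤ.+<+ (ℕ.m<m+n 48 (s≤s z≤n)) , ℤ.+≤+ z≤n
    constants 3 _ = refl , ℤ.+<+ (ℕ.m<m+n 72 (s≤s z≤n)) , ℤ.+≤+ z≤n
    constants 4 _ = refl , ℤ.+<+ (ℕ.m<m+n 100 (s≤s z≤n)) , ℤ.+≤+ z≤n
    constants (suc (suc (suc (suc (suc _))))) (s≤s (s≤s (s≤s (s≤s (s≤s ())))))

  module _ (root : (t - + 3) * (A + t) ≡ (B + C) * t - (+ 3 * B + C))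
           (r : ℕ) (γr≡2β : C * + r ≡ + 2 * B)
           (k₂ : ℤ) (γk₂ : C * k₂ ≡ + 6 * A * (A + + 1))
           (coclique : + 4 * (A - + 2) - + 6 * (C - + 1) ≤ + 3 * A) where
    private
      X : ℤ
      X = (t - + 3) * + r + + 2 * (t - + 1)

      2T[A+t]≡CX : + 2 * (t - + 3) * (A + t) ≡ C * X
      2T[A+t]≡CX = begin
        + 2 * (t - + 3) * (A + t)            ≡⟨ ℤ.*-assoc (+ 2) (t - + 3) (A + t) ⟩
        + 2 * ((t - + 3) * (A + t))          ≡⟨ cong (+ 2 *_) root ⟩
        + 2 * ((B + C) * t - (+ 3 * B + C))  ≡⟨ lemma B C t ⟩
        (t - + 3) * (+ 2 * B) + + 2 * (t - + 1) * C ≡⟨ cong (λ u → (t - + 3) * u + + 2 * (t - + 1) * C) γr≡2β ⟨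
        (t - + 3) * (C * + r) + + 2 * (t - + 1) * C ≡⟨ lemma′ C t (+ r) ⟩
        C * X                                ∎
        where
        open ≡-Reasoning
        lemma : ∀ B C t → + 2 * ((B + C) * t - (+ 3 * B + C)) ≡ (t - + 3) * (+ 2 * B) + + 2 * (t - + 1) * C
        lemma = ℤRing.solve-∀
        lemma′ : ∀ C t r → (t - + 3) * (C * r) + + 2 * (t - + 1) * C ≡ C * ((t - + 3) * r + + 2 * (t - + 1))
        lemma′ = ℤRing.solve-∀

      -- As C divides 2 (t - 3) (A + t), the number A may be replaced by - t in 4 (t - 3)² * 6 A (A
      -- + 1) modulo C. That product is a multiple of C, and the replacement gives 24 (t - 3)² t (t
      -- - 1).
      γ∣bound : γ ∣ bound s
      γ∣bound = abs-∣ {+ bound s} {C} {q} (trans (proj₁ (constants s s<5)) (begin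
        + 24 * ((t - + 3) * (t - + 3)) * (t * (t - + 1))
          ≡⟨ lemma A t ⟩
        + 4 * ((t - + 3) * (t - + 3)) * (+ 6 * A * (A + + 1)) - (+ 6 * (+ 2 * (t - + 3) * (A + t) * (+ 2 * (t - + 3) * (A + t) - + 2 * (t - + 3) * (+ 2 * t - + 1))))
          ≡⟨ cong₂ (λ u w → + 4 * ((t - + 3) * (t - + 3)) * u - (+ 6 * (w * (w - + 2 * (t - + 3) * (+ 2 * t - + 1))))) (sym γk₂) 2T[A+t]≡CX ⟩
        + 4 * ((t - + 3) * (t - + 3)) * (C * k₂) - (+ 6 * (C * X * (C * X - + 2 * (t - + 3) * (+ 2 * t - + 1))))
          ≡⟨ lemma′ C t k₂ X ⟩
        C * q ∎))
        where
        open ≡-Reasoning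
        q : ℤ
        q = + 4 * ((t - + 3) * (t - + 3)) * k₂ - + 6 * (X * (C * X - + 2 * (t - + 3) * (+ 2 * t - + 1)))
        lemma : ∀ A t → + 24 * ((t - + 3) * (t - + 3)) * (t * (t - + 1)) ≡
          + 4 * ((t - + 3) * (t - + 3)) * (+ 6 * A * (A + + 1)) - (+ 6 * (+ 2 * (t - + 3) * (A + t) * (+ 2 * (t - + 3) * (A + t) - + 2 * (t - + 3) * (+ 2 * t - + 1))))
        lemma = ℤRing.solve-∀
        lemma′ : ∀ C t k₂ X → + 4 * ((t - + 3) * (t - + 3)) * (C * k₂) - (+ 6 * (C * X * (C * X - + 2 * (t - + 3) * (+ 2 * t - + 1)))) ≡
          C * (+ 4 * ((t - + 3) * (t - + 3)) * k₂ - + 6 * (X * (C * X - + 2 * (t - + 3) * (+ 2 * t - + 1))))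
        lemma′ = ℤRing.solve-∀

      A≤6C+2 : A ≤ + 6 * C + + 2
      A≤6C+2 = subst₂ _≤_ (lemma A C) (lemma′ A C) (ℤ.+-monoˡ-≤ (+ 6 * C + + 2 - + 3 * A) coclique)
        where
        lemma : ∀ A C → + 4 * (A - + 2) - + 6 * (C - + 1) + (+ 6 * C + + 2 - + 3 * A) ≡ A
        lemma = ℤRing.solve-∀
        lemma′ : ∀ A C → + 3 * A + (+ 6 * C + + 2 - + 3 * A) ≡ + 6 * C + + 2
        lemma′ = ℤRing.solve-∀

      -- For r ≥ 33, the equation 2 (t - 3) (A + t) = C X and the bound A ≤ 6 C + 2 give C (21 (t -
      -- 3) + 2 (t - 1)) ≤ 2 (t - 3) (t + 2), where 21 = 33 - 12. For C ≥ 1 this contradicts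
      -- `constants`.
      r<33 : r ℕ.< 33
      r<33 = ℕ.≰⇒> λ 33≤r → ℤ.<⇒≱ (proj₁ (proj₂ (constants s s<5))) (ℤ.≤-trans (shrink 33≤r) (ℤ.≤-reflexive refl))
        where
        T≥0 : 0ℤ ≤ t - + 3
        T≥0 = proj₂ (proj₂ (constants s s<5))
        instance
          T-nonNeg : ℤ.NonNegative (t - + 3)
          T-nonNeg = ℤ.nonNegative T≥0
          C-nonNeg : ℤ.NonNegative C
          C-nonNeg = ℤ.nonNegative (ℤ.<⇒≤ C>0)
        K₁ K₂ : ℤ
        K₁ = + 21 * (t - + 3) + + 2 * (t - + 1)
        K₂ = + 2 * (t - + 3) * (+ 2 + t)
        K₁≥0 : 0ℤ ≤ K₁
        K₁≥0 = ℤ.≤-trans (K₂≥0) (ℤ.<⇒≤ (proj₁ (proj₂ (constants s s<5))))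
          where
          K₂≥0 : 0ℤ ≤ K₂
          K₂≥0 = subst (_≤ K₂) (ℤ.*-zeroʳ (+ 2 * (t - + 3))) (ℤ.*-monoˡ-≤-nonNeg (+ 2 * (t - + 3)) {{ℤ.nonNegative (subst (_≤ + 2 * (t - + 3)) (ℤ.*-zeroʳ (+ 2)) (ℤ.*-monoˡ-≤-nonNeg (+ 2) T≥0))}} (ℤ.+≤+ z≤n))
        shrink : 33 ℕ.≤ r → K₁ ≤ K₂
        shrink 33≤r = ℤ.≤-trans (subst (_≤ C * K₁) (ℤ.*-identityˡ K₁) (ℤ.*-monoʳ-≤-nonNeg K₁ {{ℤ.nonNegative K₁≥0}} (ℤ.+≤+ γ≥1)))
          (subst₂ _≤_ (lemma C t) (lemma′ C t) (ℤ.+-monoˡ-≤ (ℤ.- (+ 12 * (t - + 3) * C)) (ℤ.≤-trans big (ℤ.≤-trans (ℤ.≤-reflexive (sym 2T[A+t]≡CX)) small))))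
          where
          big : C * ((t - + 3) * + 33 + + 2 * (t - + 1)) ≤ C * X
          big = ℤ.*-monoˡ-≤-nonNeg C (ℤ.+-monoˡ-≤ (+ 2 * (t - + 1)) (ℤ.*-monoˡ-≤-nonNeg (t - + 3) (ℤ.+≤+ 33≤r)))
          small : + 2 * (t - + 3) * (A + t) ≤ + 2 * (t - + 3) * (+ 6 * C + + 2 + t)
          small = ℤ.*-monoˡ-≤-nonNeg (+ 2 * (t - + 3)) {{ℤ.nonNegative (subst (_≤ + 2 * (t - + 3)) (ℤ.*-zeroʳ (+ 2)) (ℤ.*-monoˡ-≤-nonNeg (+ 2) T≥0))}} (ℤ.+-monoˡ-≤ t A≤6C+2)
          lemma : ∀ C t → C * ((t - + 3) * + 33 + + 2 * (t - + 1)) + ℤ.- (+ 12 * (t - + 3) * C) ≡ C * (+ 21 * (t - + 3) + + 2 * (t - + 1))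
          lemma = ℤRing.solve-∀
          lemma′ : ∀ C t → + 2 * (t - + 3) * (+ 6 * C + + 2 + t) + ℤ.- (+ 12 * (t - + 3) * C) ≡ + 2 * (t - + 3) * (+ 2 + t)
          lemma′ = ℤRing.solve-∀

      2β≡rγ : 2 ℕ.* β ≡ r ℕ.* γ
      2β≡rγ = ℤ.+-injective (trans (ℤ.pos-* 2 β) (trans (sym γr≡2β) (trans (ℤ.*-comm C (+ r)) (sym (ℤ.pos-* r γ)))))

      α-eq : suc (suc (2 ℕ.* s)) ℕ.* (α ℕ.+ (s ℕ.+ 4)) ≡ γ ℕ.* ((s ℕ.+ 1) ℕ.* r ℕ.+ 2 ℕ.* (s ℕ.+ 3))
      α-eq = ℤ.+-injective (begin
        + (suc (suc (2 ℕ.* s)) ℕ.* (α ℕ.+ (s ℕ.+ 4)))        ≡⟨ ℤ.pos-* (suc (suc (2 ℕ.* s))) (α ℕ.+ (s ℕ.+ 4)) ⟩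
        (+ 2 + + (2 ℕ.* s)) * (A + t)                         ≡⟨ cong (λ u → (+ 2 + u) * (A + t)) (ℤ.pos-* 2 s) ⟩
        (+ 2 + + 2 * + s) * (A + t)                           ≡⟨ cong (_* (A + t)) (lemma (+ s)) ⟩
        + 2 * (t - + 3) * (A + t)                             ≡⟨ 2T[A+t]≡CX ⟩
        C * X                                                 ≡⟨ lemma′ C (+ s) (+ r) ⟩
        C * ((+ s + + 1) * + r + + 2 * (+ s + + 3))           ≡⟨ cong (C *_) (cong₂ _+_ (ℤ.pos-* (s ℕ.+ 1) r) (ℤ.pos-* 2 (s ℕ.+ 3))) ⟨
        C * + ((s ℕ.+ 1) ℕ.* r ℕ.+ 2 ℕ.* (s ℕ.+ 3))           ≡⟨ ℤ.pos-* γ _ ⟨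
        + (γ ℕ.* ((s ℕ.+ 1) ℕ.* r ℕ.+ 2 ℕ.* (s ℕ.+ 3)))       ∎)
        where
        open ≡-Reasoning
        lemma : ∀ s → + 2 + + 2 * s ≡ + 2 * (s + + 4 - + 3)
        lemma = ℤRing.solve-∀
        lemma′ : ∀ C s r → C * ((s + + 4 - + 3) * r + + 2 * (s + + 4 - + 1)) ≡ C * ((s + + 1) * r + + 2 * (s + + 3))
        lemma′ = ℤRing.solve-∀

    classified : feasible A B C t ≡ true → (α , β , γ) ∈ candidates
    classified = search-sound s α β γ r s<5 γ≥1 γ∣bound r<33 2β≡rγ α-eq

-- Irrational eigenvalues

private
  -- The first argument 0, 1, 2 encodes m = 3, 4, 5 in the relation `m * F ≡ Q` of `Irrational`,
  -- with α eliminated and s = β + γ.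
  equation? : ℕ → ℕ → ℕ → Bool
  equation? 0 s r = 14 ℕ.* s ℕ.+ 12 ≡ᵇ 9 ℕ.* r ℕ.* s
  equation? 1 s r = 20 ℕ.* s ℕ.+ 4 ℕ.* r ≡ᵇ 6 ℕ.* r ℕ.* s
  equation? _ s r = 26 ℕ.* s ℕ.+ 4 ℕ.* r ≡ᵇ 3 ℕ.* r ℕ.* s ℕ.+ 20

  no-solution? : ℕ → ℕ → ℕ → Bool
  no-solution? k s r = not ((1 ℕ.≤ᵇ s) ∧ (2 ℕ.≤ᵇ r) ∧ ((2 ℕ.* s) % (2 ℕ.+ r) ≡ᵇ 0) ∧ equation? k s r)

  no-solutions : allBelow 3 (λ k → allBelow 17 (λ s → allBelow 33 (no-solution? k s))) ≡ true
  no-solutions = refl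

  ≡ᵇ-true : ∀ {m n} → m ≡ n → (m ≡ᵇ n) ≡ true
  ≡ᵇ-true {m} refl = go m
    where
    go : ∀ m → (m ≡ᵇ m) ≡ true
    go zero    = refl
    go (suc m) = go m

  ≤ᵇ-true : ∀ {m n} → m ℕ.≤ n → (m ℕ.≤ᵇ n) ≡ true
  ≤ᵇ-true {m} {n} m≤n with m ℕ.≤ᵇ n | ℕ.≤⇒≤ᵇ m≤n
  ... | true | _ = refl

  refute : ∀ k s r γ → k ℕ.< 3 → 1 ℕ.≤ s → s ℕ.≤ 16 → 2 ℕ.≤ r → 1 ℕ.≤ γ → 2 ℕ.* s ≡ γ ℕ.* (2 ℕ.+ r) → equation? k s r ≡ true → ⊥
  refute k s r γ k<3 s≥1 s≤16 r≥2 γ≥1 2s≡ eq = contradiction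
    (trans (sym checked) (cong not (cong₂ _∧_ (≤ᵇ-true s≥1) (cong₂ _∧_ (≤ᵇ-true r≥2) (cong₂ _∧_ (≡ᵇ-true divisible) eq))))) λ ()
    where
    divisible : (2 ℕ.* s) % (2 ℕ.+ r) ≡ 0
    divisible = trans (cong (_% (2 ℕ.+ r)) 2s≡) (m*n%n≡0 γ (2 ℕ.+ r))
    r<33 : r ℕ.< 33
    r<33 = ℕ.≤-trans (ℕ.≤-trans (ℕ.n≤1+n (suc r)) (ℕ.≤-trans (ℕ.m≤m+n (2 ℕ.+ r) 0) (ℕ.≤-trans (ℕ.*-monoˡ-≤ (2 ℕ.+ r) γ≥1) (ℕ.≤-trans (ℕ.≤-reflexive (sym 2s≡)) (ℕ.*-monoʳ-≤ 2 s≤16))))) (ℕ.n≤1+n 32)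
    checked : no-solution? k s r ≡ true
    checked = allBelow-sound 33 (no-solution? k s) (allBelow-sound 17 (λ s → allBelow 33 (no-solution? k s))
      (allBelow-sound 3 (λ k → allBelow 17 (λ s → allBelow 33 (no-solution? k s))) no-solutions k<3) (s≤s s≤16)) r<33

  -- Each equation below bounds s once r is bounded away from its pole.
  bound₃ : ∀ s r → 2 ℕ.≤ r → 14 ℕ.* s ℕ.+ 12 ≡ 9 ℕ.* r ℕ.* s → s ℕ.≤ 16
  bound₃ s r r≥2 eq = ℕ.≤-trans (ℕ.*-cancelˡ-≤ {s} {3} 4 (ℕ.+-cancelˡ-≤ (14 ℕ.* s) (4 ℕ.* s) 12
    (ℕ.≤-trans (ℕ.≤-reflexive (lemma s)) (ℕ.≤-trans (ℕ.*-monoˡ-≤ s (ℕ.*-monoʳ-≤ 9 r≥2)) (ℕ.≤-reflexive (sym eq)))))) (ℕ.m≤m+n 3 13)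
    where
    lemma : ∀ s → 14 ℕ.* s ℕ.+ 4 ℕ.* s ≡ 18 ℕ.* s
    lemma = ℕRing.solve-∀

  -- The pole is at r = 10 / 3. For r ≤ 3 the left side is larger, and r ≥ 4 gives s ≤ 4.
  bound₄ : ∀ s r → 1 ℕ.≤ s → 20 ℕ.* s ℕ.+ 4 ℕ.* r ≡ 6 ℕ.* r ℕ.* s → s ℕ.≤ 16
  bound₄ s r s≥1 eq with r ℕ.<? 4
  ... | yes (s≤s r≤3) = contradiction
    (ℕ.≤-trans (ℕ.≤-reflexive eq) (ℕ.≤-trans (ℕ.*-monoˡ-≤ s (ℕ.*-monoʳ-≤ 6 r≤3)) ℕ.≤-refl))
    (ℕ.<⇒≱ (ℕ.≤-trans (ℕ.≤-trans (ℕ.≤-trans (ℕ.≤-reflexive (ℕ.+-comm 1 (18 ℕ.* s))) (ℕ.+-monoʳ-≤ (18 ℕ.* s) (ℕ.≤-trans s≥1 (ℕ.m≤m+n s s))))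
      (ℕ.≤-reflexive (lemma s))) (ℕ.m≤m+n (20 ℕ.* s) (4 ℕ.* r))))
    where
    lemma : ∀ s → 18 ℕ.* s ℕ.+ (s ℕ.+ s) ≡ 20 ℕ.* s
    lemma = ℕRing.solve-∀
  ... | no r≮4 with r′ , refl ← ℕ.m≤n⇒∃[o]m+o≡n (ℕ.≮⇒≥ r≮4) = ℕ.≤-trans (ℕ.*-cancelˡ-≤ {s} {4} 4 (ℕ.+-cancelʳ-≤ (4 ℕ.* r′) (4 ℕ.* s) 16
      (ℕ.≤-trans (ℕ.+-monoʳ-≤ (4 ℕ.* s) grow) (ℕ.≤-reflexive (ℕ.+-cancelˡ-≡ (20 ℕ.* s) _ _ (trans (lemma s r′) (trans (sym eq) (lemma′ s r′)))))))) (ℕ.m≤m+n 4 12)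
    where
    grow : 4 ℕ.* r′ ℕ.≤ 6 ℕ.* r′ ℕ.* s
    grow = ℕ.≤-trans (ℕ.*-monoˡ-≤ r′ (ℕ.m≤m+n 4 2)) (ℕ.m≤m*n (6 ℕ.* r′) s {{ℕ.>-nonZero s≥1}})
    lemma : ∀ s r′ → 20 ℕ.* s ℕ.+ (4 ℕ.* s ℕ.+ 6 ℕ.* r′ ℕ.* s) ≡ 6 ℕ.* (4 ℕ.+ r′) ℕ.* s
    lemma = ℕRing.solve-∀
    lemma′ : ∀ s r′ → 20 ℕ.* s ℕ.+ 4 ℕ.* (4 ℕ.+ r′) ≡ 20 ℕ.* s ℕ.+ (16 ℕ.+ 4 ℕ.* r′)
    lemma′ = ℕRing.solve-∀

  -- The pole is at r = 26 / 3. For r ≤ 8 this gives s ≤ 10, and for r ≥ 9 it gives s ≤ 16, the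
  -- origin of the common limit.
  bound₅ : ∀ s r → 2 ℕ.≤ s → 26 ℕ.* s ℕ.+ 4 ℕ.* r ≡ 3 ℕ.* r ℕ.* s ℕ.+ 20 → s ℕ.≤ 16
  bound₅ s r s≥2 eq with r ℕ.<? 9
  ... | yes (s≤s r≤8) = ℕ.≤-trans (ℕ.*-cancelˡ-≤ {s} {10} 2 (ℕ.+-cancelˡ-≤ (24 ℕ.* s) (2 ℕ.* s) 20
      (ℕ.≤-trans (ℕ.≤-reflexive (lemma s)) (ℕ.≤-trans (ℕ.m≤m+n (26 ℕ.* s) (4 ℕ.* r)) (ℕ.≤-trans (ℕ.≤-reflexive eq)
        (ℕ.+-monoˡ-≤ 20 (ℕ.*-monoˡ-≤ s (ℕ.*-monoʳ-≤ 3 r≤8)))))))) (ℕ.m≤m+n 10 6)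
    where
    lemma : ∀ s → 24 ℕ.* s ℕ.+ 2 ℕ.* s ≡ 26 ℕ.* s
    lemma = ℕRing.solve-∀
  ... | no r≮9 with r′ , refl ← ℕ.m≤n⇒∃[o]m+o≡n (ℕ.≮⇒≥ r≮9) = ℕ.+-cancelʳ-≤ (4 ℕ.* r′) s 16
      (ℕ.≤-trans (ℕ.+-monoʳ-≤ s grow) (ℕ.≤-reflexive (ℕ.+-cancelˡ-≡ (26 ℕ.* s ℕ.+ 20) _ _ (trans (lemma s r′) (trans (sym eq) (lemma′ s r′))))))
    where
    grow : 4 ℕ.* r′ ℕ.≤ 3 ℕ.* r′ ℕ.* s
    grow = ℕ.≤-trans (ℕ.*-monoˡ-≤ r′ (ℕ.m≤m+n 4 2)) (ℕ.≤-trans (ℕ.≤-reflexive (six r′)) (ℕ.*-monoʳ-≤ (3 ℕ.* r′) s≥2))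
      where
      six : ∀ r′ → 6 ℕ.* r′ ≡ 3 ℕ.* r′ ℕ.* 2
      six = ℕRing.solve-∀
    lemma : ∀ s r′ → 26 ℕ.* s ℕ.+ 20 ℕ.+ (s ℕ.+ 3 ℕ.* r′ ℕ.* s) ≡ 3 ℕ.* (9 ℕ.+ r′) ℕ.* s ℕ.+ 20
    lemma = ℕRing.solve-∀
    lemma′ : ∀ s r′ → 26 ℕ.* s ℕ.+ 4 ℕ.* (9 ℕ.+ r′) ≡ 26 ℕ.* s ℕ.+ 20 ℕ.+ (16 ℕ.+ 4 ℕ.* r′)
    lemma′ = ℕRing.solve-∀

  -- The case m = 1: for r ≥ 2 each term on the right exceeds its counterpart on the left.
  small₁ : ∀ s r → 1 ℕ.≤ s → 2 ℕ.≤ r → 2 ℕ.* s ℕ.+ 12 ≢ 15 ℕ.* r ℕ.* s ℕ.+ 20 ℕ.* r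
  small₁ s r s≥1 r≥2 = ℕ.<⇒≢ (ℕ.+-mono-≤-< (ℕ.*-monoˡ-≤ s (ℕ.≤-trans (ℕ.m≤m+n 2 28) (ℕ.*-monoʳ-≤ 15 r≥2))) (ℕ.≤-trans (ℕ.m≤m+n 13 27) (ℕ.*-monoʳ-≤ 20 r≥2)))

  small₂ : ∀ s r → 1 ℕ.≤ s → 2 ℕ.≤ r → 8 ℕ.* s ℕ.+ 16 ≢ 12 ℕ.* r ℕ.* s ℕ.+ 8 ℕ.* r
  small₂ s r s≥1 r≥2 = ℕ.<⇒≢ (ℕ.+-mono-<-≤ (ℕ.<-≤-trans (ℕ.*-monoˡ-< s {{ℕ.>-nonZero s≥1}} (ℕ.m<m+n 8 {16} (s≤s z≤n))) (ℕ.*-monoˡ-≤ s (ℕ.*-monoʳ-≤ 12 r≥2))) (ℕ.*-monoʳ-≤ 8 r≥2))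

-- The irrational part of the norm of an irrational eigenvalue, split into its positive and negative terms.
Vanishing : (A B C : ℤ) → Set
Vanishing A B C = (B + C - A + + 3) * (+ 2 * (A + + 1) * C + (B + C) * (B + C) + + 2 * A * B) ≡
  + 2 * (B + C) * (+ 3 * B + C) + + 12 * A * B

module Irrational (α β γ r : ℕ) (α≥3 : 3 ℕ.≤ α) (β≥1 : 1 ℕ.≤ β) (γ≥1 : 1 ℕ.≤ γ)
  (γr≡2β : + γ * + r ≡ + 2 * + β)
  (krein : (+ α + + 1) * (+ γ * + γ) ≤ (+ α + + 9) * (+ β * + β))
  (vanishing : Vanishing (+ α) (+ β) (+ γ)) where
  private
    -- Here m is the sum of the two roots t.
    A B C R s m : ℤ
    A = + α
    B = + β
    C = + γ
    R = + r
    s = B + C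
    m = B + C - A + + 3

    nn : ∀ n → 0ℤ ≤ + n
    nn n = ℤ.+≤+ z≤n

    -- The value r = 1 means γ = 2 β, and then the Krein condition becomes 3 α ≤ 5.
    r≥2 : 2 ℕ.≤ r
    r≥2 = go r γr≡2β
      where
      go : ∀ r → C * + r ≡ + 2 * B → 2 ℕ.≤ r
      go 0 eq = contradiction (subst (1 ℕ.≤_) (ℤ.+-injective (ℤ.*-cancelˡ-≡ (+ 2) B 0ℤ (trans (sym eq) (ℤ.*-zeroʳ C)))) β≥1) λ ()
      go 1 eq = contradiction (ℤ.≤-trans (lemma₁ (ℤ.*-cancelʳ-≤-pos _ _ (B * B) {{BB-pos}} (subst₂ _≤_ (lemma₂ A B) refl
          (subst (λ c → (A + + 1) * (c * c) ≤ (A + + 9) * (B * B)) (trans (sym (ℤ.*-identityʳ C)) eq) krein)))) ℤ.≤-refl)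
          (ℤ.<⇒≱ (ℤ.+<+ (ℕ.≤-trans (ℕ.m≤m+n 6 3) (ℕ.*-monoʳ-≤ 3 α≥3))))
        where
        BB-pos : ℤ.Positive (B * B)
        BB-pos = ℤ.positive (subst (0ℤ <_) (ℤ.pos-* β β) (ℤ.+<+ (ℕ.*-mono-≤ β≥1 β≥1)))
        lemma₂ : ∀ A B → (A + + 1) * (+ 2 * B * (+ 2 * B)) ≡ + 4 * (A + + 1) * (B * B)
        lemma₂ = ℤRing.solve-∀
        lemma₁ : + 4 * (A + + 1) ≤ A + + 9 → + (3 ℕ.* α) ≤ + 5
        lemma₁ le = subst₂ _≤_ (trans (l A) (sym (ℤ.pos-* 3 α))) (l′ A) (ℤ.+-monoˡ-≤ (ℤ.- A + ℤ.- + 4) le)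
          where
          l : ∀ A → + 4 * (A + + 1) + (ℤ.- A + ℤ.- + 4) ≡ + 3 * A
          l = ℤRing.solve-∀
          l′ : ∀ A → A + + 9 + (ℤ.- A + ℤ.- + 4) ≡ + 5
          l′ = ℤRing.solve-∀
      go (suc (suc r)) _ = s≤s (s≤s z≤n)

    -- After the substitutions 2 β = γ r and 2 s = γ (r + 2), both sides of twice the vanishing
    -- equation are multiples of γ. The quotients are m F and Q.
    F Q : ℤ
    F = + 2 * A * (R + + 2) + + 4 + s * (R + + 2)
    Q = + 2 * s * (+ 3 * R + + 2) + + 12 * A * R

    2s≡C[R+2] : + 2 * s ≡ C * (R + + 2)
    2s≡C[R+2] = trans (lemma B C) (trans (cong (_+ + 2 * C) (sym γr≡2β)) (lemma′ C R))
      where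
      lemma : ∀ B C → + 2 * (B + C) ≡ + 2 * B + + 2 * C
      lemma = ℤRing.solve-∀
      lemma′ : ∀ C R → C * R + + 2 * C ≡ C * (R + + 2)
      lemma′ = ℤRing.solve-∀

    linear : m * F ≡ Q
    linear = ℤ.*-cancelˡ-≡ C (m * F) Q {{ℤ.>-nonZero (ℤ.+<+ γ≥1)}} (begin
      C * (m * F)
        ≡⟨ lemma₁ A C R s m ⟩
      m * (+ 4 * (A + + 1) * C + C * (R + + 2) * s + + 2 * A * (C * R))
        ≡⟨ cong₂ (λ p q → m * (+ 4 * (A + + 1) * C + p * s + + 2 * A * q)) (sym 2s≡C[R+2]) γr≡2β ⟩
      m * (+ 4 * (A + + 1) * C + + 2 * s * s + + 2 * A * (+ 2 * B))
        ≡⟨ lemma₂ A B C s m ⟩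
      + 2 * (m * (+ 2 * (A + + 1) * C + s * s + + 2 * A * B))
        ≡⟨ cong (+ 2 *_) vanishing ⟩
      + 2 * (+ 2 * s * (+ 3 * B + C) + + 12 * A * B)
        ≡⟨ lemma₃ A B C s ⟩
      + 2 * s * (+ 3 * (+ 2 * B) + + 2 * C) + + 12 * A * (+ 2 * B)
        ≡⟨ cong (λ u → + 2 * s * (+ 3 * u + + 2 * C) + + 12 * A * u) γr≡2β ⟨
      + 2 * s * (+ 3 * (C * R) + + 2 * C) + + 12 * A * (C * R)
        ≡⟨ lemma₄ A C R s ⟩
      C * Q ∎)
      where
      open ≡-Reasoning
      lemma₁ : ∀ A C R s m → C * (m * (+ 2 * A * (R + + 2) + + 4 + s * (R + + 2))) ≡ m * (+ 4 * (A + + 1) * C + C * (R + + 2) * s + + 2 * A * (C * R))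
      lemma₁ = ℤRing.solve-∀
      lemma₂ : ∀ A B C s m → m * (+ 4 * (A + + 1) * C + + 2 * s * s + + 2 * A * (+ 2 * B)) ≡ + 2 * (m * (+ 2 * (A + + 1) * C + s * s + + 2 * A * B))
      lemma₂ = ℤRing.solve-∀
      lemma₃ : ∀ A B C s → + 2 * (+ 2 * s * (+ 3 * B + C) + + 12 * A * B) ≡ + 2 * s * (+ 3 * (+ 2 * B) + + 2 * C) + + 12 * A * (+ 2 * B)
      lemma₃ = ℤRing.solve-∀
      lemma₄ : ∀ A C R s → + 2 * s * (+ 3 * (C * R) + + 2 * C) + + 12 * A * (C * R) ≡ C * (+ 2 * s * (+ 3 * R + + 2) + + 12 * A * R)
      lemma₄ = ℤRing.solve-∀

    F>0 : 0ℤ < F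
    F>0 = ℤ.+-mono-<-≤ (ℤ.+-mono-≤-< (*-nonNeg (*-nonNeg (nn 2) (nn α)) (nn (r ℕ.+ 2))) (ℤ.+<+ {0} {4} (s≤s z≤n))) (*-nonNeg (nn (β ℕ.+ γ)) (nn (r ℕ.+ 2)))

    Q>0 : 0ℤ < Q
    Q>0 = ℤ.+-mono-<-≤ (subst (_< + 2 * s * (+ 3 * R + + 2)) (ℤ.*-zeroʳ (+ 2 * s))
      (ℤ.*-monoˡ-<-pos (+ 2 * s) {{ℤ.positive (ℤ.*-monoˡ-<-pos (+ 2) {0ℤ} {s} (ℤ.+<+ (ℕ.≤-trans β≥1 (ℕ.m≤m+n β γ))))}}
        (ℤ.+-mono-≤-< (*-nonNeg (nn 3) (nn r)) (ℤ.+<+ {0} {2} (s≤s z≤n)))))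
      (*-nonNeg (*-nonNeg (nn 12) (nn α)) (nn r))

    m>0 : 0ℤ < m
    m>0 = ℤ.≰⇒> λ m≤0 → ℤ.<⇒≱ Q>0 (subst₂ _≤_ linear (ℤ.*-zeroˡ F) (ℤ.*-monoʳ-≤-nonNeg F {{ℤ.nonNegative (ℤ.<⇒≤ F>0)}} m≤0))

    -- The difference 6 F - Q is 24 (A + 1) + 8 s, which is positive.
    m<6 : m < + 6
    m<6 = ℤ.*-cancelʳ-<-nonNeg F {{ℤ.nonNegative (ℤ.<⇒≤ F>0)}} (subst₂ _<_ (trans (ℤ.+-identityʳ Q) (sym linear)) (lemma A R s)
      (ℤ.+-monoʳ-< Q (ℤ.+-mono-<-≤ {0ℤ} {+ 24 * (A + + 1)} {0ℤ} {+ 8 * s}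
        (ℤ.*-monoˡ-<-pos (+ 24) {0ℤ} {A + + 1} (ℤ.+<+ (ℕ.m≤n+m 1 α))) (*-nonNeg (nn 8) (nn (β ℕ.+ γ))))))
      where
      lemma : ∀ A R s → + 2 * s * (+ 3 * R + + 2) + + 12 * A * R + (+ 24 * (A + + 1) + + 8 * s) ≡ + 6 * (+ 2 * A * (R + + 2) + + 4 + s * (R + + 2))
      lemma = ℤRing.solve-∀

    σ : ℕ
    σ = β ℕ.+ γ

    2σ≡γ[2+r] : 2 ℕ.* σ ≡ γ ℕ.* (2 ℕ.+ r)
    2σ≡γ[2+r] = ℤ.+-injective (trans (ℤ.pos-* 2 σ) (trans 2s≡C[R+2] (trans (cong (C *_) (ℤ.+-comm R (+ 2))) (sym (ℤ.pos-* γ (2 ℕ.+ r))))))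

    σ≥2 : 2 ℕ.≤ σ
    σ≥2 = ℕ.+-mono-≤ β≥1 γ≥1
    σ≥1 : 1 ℕ.≤ σ
    σ≥1 = ℕ.≤-trans (ℕ.n≤1+n 1) σ≥2

    -- The relation m F = Q after eliminating α = σ + 3 - m.
    reduced : ∀ {k} → m ≡ k → k * (+ 2 * (s + + 3 - k) * (R + + 2) + + 4 + s * (R + + 2)) ≡ + 2 * s * (+ 3 * R + + 2) + + 12 * (s + + 3 - k) * R
    reduced {k} m≡k = subst₂ (λ a k → k * (+ 2 * a * (R + + 2) + + 4 + s * (R + + 2)) ≡ + 2 * s * (+ 3 * R + + 2) + + 12 * a * R)
      (trans (lemma A B C) (cong (λ k → s + + 3 - k) m≡k)) m≡k linear
      where
      lemma : ∀ A B C → A ≡ B + C + + 3 - (B + C - A + + 3)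
      lemma = ℤRing.solve-∀

    transfer : ∀ {i j k l : ℤ} → i - j ≡ k - l → i ≡ j → k ≡ l
    transfer {i} {j} {k} {l} diff i≡j = ℤ.i-j≡0⇒i≡j k l (trans (sym diff) (trans (cong (_- j) i≡j) (ℤ.+-inverseʳ j)))

    hom₃ : ∀ a → + (a ℕ.* r ℕ.* σ) ≡ + a * R * s
    hom₃ a = trans (ℤ.pos-* (a ℕ.* r) σ) (cong (_* s) (ℤ.pos-* a r))

    case : ∀ k → m ≡ + k → ⊥
    case 0 m≡ = ℤ.<-irrefl (sym m≡) m>0
    case 1 m≡ = small₁ σ r σ≥1 r≥2 (ℤ.+-injective (begin
      + (2 ℕ.* σ) + + 12                        ≡⟨ cong (_+ + 12) (ℤ.pos-* 2 σ) ⟩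
      + 2 * s + + 12                            ≡⟨ transfer (lemma s R) (reduced m≡) ⟩
      + 15 * R * s + + 20 * R                   ≡⟨ cong₂ _+_ (hom₃ 15) (ℤ.pos-* 20 r) ⟨
      + (15 ℕ.* r ℕ.* σ ℕ.+ 20 ℕ.* r)           ∎))
      where
      open ≡-Reasoning
      lemma : ∀ s R → + 1 * (+ 2 * (s + + 3 - + 1) * (R + + 2) + + 4 + s * (R + + 2)) - (+ 2 * s * (+ 3 * R + + 2) + + 12 * (s + + 3 - + 1) * R) ≡
        (+ 2 * s + + 12) - (+ 15 * R * s + + 20 * R)
      lemma = ℤRing.solve-∀
    case 2 m≡ = small₂ σ r σ≥1 r≥2 (ℤ.+-injective (begin
      + (8 ℕ.* σ) + + 16                        ≡⟨ cong (_+ + 16) (ℤ.pos-* 8 σ) ⟩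
      + 8 * s + + 16                            ≡⟨ transfer (lemma s R) (reduced m≡) ⟩
      + 12 * R * s + + 8 * R                    ≡⟨ cong₂ _+_ (hom₃ 12) (ℤ.pos-* 8 r) ⟨
      + (12 ℕ.* r ℕ.* σ ℕ.+ 8 ℕ.* r)            ∎))
      where
      open ≡-Reasoning
      lemma : ∀ s R → + 2 * (+ 2 * (s + + 3 - + 2) * (R + + 2) + + 4 + s * (R + + 2)) - (+ 2 * s * (+ 3 * R + + 2) + + 12 * (s + + 3 - + 2) * R) ≡
        (+ 8 * s + + 16) - (+ 12 * R * s + + 8 * R)
      lemma = ℤRing.solve-∀
    case 3 m≡ = refute 0 σ r γ (s≤s z≤n) σ≥1 (bound₃ σ r r≥2 eq) r≥2 γ≥1 2σ≡γ[2+r] (≡ᵇ-true eq)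
      where
      open ≡-Reasoning
      lemma : ∀ s R → + 3 * (+ 2 * (s + + 3 - + 3) * (R + + 2) + + 4 + s * (R + + 2)) - (+ 2 * s * (+ 3 * R + + 2) + + 12 * (s + + 3 - + 3) * R) ≡
        (+ 14 * s + + 12) - (+ 9 * R * s)
      lemma = ℤRing.solve-∀
      eq : 14 ℕ.* σ ℕ.+ 12 ≡ 9 ℕ.* r ℕ.* σ
      eq = ℤ.+-injective (trans (cong (_+ + 12) (ℤ.pos-* 14 σ)) (trans (transfer (lemma s R) (reduced m≡)) (sym (hom₃ 9))))
    case 4 m≡ = refute 1 σ r γ (s≤s (s≤s z≤n)) σ≥1 (bound₄ σ r σ≥1 eq) r≥2 γ≥1 2σ≡γ[2+r] (≡ᵇ-true eq)
      where
      lemma : ∀ s R → + 4 * (+ 2 * (s + + 3 - + 4) * (R + + 2) + + 4 + s * (R + + 2)) - (+ 2 * s * (+ 3 * R + + 2) + + 12 * (s + + 3 - + 4) * R) ≡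
        (+ 20 * s + + 4 * R) - (+ 6 * R * s)
      lemma = ℤRing.solve-∀
      eq : 20 ℕ.* σ ℕ.+ 4 ℕ.* r ≡ 6 ℕ.* r ℕ.* σ
      eq = ℤ.+-injective (trans (cong₂ _+_ (ℤ.pos-* 20 σ) (ℤ.pos-* 4 r)) (trans (transfer (lemma s R) (reduced m≡)) (sym (hom₃ 6))))
    case 5 m≡ = refute 2 σ r γ (s≤s (s≤s (s≤s z≤n))) σ≥1 (bound₅ σ r σ≥2 eq) r≥2 γ≥1 2σ≡γ[2+r] (≡ᵇ-true eq)
      where
      lemma : ∀ s R → + 5 * (+ 2 * (s + + 3 - + 5) * (R + + 2) + + 4 + s * (R + + 2)) - (+ 2 * s * (+ 3 * R + + 2) + + 12 * (s + + 3 - + 5) * R) ≡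
        (+ 26 * s + + 4 * R) - (+ 3 * R * s + + 20)
      lemma = ℤRing.solve-∀
      eq : 26 ℕ.* σ ℕ.+ 4 ℕ.* r ≡ 3 ℕ.* r ℕ.* σ ℕ.+ 20
      eq = ℤ.+-injective (trans (cong₂ _+_ (ℤ.pos-* 26 σ) (ℤ.pos-* 4 r)) (trans (transfer (lemma s R) (reduced m≡)) (cong (_+ + 20) (sym (hom₃ 3)))))
    case (suc (suc (suc (suc (suc (suc k)))))) m≡ = ℤ.<⇒≱ m<6 (subst (+ 6 ≤_) (sym m≡) (ℤ.+≤+ (s≤s (s≤s (s≤s (s≤s (s≤s (s≤s z≤n))))))))

  irrational-impossible : ⊥
  irrational-impossible = go m refl m>0
    where
    go : ∀ i → m ≡ i → 0ℤ < i → ⊥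
    go (+ k)      m≡ _  = case k m≡
    go ℤ.-[1+ k ] m≡ ()

-- The discriminant and the classification of the arrays

parity : ∀ n → ∃[ k ] ((n ≡ k ℕ.+ k) ⊎ (n ≡ suc (k ℕ.+ k)))
parity zero = 0 , inj₁ refl
parity (suc n) with parity n
... | k , inj₁ eq = k , inj₂ (cong suc eq)
... | k , inj₂ eq = suc k , inj₁ (cong suc (trans eq (sym (ℕ.+-suc k k))))

ℤ-parity : ∀ i → ∃[ k ] ((i ≡ + 2 * k) ⊎ (i ≡ + 2 * k + + 1))
ℤ-parity (+ n) with parity n
... | k , inj₁ refl = + k , inj₁ (lemma (+ k))
  where
  lemma : ∀ k → k + k ≡ + 2 * k
  lemma = ℤRing.solve-∀
... | k , inj₂ refl = + k , inj₂ (lemma (+ k))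
  where
  lemma : ∀ k → + 1 + (k + k) ≡ + 2 * k + + 1
  lemma = ℤRing.solve-∀
ℤ-parity ℤ.-[1+ n ] with parity n
... | k , inj₁ refl = ℤ.-[1+ k ] , inj₂ (lemma (+ k))
  where
  lemma : ∀ k → ℤ.- (+ 1 + (k + k)) ≡ + 2 * (ℤ.- (+ 1 + k)) + + 1
  lemma = ℤRing.solve-∀
... | k , inj₂ refl = ℤ.-[1+ k ] , inj₁ (lemma (+ k))
  where
  lemma : ∀ k → ℤ.- (+ 1 + (+ 1 + (k + k))) ≡ + 2 * (ℤ.- (+ 1 + k))
  lemma = ℤRing.solve-∀

2*i≢1 : ∀ i → + 2 * i ≢ + 1
2*i≢1 i eq = contradiction (ℕ.m*n≡1⇒m≡1 2 (abs i) (trans (sym (ℤ.abs-* (+ 2) i)) (cong abs eq))) λ ()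

-- A natural d with d² = n is at most n, so a bounded search decides.
square? : ∀ D → (∃[ d ] D ≡ + d * + d) ⊎ (∀ d → D ≢ d * d)
square? ℤ.-[1+ n ] = inj₂ λ d eq → ℤ.<⇒≱ {ℤ.-[1+ n ]} {0ℤ} ℤ.-<+ (subst (0ℤ ≤_) (sym eq) (square-nonNeg d))
square? (+ n) with ℕ.anyUpTo? (λ d → n ℕ.≟ d ℕ.* d) (suc n)
... | yes (d , _ , n≡d²) = inj₁ (d , trans (cong +_ n≡d²) (ℤ.pos-* d d))
... | no none = inj₂ λ i eq → none (abs i , s≤s (small i eq) , n≡ i eq)
  where
  n≡ : ∀ i → + n ≡ i * i → n ≡ abs i ℕ.* abs i
  n≡ i eq = trans (cong abs eq) (ℤ.abs-* i i)
  m≤m*m : ∀ m → m ℕ.≤ m ℕ.* m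
  m≤m*m zero    = z≤n
  m≤m*m (suc m) = ℕ.m≤m*n (suc m) (suc m)
  small : ∀ i → + n ≡ i * i → abs i ℕ.≤ n
  small i eq = ℕ.≤-trans (m≤m*m (abs i)) (ℕ.≤-reflexive (sym (n≡ i eq)))

module Classification {n} (Γ : Graph n) (G : DistanceRegular Γ 3) {α β γ : ℕ} (H : HasArray G α β γ)
                      (α≥3 : 3 ℕ.≤ α) (a₂≥0 : 0ℤ ≤ + 3 * + α - + β - + γ) where
  open HasArray H
  open Parameters Γ G using (geodesic)
  open ArrayInteger Γ G H
  open ArrayConditions Γ G H
  open Coclique Γ G H using (coclique-bound)

  private
    S P : ℤ
    S = A - + 3 - B - C
    P = + 3 * B + C - + 3 * A

  r∃ : ∃[ r ] C * + r ≡ + 2 * B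
  r∃ = go γ∣2β
    where
    go : ∃[ q ] C * q ≡ + 2 * B → ∃[ r ] C * + r ≡ + 2 * B
    go (+ r , eq) = r , eq
    go (ℤ.-[1+ k ] , eq) = contradiction (ℤ.≤-trans (ℤ.≤-reflexive (sym eq)) (ℤ.<⇒≤ negative)) (ℤ.<⇒≱ 2B>0)
      where
      2B>0 : 0ℤ < + 2 * B
      2B>0 = ℤ.*-monoˡ-<-pos (+ 2) B>0
      negative : C * ℤ.-[1+ k ] < 0ℤ
      negative = subst (C * ℤ.-[1+ k ] <_) (ℤ.*-zeroʳ C) (ℤ.*-monoˡ-<-pos C {{ℤ.positive C>0}} (ℤ.-<+ {k} {0}))

  private
    4-coclique : + 4 * (A - + 2) - + 6 * (C - + 1) ≤ + 3 * A
    4-coclique = coclique-bound 4 small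
      where
      3A-6<3A : + 3 * (A - + 2) < + 3 * A
      3A-6<3A = subst₂ _<_ (lemma A) (ℤ.+-identityʳ (+ 3 * A)) (ℤ.+-monoʳ-< (+ 3 * A) (ℤ.-<+ {5} {0}))
        where
        lemma : ∀ A → + 3 * A + ℤ.-[1+ 5 ] ≡ + 3 * (A - + 2)
        lemma = ℤRing.solve-∀
      A-2≥0 : 0ℤ ≤ A - + 2
      A-2≥0 = ℤ.i≤j⇒0≤j-i {+ 2} {A} (ℤ.+≤+ (ℕ.≤-trans (ℕ.n≤1+n 2) α≥3))
      small : ∀ j → j ℕ.< 4 → + j * (A - + 2) < + 3 * A
      small j (s≤s j≤3) = ℤ.≤-<-trans (ℤ.*-monoʳ-≤-nonNeg (A - + 2) {{ℤ.nonNegative A-2≥0}} (ℤ.+≤+ j≤3)) 3A-6<3A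

    -- At α = 7 four closed neighbourhoods have at most 20 < 21 vertices, so a fifth vertex can be
    -- chosen. For γ = 1 the five neighbourhoods are disjoint and would have 25 vertices.
    5-coclique : ¬ (A ≡ + 7 × C ≡ + 1)
    5-coclique (A≡7 , C≡1) = 25≰21 (subst₂ (λ A C → + 5 * (A - + 2) - + 10 * (C - + 1) ≤ + 3 * A) A≡7 C≡1 (coclique-bound 5 small))
      where
      25≰21 : ¬ (+ 25 ≤ + 21)
      25≰21 (ℤ.+≤+ le) = ℕ.<⇒≱ (ℕ.m<m+n 21 {4} (s≤s z≤n)) le
      small : ∀ j → j ℕ.< 5 → + j * (A - + 2) < + 3 * A
      small j (s≤s j≤4) = subst (λ A → + j * (A - + 2) < + 3 * A) (sym A≡7)
        (ℤ.≤-<-trans (ℤ.*-monoʳ-≤-nonNeg (+ 5) (ℤ.+≤+ j≤4)) (ℤ.+<+ (ℕ.m<m+n 20 {1} (s≤s z≤n))))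

  module Square (d : ℕ) (D≡d² : S * S - + 4 * P ≡ + d * + d) where
    private
      -- The number x = d - S satisfies x² + 2 S x + 4 P = 0, so it cannot be odd.
      half : ∃[ t ] + d - S ≡ + 2 * t
      half = go (ℤ-parity (+ d - S))
        where
        go : ∃[ k ] ((+ d - S ≡ + 2 * k) ⊎ (+ d - S ≡ + 2 * k + + 1)) → ∃[ t ] + d - S ≡ + 2 * t
        go (k , inj₁ eq) = k , eq
        go (k , inj₂ eq) = contradiction (begin
          + 2 * (ℤ.- (+ 2 * k * k + + 2 * k + S * x + + 2 * P))
            ≡⟨ lemma k S x P ⟩
          + 1 - ((+ 2 * k + + 1) * (+ 2 * k + + 1) + + 2 * S * x + + 4 * P)
            ≡⟨ cong (λ y → + 1 - (y * y + + 2 * S * x + + 4 * P)) (sym eq) ⟩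
          + 1 - (x * x + + 2 * S * x + + 4 * P)
            ≡⟨ lemma′ (+ d) S P ⟩
          + 1 - (+ d * + d - (S * S - + 4 * P))
            ≡⟨ cong (λ y → + 1 - (+ d * + d - y)) D≡d² ⟩
          + 1 - (+ d * + d - + d * + d)
            ≡⟨ cong (λ y → + 1 - y) (ℤ.+-inverseʳ (+ d * + d)) ⟩
          + 1 ∎) (2*i≢1 _)
          where
          open ≡-Reasoning
          x : ℤ
          x = + d - S
          lemma : ∀ k S x P → + 2 * (ℤ.- (+ 2 * k * k + + 2 * k + S * x + + 2 * P)) ≡ + 1 - ((+ 2 * k + + 1) * (+ 2 * k + + 1) + + 2 * S * x + + 4 * P)
          lemma = ℤRing.solve-∀
          lemma′ : ∀ d S P → + 1 - ((d - S) * (d - S) + + 2 * S * (d - S) + + 4 * P) ≡ + 1 - (d * d - (S * S - + 4 * P))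
          lemma′ = ℤRing.solve-∀

      t : ℤ
      t = proj₁ half

      d≡ : + d ≡ + 2 * t + S
      d≡ = trans (lemma (+ d) S) (cong (_+ S) (proj₂ half))
        where
        lemma : ∀ d S → d ≡ d - S + S
        lemma = ℤRing.solve-∀

      t²+St+P≡0 : t * t + S * t + P ≡ 0ℤ
      t²+St+P≡0 = ℤ.*-cancelˡ-≡ (+ 4) (t * t + S * t + P) 0ℤ (begin
        + 4 * (t * t + S * t + P)                               ≡⟨ lemma t S P ⟩
        (+ 2 * t + S) * (+ 2 * t + S) - (S * S - + 4 * P)       ≡⟨ cong₂ (λ y z → y * y - z) (sym d≡) D≡d² ⟩
        + d * + d - + d * + d                                   ≡⟨ ℤ.+-inverseʳ (+ d * + d) ⟩
        0ℤ                                                      ∎)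
        where
        open ≡-Reasoning
        lemma : ∀ t S P → + 4 * (t * t + S * t + P) ≡ (+ 2 * t + S) * (+ 2 * t + S) - (S * S - + 4 * P)
        lemma = ℤRing.solve-∀

      root : (t - + 3) * (A + t) ≡ (B + C) * t - (+ 3 * B + C)
      root = ℤ.i-j≡0⇒i≡j _ _ (trans (lemma A B C t) t²+St+P≡0)
        where
        lemma : ∀ A B C t → (t - + 3) * (A + t) - ((B + C) * t - (+ 3 * B + C)) ≡ t * t + (A - + 3 - B - C) * t + (+ 3 * B + C - + 3 * A)
        lemma = ℤRing.solve-∀

      -- The polynomial x² + S x + P takes the value - 2 c₂ at 3.
      t>3 : + 3 < t
      t>3 = ℤ.≰⇒> λ t≤3 → ℤ.<⇒≱ (ℤ.*-monoˡ-<-pos (+ 2) C>0) (subst₂ _≤_ product≡2C (ℤ.*-zeroʳ (t - + 3))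
        (ℤ.*-monoˡ-≤-nonPos (t - + 3) {{ℤ.nonPositive (ℤ.i≤j⇒i-j≤0 t≤3)}} (nonneg t≤3)))
        where
        -- As d is the difference of the two roots, d - t + 3 is 3 minus the other root.
        product≡2C : (t - + 3) * (+ d - t + + 3) ≡ + 2 * C
        product≡2C = trans (cong (λ y → (t - + 3) * (y - t + + 3)) d≡) (trans (lemma A B C t)
          (trans (cong (_+ + 2 * C) t²+St+P≡0) (ℤ.+-identityˡ (+ 2 * C))))
          where
          lemma : ∀ A B C t → let S = A - + 3 - B - C ; P = + 3 * B + C - + 3 * A in
            (t - + 3) * (+ 2 * t + S - t + + 3) ≡ t * t + S * t + P + + 2 * C
          lemma = ℤRing.solve-∀
        nonneg : t ≤ + 3 → 0ℤ ≤ + d - t + + 3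
        nonneg t≤3 = subst (0ℤ ≤_) (lemma (+ d) t) (ℤ.+-mono-≤ (ℤ.+≤+ {0} {d} z≤n) (ℤ.i≤j⇒0≤j-i t≤3))
          where
          lemma : ∀ d t → d + (+ 3 - t) ≡ d - t + + 3
          lemma = ℤRing.solve-∀

      natural : ∃[ s ] t ≡ + (s ℕ.+ 4)
      natural = go t t>3
        where
        go : ∀ i → + 3 < i → ∃[ s ] i ≡ + (s ℕ.+ 4)
        go (+ i) (ℤ.+<+ 3<i) = i ℕ.∸ 4 , cong +_ (sym (ℕ.m∸n+n≡m 3<i))

    module _ (s : ℕ) (t≡ : t ≡ + (s ℕ.+ 4)) where
      private
        u : ℤ
        u = + (s ℕ.+ 4)

        root′ : (u - + 3) * (A + u) ≡ (B + C) * u - (+ 3 * B + C)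
        root′ = subst (λ t → (t - + 3) * (A + t) ≡ (B + C) * t - (+ 3 * B + C)) t≡ root

        module Sm = Smallest u (ℤ.+≤+ z≤n) root′

        -- For t ≥ 9 the left side of `krein₁₁₃` is positive and the right side is at most 0.
        s<5 : s ℕ.< 5
        s<5 = ℕ.≰⇒> λ 5≤s → ℤ.<⇒≱ (left>0 5≤s) (ℤ.≤-trans Sm.krein₁₁₃ (right≤0 5≤s))
          where
          left>0 : 5 ℕ.≤ s → 0ℤ < (u - + 3) * C
          left>0 5≤s = subst (_< (u - + 3) * C) (ℤ.*-zeroʳ (u - + 3))
            (ℤ.*-monoˡ-<-pos (u - + 3) {{ℤ.positive (ℤ.+-monoˡ-< (ℤ.- + 3) {+ 3} {u} (ℤ.+<+ (ℕ.m≤n+m 4 s)))}} C>0)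
          right≤0 : 5 ℕ.≤ s → (+ 9 - u) * B ≤ 0ℤ
          right≤0 5≤s = subst ((+ 9 - u) * B ≤_) (ℤ.*-zeroˡ B)
            (ℤ.*-monoʳ-≤-nonNeg B {{ℤ.nonNegative (ℤ.<⇒≤ B>0)}} (ℤ.i≤j⇒i-j≤0 {+ 9} {u} (ℤ.+≤+ (ℕ.+-monoˡ-≤ 4 5≤s))))

        Vn : C * + n ≡ γ-order-value A B C
        Vn = Sizes.γ-order (proj₁ geodesic)

        m₁-divides : abs (C * N) ∣ abs (γ-order-value A B C * (+ 3 * B))
        m₁-divides = go η-multiplicity
          where
          go : ∃[ m ] + n * (+ 3 * B) ≡ + m * N → abs (C * N) ∣ abs (γ-order-value A B C * (+ 3 * B))
          go (m , eq) = abs-∣ {γ-order-value A B C * (+ 3 * B)} {C * N} {+ m} (begin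
            γ-order-value A B C * (+ 3 * B)   ≡⟨ cong (_* (+ 3 * B)) Vn ⟨
            C * + n * (+ 3 * B)               ≡⟨ ℤ.*-assoc C (+ n) (+ 3 * B) ⟩
            C * (+ n * (+ 3 * B))             ≡⟨ cong (C *_) eq ⟩
            C * (+ m * N)                     ≡⟨ lemma C (+ m) N ⟩
            C * N * + m                       ∎)
            where
            open ≡-Reasoning
            lemma : ∀ C m N → C * (m * N) ≡ C * N * m
            lemma = ℤRing.solve-∀

        m₃-divides : abs Sm.N′ ∣ abs (γ-order-value A B C * (+ 6 * A * (A + + 1)))
        m₃-divides = go Sm.multiplicity
          where
          go : ∃[ m ] + n * (C * (+ 6 * A * (A + + 1))) ≡ + m * Sm.N′ → abs Sm.N′ ∣ abs (γ-order-value A B C * (+ 6 * A * (A + + 1)))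
          go (m , eq) = abs-∣ {γ-order-value A B C * (+ 6 * A * (A + + 1))} {Sm.N′} {+ m} (begin
            γ-order-value A B C * (+ 6 * A * (A + + 1)) ≡⟨ cong (_* (+ 6 * A * (A + + 1))) Vn ⟨
            C * + n * (+ 6 * A * (A + + 1))             ≡⟨ lemma C (+ n) (+ 6 * A * (A + + 1)) ⟩
            + n * (C * (+ 6 * A * (A + + 1)))           ≡⟨ eq ⟩
            + m * Sm.N′                                 ≡⟨ ℤ.*-comm (+ m) Sm.N′ ⟩
            Sm.N′ * + m                                 ∎)
            where
            open ≡-Reasoning
            lemma : ∀ C m N → C * m * N ≡ m * (C * N)
            lemma = ℤRing.solve-∀

        even-divides : abs (+ 2 * C) ∣ abs (+ 6 * A * (A + + 1) * second A B C)
        even-divides = go k₂a₂-even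
          where
          go : ∃[ q ] k₂ * second A B C ≡ + 2 * q → abs (+ 2 * C) ∣ abs (+ 6 * A * (A + + 1) * second A B C)
          go (q , eq) = abs-∣ {+ 6 * A * (A + + 1) * second A B C} {+ 2 * C} {q} (begin
            + 6 * A * (A + + 1) * second A B C   ≡⟨ cong (_* second A B C) γk₂≡ ⟨
            C * k₂ * second A B C                ≡⟨ ℤ.*-assoc C k₂ (second A B C) ⟩
            C * (k₂ * second A B C)              ≡⟨ cong (C *_) eq ⟩
            C * (+ 2 * q)                        ≡⟨ lemma C q ⟩
            + 2 * C * q                          ∎)
            where
            open ≡-Reasoning
            lemma : ∀ C q → C * (+ 2 * q) ≡ + 2 * C * q
            lemma = ℤRing.solve-∀

        p²₂₂-divides : abs C ∣ abs (p²₂₂-value A B C)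
        p²₂₂-divides = abs-∣ {p²₂₂-value A B C} {C} {proj₁ γ∣p²₂₂} (sym (proj₂ γ∣p²₂₂))

        not-7-1 : (not (does (A ℤ.≟ + 7)) ∨ not (does (C ℤ.≟ + 1))) ≡ true
        not-7-1 = go (A ℤ.≟ + 7) (C ℤ.≟ + 1)
          where
          go : (p : Dec (A ≡ + 7)) (q : Dec (C ≡ + 1)) → (not (does p) ∨ not (does q)) ≡ true
          go (no _)  _       = refl
          go (yes _) (no _)  = refl
          go (yes p) (yes q) = contradiction (p , q) 5-coclique

        feasible-true : feasible A B C u ≡ true
        feasible-true = ∧-true (dec-true (+ 3 ℤ.≤? A) (ℤ.+≤+ α≥3)) (∧-true (dec-true (0ℤ ℤ.≤? second A B C) a₂≥0)
          (∧-true (dec-true (_ ℤ.≤? _) 4-coclique) (∧-true not-7-1 (∧-true (dec-true (_ ℤ.≤? _) Sm.krein₁₁₃)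
          (∧-true (dec-true (_ ℤ.≤? _) krein₁₁₁) (∧-true (divides?-true m₁-divides) (∧-true (divides?-true m₃-divides)
          (∧-true (divides?-true even-divides) (divides?-true p²₂₂-divides)))))))))

      is-candidate : (α , β , γ) ∈ candidates
      is-candidate = Rational.classified s α β γ s<5 γ≥1 root′ (proj₁ r∃) (proj₂ r∃) k₂ γk₂≡ 4-coclique feasible-true

    square-case : (α , β , γ) ∈ candidates
    square-case = is-candidate (proj₁ natural) (proj₂ natural)

module NonSquare {n} (Γ : Graph n) (G : DistanceRegular Γ 3) {α β γ : ℕ} (H : HasArray G α β γ)
                 (nonsquare : ∀ d → (+ α - + 3 - + β - + γ) * (+ α - + 3 - + β - + γ) - + 4 * (+ 3 * + β + + γ - + 3 * + α) ≢ d * d) where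
  open ArrayInteger Γ G H using (A>0; C>0)
  open ArrayConditions Γ G H using (n>0; A+1>0)
  open Quadratic (+ α - + 3 - + β - + γ) (+ 3 * + β + + γ - + 3 * + α)

  private
    A B C : ℤ
    A = + α
    B = + β
    C = + γ

    module Q = ArraySpectral (quadratic-domain nonsquare) Γ G H
    open Domain (quadratic-domain nonsquare) using () renaming (Carrier to K)

    t : K
    t = + 0 , + 1

    root : (t ⊕ ⊝ (+ 3 , + 0)) ⊛ ((A , + 0) ⊕ t) ≡ ((B , + 0) ⊕ (C , + 0)) ⊛ t ⊕ ⊝ ((+ 3 , + 0) ⊛ (B , + 0) ⊕ (C , + 0))
    root = cong₂ _,_ (lemma A B C) (lemma′ A B C)
      where
      lemma : ∀ A B C → (+ 0 - + 3) * (A + + 0) - (+ 3 * B + C - + 3 * A) * ((+ 1 - + 0) * (+ 0 + + 1)) ≡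
        ((B + C) * + 0 - (+ 3 * B + C - + 3 * A) * ((+ 0 + + 0) * + 1)) + ℤ.- (+ 3 * B - (+ 3 * B + C - + 3 * A) * (+ 0 * + 0) + C)
      lemma = ℤRing.solve-∀
      lemma′ : ∀ A B C → (+ 0 - + 3) * (+ 0 + + 1) + (+ 1 - + 0) * (A + + 0) - (A - + 3 - B - C) * ((+ 1 - + 0) * (+ 0 + + 1)) ≡
        ((B + C) * + 1 + (+ 0 + + 0) * + 0 - (A - + 3 - B - C) * ((+ 0 + + 0) * + 1)) +
        ℤ.- (+ 3 * + 0 + + 0 * B - (A - + 3 - B - C) * (+ 0 * + 0) + + 0)
      lemma′ = ℤRing.solve-∀

    A+t≢0 : (A , + 0) ⊕ t ≢ (+ 0 , + 0)
    A+t≢0 eq = contradiction (cong proj₂ eq) λ ()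

    module Minimal = Q.Minimal t root A+t≢0
    open DomainProperties (quadratic-domain nonsquare) using (evalℤ)

    x y ℓ : ℤ
    x = evalℤ Minimal.rational-part
    y = evalℤ Minimal.irrational-part
    ℓ = evalℤ Minimal.leading

    components : ∀ {m} → (ℓ , + 0) ≡ (+ m , + 0) ⊛ ((x , + 0) ⊕ (y , + 0) ⊛ t) → ℓ ≡ + m * x × + 0 ≡ + m * y
    components {m} eq = trans (cong proj₁ eq) (lemma P x y (+ m)) , trans (cong proj₂ eq) (lemma′ P S x y (+ m))
      where
      S P : ℤ
      S = A - + 3 - B - C
      P = + 3 * B + C - + 3 * A
      lemma : ∀ P x y m → m * (x + (y * + 0 - P * (+ 0 * + 1))) - P * (+ 0 * (+ 0 + (y * + 1 + + 0 * + 0 - P * (+ 0 * + 1)))) ≡ m * x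
      lemma = ℤRing.solve-∀
      lemma′ : ∀ P S x y m → m * (+ 0 + (y * + 1 + + 0 * + 0 - S * (+ 0 * + 1))) + + 0 * (x + (y * + 0 - P * (+ 0 * + 1))) -
        S * (+ 0 * (+ 0 + (y * + 1 + + 0 * + 0 - S * (+ 0 * + 1)))) ≡ m * y
      lemma′ = ℤRing.solve-∀

    ℓ≢0 : ℓ ≢ 0ℤ
    ℓ≢0 ℓ≡0 = ℤ.<-irrefl (sym ℓ≡0) (*-pos {+ n} {C * (+ 6 * A * (A + + 1))} n>0
      (*-pos {C} {+ 6 * A * (A + + 1)} C>0 (*-pos {+ 6 * A} {A + + 1} (*-pos {+ 6} {A} (ℤ.+<+ (s≤s z≤n)) A>0) A+1>0)))

  -- With t = τ, the two coordinates of ℓ = m (x + y τ) give m x = ℓ ≠ 0 and m y = 0, hence y = 0.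
  vanishing : Vanishing A B C
  vanishing = go Minimal.linear-multiplicity
    where
    go : ∃[ m ] (ℓ , + 0) ≡ (+ m , + 0) ⊛ ((x , + 0) ⊕ (y , + 0) ⊛ t) → Vanishing A B C
    go (m , eq) = ℤ.i-j≡0⇒i≡j _ _ (conclude (ℤ.i*j≡0⇒i≡0∨j≡0 (+ m) (sym (proj₂ (components {m} eq)))))
      where
      conclude : + m ≡ 0ℤ ⊎ y ≡ 0ℤ → y ≡ 0ℤ
      conclude (inj₂ y≡0) = y≡0
      conclude (inj₁ m≡0) = contradiction (trans (proj₁ (components {m} eq)) (cong (_* x) m≡0)) ℓ≢0

classification : ∀ {n} (Γ : Graph n) (G : DistanceRegular Γ 3) {α β γ : ℕ} → HasArray G α β γ → 3 ℕ.≤ α →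
  0ℤ ≤ + 3 * + α - + β - + γ → (α , β , γ) ∈ arrays
classification Γ G {α} {β} {γ} H α≥3 a₂≥0 = by-discriminant (square? _)
  where
  open Classification Γ G H α≥3 a₂≥0
  exclude : ∀ {α β γ} → HasArray G α β γ → (α , β , γ) ∈ candidates → (α , β , γ) ∈ arrays
  exclude H (here refl)  = ⊥-elim (FinalCount.impossible Γ G H)
  exclude _ (there rest) = rest
  S P : ℤ
  S = + α - + 3 - + β - + γ
  P = + 3 * + β + + γ - + 3 * + α
  by-discriminant : (∃[ d ] S * S - + 4 * P ≡ + d * + d) ⊎ (∀ d → S * S - + 4 * P ≢ d * d) → (α , β , γ) ∈ arrays
  by-discriminant (inj₁ (d , D≡d²)) = exclude H (Square.square-case d D≡d²)
  by-discriminant (inj₂ nonsquare)  = ⊥-elim (Irrational.irrational-impossible α β γ (proj₁ r∃) α≥3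
    (HasArray.β≥1 H) (HasArray.γ≥1 H) (proj₂ r∃) (ArrayConditions.krein₁₁₁ Γ G H) (NonSquare.vanishing Γ G H nonsquare))

-- The array of a Shilla graph with b(Γ) = 3

toArray : ℕ × ℕ × ℕ → Vec ℕ 3 × Vec ℕ 3
toArray (α , β , γ) = (3 ℕ.* α ∷ 2 ℕ.* α ℕ.+ 2 ∷ β ∷ []) , (1 ∷ γ ∷ 2 ℕ.* α ∷ [])

module _ {n} (Γ : Graph n) (S : Shilla Γ) (b≡3 : Shilla.bΓ S ≡ + 3) where
  open Shilla S
  open Parameters Γ distanceRegular

  private
    a₃ : ∃[ α ] a 3F ≡ + α
    a₃ = a≥0 3F λ ()
    α β γ : ℕ
    α = proj₁ a₃
    β = b 2F
    γ = c 2F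

    a₃≡ : a 3F ≡ + α
    a₃≡ = proj₂ a₃

    k≡ : + valency ≡ + 3 * + α
    k≡ = trans (relation (proj₁ θ₁≡a₃)) (trans (cong₂ _*_ a₃≡ b≡3) (ℤ.*-comm (+ α) (+ 3)))
      where
      relation : IsEigenvalue (adjacencyMatrix Γ) (fromℤ (a 3F)) → + valency ≡ a 3F * (a 3F - a 1F)
      relation (v , v≉0 , eigen) = eigenvalue-relation v eigen v≉0

    a₁≡ : a 1F ≡ + α - + 3
    a₁≡ = trans (lemma (a 3F) (a 1F)) (cong₂ _-_ a₃≡ b≡3)
      where
      lemma : ∀ p q → q ≡ p - (p - q)
      lemma = ℤRing.solve-∀

    -- The difference α - 3 is a₁, a number of vertices.
    α≥3 : 3 ℕ.≤ α
    α≥3 = go (a≥0 1F λ ())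
      where
      go : ∃[ m ] a 1F ≡ + m → 3 ℕ.≤ α
      go (m , eq) = ℤ.drop‿+≤+ (ℤ.0≤i-j⇒j≤i {+ α} {+ 3} (subst (0ℤ ≤_) (trans (sym eq) a₁≡) (ℤ.+≤+ z≤n)))

    rearrange : ∀ {k p q r} → k - p - q ≡ r → p ≡ k - q - r
    rearrange {k} {p} {q} eq = trans (lemma k p q) (cong (λ s → k - q - s) eq)
      where
      lemma : ∀ k p q → p ≡ k - q - (k - p - q)
      lemma = ℤRing.solve-∀

    b₁≡ : + b 1F ≡ + 2 * + α + + 2
    b₁≡ = trans (rearrange {+ valency} {+ b 1F} {+ c 1F} a₁≡) (trans (cong₂ (λ k q → k - q - (+ α - + 3)) k≡ (cong +_ c₁≡1)) (lemma (+ α)))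
      where
      lemma : ∀ α → + 3 * α - + 1 - (α - + 3) ≡ + 2 * α + + 2
      lemma = ℤRing.solve-∀

    c₃≡ : + c 3F ≡ + 2 * + α
    c₃≡ = trans (lemma (+ valency) (+ b 3F) (+ c 3F)) (trans (cong₂ _-_ (cong₂ (λ k q → k - + q) k≡ b₃≡0) a₃≡) (lemma′ (+ α)))
      where
      lemma : ∀ k p q → q ≡ k - p - (k - p - q)
      lemma = ℤRing.solve-∀
      lemma′ : ∀ α → + 3 * α - + 0 - α ≡ + 2 * α
      lemma′ = ℤRing.solve-∀

    a₂≡ : a 2F ≡ + 3 * + α - + β - + γ
    a₂≡ = cong (λ k → k - + β - + γ) k≡

    a₂≥0 : 0ℤ ≤ + 3 * + α - + β - + γ
    a₂≥0 = subst (0ℤ ≤_) (trans (sym (proj₂ a₂)) a₂≡) (ℤ.+≤+ z≤n)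
      where
      a₂ : ∃[ m ] a 2F ≡ + m
      a₂ = a≥0 2F λ ()

    H : HasArray distanceRegular α β γ
    H = record
      { k≡ = k≡ ; b₁≡ = b₁≡ ; b₂≡ = refl ; c₁≡ = cong +_ c₁≡1 ; c₂≡ = refl ; c₃≡ = c₃≡
      ; a₁≡ = a₁≡ ; a₂≡ = a₂≡ ; a₃≡ = a₃≡
      ; α≥1 = ℕ.≤-trans (s≤s z≤n) α≥3 ; β≥1 = b₂≥1 ; γ≥1 = c₂≥1
      }

    3α≡ : 3 ℕ.* α ≡ b 0F
    3α≡ = ℤ.+-injective (trans (ℤ.pos-* 3 α) (sym k≡))

    2α+2≡ : 2 ℕ.* α ℕ.+ 2 ≡ b 1F
    2α+2≡ = ℤ.+-injective (trans (cong (_+ + 2) (ℤ.pos-* 2 α)) (sym b₁≡))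

    2α≡ : 2 ℕ.* α ≡ c 3F
    2α≡ = ℤ.+-injective (trans (ℤ.pos-* 2 α) (sym c₃≡))

    array≡ : toArray (α , β , γ) ≡ intersectionArray
    array≡ = cong₂ _,_ (cong₂ (λ p q → p ∷ q ∷ β ∷ []) 3α≡ 2α+2≡) (cong₂ (λ p q → p ∷ γ ∷ q ∷ []) (sym c₁≡1) 2α≡)

  array-listed : intersectionArray ∈ map toArray arrays
  array-listed = subst (_∈ map toArray arrays) array≡ (∈-map⁺ toArray (classification Γ distanceRegular H α≥3 a₂≥0))

theorem19 : ∀ {n} (Γ : Graph n) (S : Shilla Γ) → Shilla.bΓ S ≡ + 3 →
    Shilla.intersectionArray S ∈
      ( (12 ∷ 10 ∷ 5 ∷ [] , 1 ∷ 1 ∷ 8 ∷ [])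
      ∷ (12 ∷ 10 ∷ 2 ∷ [] , 1 ∷ 2 ∷ 8 ∷ [])
      ∷ (12 ∷ 10 ∷ 3 ∷ [] , 1 ∷ 3 ∷ 8 ∷ [])
      ∷ (15 ∷ 12 ∷ 6 ∷ [] , 1 ∷ 2 ∷ 10 ∷ [])
      ∷ (24 ∷ 18 ∷ 9 ∷ [] , 1 ∷ 1 ∷ 16 ∷ [])
      ∷ (27 ∷ 20 ∷ 10 ∷ [] , 1 ∷ 2 ∷ 18 ∷ [])
      ∷ (30 ∷ 22 ∷ 9 ∷ [] , 1 ∷ 3 ∷ 20 ∷ [])
      ∷ (42 ∷ 30 ∷ 12 ∷ [] , 1 ∷ 6 ∷ 28 ∷ [])
      ∷ (60 ∷ 42 ∷ 18 ∷ [] , 1 ∷ 6 ∷ 40 ∷ [])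
      ∷ (69 ∷ 48 ∷ 24 ∷ [] , 1 ∷ 4 ∷ 46 ∷ [])
      ∷ (93 ∷ 64 ∷ 24 ∷ [] , 1 ∷ 6 ∷ 62 ∷ [])
      ∷ (105 ∷ 72 ∷ 24 ∷ [] , 1 ∷ 12 ∷ 70 ∷ [])
      ∷ [])
theorem19 = array-listed
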